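{- Define $\lambda:\mathcal H\to\mathbf{QSym}$ on the class of a topology $\mathcal T$ on a finite set $X$ by $\lambda(\mathcal T)=\sum_{f\in\mathcal L_{\mathcal T}(Z)}\prod_{x\in X}f(x)$, where $Z$ is an infinite denumerable totally ordered alphabet of commuting variables and $\mathbf{QSym}(Z)$ is identified with $\mathbf{QSym}$; equivalently $\lambda(\mathcal T)=\sum_{(X_1,\dots,X_k)}M_{(|X_1|,\dots,|X_k|)}$, the sum over all set compositions $(X_1,\dots,X_k)$ of $X$ such that for $x\in X_i,y\in X_j$, $x<_{\mathcal T}y\Rightarrow i<j$ and $x\sim_{\mathcal T}y\Rightarrow i=j$. Then $\lambda$ is a Hopf algebra morphism from $(\mathcal H,\cdot,\Delta)$ to $(\mathbf{QSym},\cdot,\Delta)$, and it is compatible with the internal coproducts: $(\lambda\otimes\lambda)\circ\Gamma=\rho\circ\lambda$.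
   Context: For a topology $\mathcal T$ on a finite set $X$: $x\le_{\mathcal T}y$ iff every open set containing $x$ contains $y$ (open sets = final segments); $x\sim_{\mathcal T}y$ iff $x\le_{\mathcal T}y\le_{\mathcal T}x$; $x<_{\mathcal T}y$ iff $x\le_{\mathcal T}y$ and not $y\le_{\mathcal T}x$; $\mathcal T|_Y=\{W\cap Y:W\in\mathcal T\}$; $Y$ is $\mathcal T$-connected if $(Y,\mathcal T|_Y)$ is connected. $\mathcal L_{\mathcal T}(Z)$ is the set of maps $f:X\to Z$ with $x<_{\mathcal T}y\Rightarrow f(x)<f(y)$ and $x\sim_{\mathcal T}y\Rightarrow f(x)=f(y)$. $\mathcal H=\bigoplus_n\mathcal H_n$ is spanned by homeomorphism classes of topologies on $n$-element sets ($\mathcal H_0=K\mathbf 1$), with product induced by $\mathcal T_1\mathcal T_2$ on $X_1\sqcup X_2$ ($Y$ open iff $Y\cap X_i\in\mathcal T_i$), coproduct $\Delta(\mathcal T)=\sum_{Y\in\mathcal T}\mathcal T|_{X\setminus Y}\otimes\mathcal T|_Y$, and internal coproduct $\Gamma(\mathcal T)=\sum\mathcal T'\otimes\mathcal T/\mathcal T'$ over $\mathcal T$-admissible $\mathcal T'$; here $\mathcal T'\prec\mathcal T$ means every $\mathcal T$-open set is $\mathcal T'$-open, $\mathcal T/\mathcal T'$ is the topology on $X$ with quasi-order the transitive closure of $x\,\mathcal R\,y\iff(x\le_{\mathcal T}y\text{ or }y\le_{\mathcal T'}x)$, and $\mathcal T'$ is $\mathcal T$-admissible if $\mathcal T'\prec\mathcal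 T$, $\mathcal T'|_Y=\mathcal T|_Y$ for every $\mathcal T'$-connected $Y$, and $x\sim_{\mathcal T/\mathcal T'}y\iff x\sim_{\mathcal T'/\mathcal T'}y$. $\mathbf{QSym}$ has basis $M_c$ indexed by compositions $c=(c_1,\dots,c_k)$ (finite sequences of positive integers, the empty one giving the unit), realized as $M_c(Z)=\sum_{z_1<\dots<z_k}z_1^{c_1}\cdots z_k^{c_k}$. For $i_1,\dots,i_p\ge0$, $\mathrm{QSh}(i_1,\dots,i_p)$ is the set of surjections $u:[i_1+\dots+i_p]\to[\max u]$ strictly increasing on each consecutive block of sizes $i_1,\dots,i_p$. Structure: $M_{(c_1,\dots,c_k)}M_{(c_{k+1},\dots,c_{k+l})}=\sum_{\sigma\in\mathrm{QSh}(k,l)}M_{(\sum_{\sigma(i)=1}c_i,\dots,\sum_{\sigma(i)=\max\sigma}c_i)}$; $\Delta(M_{(c_1,\dots,c_k)})=\sum_{i=0}^kM_{(c_1,\dots,c_i)}\otimes M_{(c_{i+1},\dots,c_k)}$; $\rho(M_{(c_1,\dots,c_k)})=\sum_{i_1+\dots+i_p=k,\,i_j\ge1}M_{(c_1,\dots,c_{i_1})}\cdots M_{(c_{i_1+\dots+i_{p-1}+1},\dots,c_k)}\otimes M_{(C_1,\dots,C_p)}$ with $C_j=c_{i_1+\dots+i_{j-1}+1}+\dots+c_{i_1+\dots+i_j}$. -}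

module Defs where

open import Data.Nat using (ℕ; zero; suc; _+_; _≡ᵇ_; _<ᵇ_)
open import Data.Bool using (Bool; true; false; _∧_; _∨_; not)
open import Data.Fin using (Fin; toℕ)
open import Data.Vec as V using (Vec; []; _∷_)
open import Data.List as L using (List; []; _∷_; concatMap; upTo; allFin; length; _++_)
open import Data.Nat.ListAction using (sum)
open import Data.Bool.ListAction using (and; or)
open import Data.Product using (_×_; _,_; Σ; proj₁; proj₂)
open import Function.Bundles using (_⤖_; Bijection)
open import Relation.Binary.PropositionalEquality using (_≡_)

allB : {A : Set} → (A → Bool) → List A → Bool
allB p xs = and (L.map p xs)

anyB : {A : Set} → (A → Bool) → List A → Bool
anyB p xs = or (L.map p xs)

filterB : {A : Set} → (A → Bool) → List A → List A
filterB p [] = []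
filterB p (x ∷ xs) with p x
... | true  = x ∷ filterB p xs
... | false = filterB p xs

countB : {A : Set} → (A → Bool) → List A → ℕ
countB p xs = length (filterB p xs)

iffB : Bool → Bool → Bool
iffB a b = (a ∧ b) ∨ (not a ∧ not b)

finEq : {m : ℕ} → Fin m → Fin m → Bool
finEq i j = toℕ i ≡ᵇ toℕ j

finLt : {m : ℕ} → Fin m → Fin m → Bool
finLt i j = toℕ i <ᵇ toℕ j

boolVecEq : {n : ℕ} → Vec Bool n → Vec Bool n → Bool
boolVecEq [] [] = true
boolVecEq (a ∷ u) (b ∷ v) = iffB a b ∧ boolVecEq u v

natListEq : List ℕ → List ℕ → Bool
natListEq [] [] = true
natListEq (a ∷ u) (b ∷ v) = (a ≡ᵇ b) ∧ natListEq u v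
natListEq _ _ = false

subsets : (n : ℕ) → List (Vec Bool n)
subsets zero = [] ∷ []
subsets (suc n) = concatMap (λ v → (true ∷ v) ∷ (false ∷ v) ∷ []) (subsets n)

maps : (m N : ℕ) → List (Vec (Fin m) N)
maps m zero = [] ∷ []
maps m (suc N) = concatMap (λ v → L.map (λ i → i ∷ v) (allFin m)) (maps m N)

sublists : {A : Set} → List A → List (List A)
sublists [] = [] ∷ []
sublists (x ∷ xs) = concatMap (λ s → (x ∷ s) ∷ s ∷ []) (sublists xs)

memVec : {n : ℕ} → Vec Bool n → List (Vec Bool n) → Bool
memVec v fam = anyB (boolVecEq v) fam

surjB : {m N : ℕ} → Vec (Fin m) N → Bool
surjB {m} {N} u = allB (λ j → anyB (λ x → finEq (V.lookup u x) j) (allFin N)) (allFin m)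

incrList : {m : ℕ} → List (Fin m) → Bool
incrList [] = true
incrList (a ∷ []) = true
incrList (a ∷ b ∷ xs) = finLt a b ∧ incrList (b ∷ xs)

record Top : Set where
  constructor top
  field
    size   : ℕ
    isOpen : Vec Bool size → Bool
open Top public

∅ₛ : (n : ℕ) → Vec Bool n
∅ₛ n = V.replicate n false

Xₛ : (n : ℕ) → Vec Bool n
Xₛ n = V.replicate n true

_∪ₛ_ : {n : ℕ} → Vec Bool n → Vec Bool n → Vec Bool n
U ∪ₛ W = V.zipWith _∨_ U W

_∩ₛ_ : {n : ℕ} → Vec Bool n → Vec Bool n → Vec Bool n
U ∩ₛ W = V.zipWith _∧_ U W

isTopologyB : Top → Bool
isTopologyB (top n O) =
  O (∅ₛ n) ∧ O (Xₛ n) ∧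
  allB (λ U → allB (λ W → not (O U ∧ O W) ∨ (O (U ∪ₛ W) ∧ O (U ∩ₛ W))) (subsets n)) (subsets n)

IsTopology : Top → Set
IsTopology T = isTopologyB T ≡ true

leqT : (T : Top) → Fin (size T) → Fin (size T) → Bool
leqT (top n O) x y = allB (λ W → not (O W ∧ V.lookup W x) ∨ V.lookup W y) (subsets n)

simT : (T : Top) → Fin (size T) → Fin (size T) → Bool
simT T x y = leqT T x y ∧ leqT T y x

ltT : (T : Top) → Fin (size T) → Fin (size T) → Bool
ltT T x y = leqT T x y ∧ not (leqT T y x)

Homeomorphic : Top → Top → Set
Homeomorphic T₁ T₂ =
  Σ (Fin (size T₁) ⤖ Fin (size T₂)) λ σ →
    (W : Vec Bool (size T₂)) →
      isOpen T₂ W ≡ isOpen T₁ (V.tabulate (λ x → V.lookup W (Bijection.to σ x)))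

-- QSym with basis M_c, c a composition (List ℕ).  An element with
-- nonnegative integer coefficients is a formal sum = list of basis
-- compositions (with multiplicity).  Equality = equal coefficients.

QS : Set
QS = List (List ℕ)

QS⊗ : Set
QS⊗ = List (List ℕ × List ℕ)

coeff : List ℕ → QS → ℕ
coeff c p = countB (natListEq c) p

coeff⊗ : List ℕ → List ℕ → QS⊗ → ℕ
coeff⊗ c d p = countB (λ cd → natListEq c (proj₁ cd) ∧ natListEq d (proj₂ cd)) p

_≈Q_ : QS → QS → Set
p ≈Q q = (c : List ℕ) → coeff c p ≡ coeff c q

_≈⊗_ : QS⊗ → QS⊗ → Set
p ≈⊗ q = (c d : List ℕ) → coeff⊗ c d p ≡ coeff⊗ c d q

oneQ : QS
oneQ = [] ∷ []

counitQ : QS → ℕ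
counitQ p = coeff [] p

QSh : (k l : ℕ) → List (Σ ℕ λ m → Vec (Fin m) (k + l))
QSh k l = concatMap (λ m → L.map (λ u → m , u)
            (filterB (λ u → surjB u ∧ incrList (V.toList (V.take k u))
                                    ∧ incrList (V.toList (V.drop k u)))
                     (maps m (k + l))))
          (upTo (suc (k + l)))

packComp : (m : ℕ) → List (Fin m) → List ℕ → List ℕ
packComp m us cs =
  L.map (λ j → sum (L.map proj₂ (filterB (λ p → finEq (proj₁ p) j) (L.zip us cs)))) (allFin m)

mulM : List ℕ → List ℕ → QS
mulM c d = L.map (λ mu → packComp (proj₁ mu) (V.toList (proj₂ mu)) (c ++ d))
                 (QSh (length c) (length d))

mulQ : QS → QS → QS
mulQ p q = concatMap (λ c → concatMap (λ d → mulM c d) q) p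

ΔM : List ℕ → QS⊗
ΔM c = L.map (λ i → L.take i c , L.drop i c) (upTo (suc (length c)))

ΔQ : QS → QS⊗
ΔQ p = concatMap ΔM p

cuts : List ℕ → List (List (List ℕ))
cuts [] = [] ∷ []
cuts (x ∷ xs) = concatMap ext (cuts xs)
  where
  ext : List (List ℕ) → List (List (List ℕ))
  ext [] = ((x ∷ []) ∷ []) ∷ []
  ext (s ∷ ss) = ((x ∷ s) ∷ ss) ∷ ((x ∷ []) ∷ s ∷ ss) ∷ []

mulAll : List (List ℕ) → QS
mulAll segs = L.foldr (λ s acc → mulQ (s ∷ []) acc) oneQ segs

ρM : List ℕ → QS⊗
ρM c = concatMap (λ segs → L.map (λ a → a , L.map sum segs) (mulAll segs)) (cuts c)

ρQ : QS → QS⊗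
ρQ p = concatMap ρM p

-- The morphism λ : sum over set compositions (X₁,…,X_k) of X (encoded
-- as surjections f : X → [k], X_i = f⁻¹(i)) compatible with T.

blockSizes : {n k : ℕ} → Vec (Fin k) n → List ℕ
blockSizes {n} {k} f = L.map (λ j → countB (λ x → finEq (V.lookup f x) j) (allFin n)) (allFin k)

compatible : (T : Top) {k : ℕ} → Vec (Fin k) (size T) → Bool
compatible T f =
  allB (λ x → allB (λ y →
      (not (ltT T x y) ∨ finLt (V.lookup f x) (V.lookup f y)) ∧
      (not (simT T x y) ∨ finEq (V.lookup f x) (V.lookup f y)))
    (allFin (size T))) (allFin (size T))

lam : Top → QS
lam T = concatMap (λ k → L.map blockSizes
                    (filterB (λ f → surjB f ∧ compatible T f) (maps k (size T))))
                  (upTo (suc (size T)))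

lam⊗ : List (Top × Top) → QS⊗
lam⊗ ps = concatMap (λ p → concatMap (λ c → L.map (λ d → c , d) (lam (proj₂ p))) (lam (proj₁ p))) ps

unitT : Top
unitT = top 0 (λ _ → true)

counitH : Top → ℕ
counitH (top zero _) = 1
counitH (top (suc _) _) = 0

prodT : Top → Top → Top
prodT (top n₁ O₁) (top n₂ O₂) = top (n₁ + n₂) (λ Y → O₁ (V.take n₁ Y) ∧ O₂ (V.drop n₁ Y))

card : {n : ℕ} → Vec Bool n → ℕ
card [] = 0
card (true ∷ v) = suc (card v)
card (false ∷ v) = card v

emb : {n : ℕ} (Y : Vec Bool n) → Fin (card Y) → Fin n
emb (true ∷ Y) Fin.zero = Fin.zero
emb (true ∷ Y) (Fin.suc i) = Fin.suc (emb Y i)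
emb (false ∷ Y) i = Fin.suc (emb Y i)

restrict : (T : Top) → Vec Bool (size T) → Top
restrict (top n O) Y =
  top (card Y) (λ U → anyB (λ W → O W ∧ boolVecEq U (V.tabulate (λ i → V.lookup W (emb Y i))))
                            (subsets n))

ΔH : Top → List (Top × Top)
ΔH T = L.map (λ Y → restrict T (V.map not Y) , restrict T Y) (filterB (isOpen T) (subsets (size T)))

-- T/T' : topology whose opens are the final segments of the transitive
-- closure of x R y ⇔ (x ≤_T y or y ≤_T' x), i.e. the R-upward-closed sets
quotT : (T : Top) → (Vec Bool (size T) → Bool) → Top
quotT T O' =
  top (size T) (λ Y → allB (λ x → allB (λ y →
        not (V.lookup Y x ∧ (leqT T x y ∨ leqT (top (size T) O') y x)) ∨ V.lookup Y y)
      (allFin (size T))) (allFin (size T)))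

finerB : {n : ℕ} → (O' O : Vec Bool n → Bool) → Bool
finerB {n} O' O = allB (λ W → not (O W) ∨ O' W) (subsets n)

connectedB : {n : ℕ} → (Vec Bool n → Bool) → Vec Bool n → Bool
connectedB {n} O Y = not (anyB (λ U → anyB (λ W →
     O U ∧ O W ∧
     anyB (λ x → V.lookup Y x ∧ V.lookup U x) (allFin n) ∧
     anyB (λ x → V.lookup Y x ∧ V.lookup W x) (allFin n) ∧
     allB (λ x → not (V.lookup Y x) ∨ (V.lookup U x ∨ V.lookup W x)) (allFin n) ∧
     allB (λ x → not (V.lookup Y x ∧ V.lookup U x ∧ V.lookup W x)) (allFin n))
   (subsets n)) (subsets n))

sameRestrB : {n : ℕ} → (O' O : Vec Bool n → Bool) → Vec Bool n → Bool
sameRestrB {n} O' O Y = allB (λ U →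
    iffB (anyB (λ W → O' W ∧ boolVecEq (W ∩ₛ Y) U) (subsets n))
         (anyB (λ W → O W ∧ boolVecEq (W ∩ₛ Y) U) (subsets n)))
  (subsets n)

admissibleB : (T : Top) → (Vec Bool (size T) → Bool) → Bool
admissibleB T O' =
  finerB O' (isOpen T) ∧
  allB (λ Y → not (connectedB O' Y) ∨ sameRestrB O' (isOpen T) Y) (subsets (size T)) ∧
  allB (λ x → allB (λ y →
      iffB (simT (quotT T O') x y)
           (simT (quotT T' O') x y))
    (allFin (size T))) (allFin (size T))
  where
  T' : Top
  T' = top (size T) O'

topologiesOn : (n : ℕ) → List (Vec Bool n → Bool)
topologiesOn n = filterB (λ O → isTopologyB (top n O))
                         (L.map (λ fam W → memVec W fam) (sublists (subsets n)))

ΓH : Top → List (Top × Top)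
ΓH T = L.map (λ O' → top (size T) O' , quotT T O')
             (filterB (admissibleB T) (topologiesOn (size T)))

{-# OPTIONS --safe #-}

-- Everything is read off coefficients, as in the power-series realisation of QSym.  For a weak
-- composition c (zeros allowed) let N_T(c) be the number of compatible, not necessarily surjective,
-- maps X → [m] with fibre sizes c.  N_T(c) only depends on c with its zeros removed and is then the
-- coefficient of λ(T).  In the same way the coefficient of c in a product of quasi-symmetric
-- functions is a convolution over all ways of writing c = α + β entrywise, and the coefficient of
-- M_c ⊗ M_d in ρ is a sum over matrices with column sums c and row sums d.  Products and coproducts
-- then amount to bijections of compatible maps: a map on X₁ ⊔ X₂ is a pair of maps; a compatible
-- map to [k + l] is an open set Y (the preimage of the last l values) with compatible maps on X ∖ Y
-- and Y; a compatible map to [p] × [m] ordered lexicographically is a pair (g , f).  For the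
-- internal coproduct, exactly one admissible T′ has f compatible with T′ and g compatible with
-- T / T′ when (g , f) is lexicographically compatible with T, namely x ≤_T′ y ⇔ x ≤_T y and
-- g x = g y, and none otherwise.

module Submission where

open import Defs
open import Data.Bool using (Bool; true; false; _∧_; _∨_; not; if_then_else_)
open import Data.Bool.Properties using (T-≡)
open import Data.Empty using (⊥; ⊥-elim)
open import Data.Fin as F using (Fin; toℕ; _↑ˡ_; _↑ʳ_; combine)
open import Data.Fin.Properties as FP using (toℕ-injective)
open import Data.List as L using (List; []; _∷_; _++_; allFin; applyUpTo; concatMap; length; null; upTo; zipWith)
open import Data.List.Membership.Propositional using (_∈_)
open import Data.List.Membership.Propositional.Properties using (∈-allFin; ∈-concatMap⁺)
open import Data.List.Properties using (length-++; length-tabulate; map-tabulate; map-upTo; tabulate-cong)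
import Data.List.Relation.Unary.All as All
import Data.List.Relation.Unary.All.Properties as AllP
import Data.List.Relation.Unary.AllPairs as AllPairs
import Data.List.Relation.Unary.AllPairs.Properties as AllPairsP
open import Data.List.Relation.Unary.Any as Any using (here; there)
open import Data.List.Relation.Binary.Disjoint.Propositional using (Disjoint)
open import Data.List.Relation.Unary.Unique.Propositional using (Unique; []; _∷_)
open import Data.List.Relation.Unary.Unique.Propositional.Properties using (concat⁺)
open import Data.Nat using (ℕ; zero; suc; _+_; _*_; _≤_; _<_; _≡ᵇ_; _≤ᵇ_; z≤n; s≤s)
open import Data.Nat.ListAction using (sum)
open import Data.Nat.Properties
open import Data.Nat.Solver using (module +-*-Solver)
open +-*-Solver using (solve; _:+_; _:*_; _:=_; con)
open import Data.Product using (_×_; _,_; Σ; ∃; proj₁; proj₂; map₁; map₂)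
open import Data.Sum using (_⊎_; inj₁; inj₂; swap)
open import Data.Vec as V using (Vec; []; _∷_)
import Data.Vec.Properties as VP
open import Function using (_∘_; id; case_of_)
open import Function.Bundles using (Bijection; Equivalence)
open import Relation.Nullary using (¬_; contradiction; yes; no)
open import Relation.Binary.PropositionalEquality

-- Boolean reflection

-- The bijections are carried out on indicator sums: a set is a list, a condition is a factor
-- `⟦ b ⟧`, and a bijection becomes an exchange of summations; the lemmas named with `δ` evaluate
-- the sum of an indicator. Zeros in compositions make the recursions uniform: when c = α + β
-- entrywise, an index may be missed by one factor, so a quasi-shuffle is a pair of independent
-- increasing placements. Surjectivity turns into positivity of c and leaves the sum as the factor
-- `⟦ posB c ⟧`. Formal sums also admit lists with zeros as labels, so the formulas for products and
-- for `ρ` are restricted to elements whose labels are genuine compositions; `Positive` records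
-- this. Topologies on X are Boolean predicates enumerated through sublists of the list of subsets.
-- The unique T′ is therefore determined up to pointwise equality of predicates, and it has to be
-- counted that exactly one sublist has the required membership function.

bool-ext : ∀ {a b} → (a ≡ true → b ≡ true) → (b ≡ true → a ≡ true) → a ≡ b
bool-ext {true}  {b}     p q = sym (p refl)
bool-ext {false} {true}  p q = q refl
bool-ext {false} {false} p q = refl

∧⁺ : ∀ {a b} → a ≡ true → b ≡ true → a ∧ b ≡ true
∧⁺ refl q = q

∧⁻ˡ : ∀ {a b} → a ∧ b ≡ true → a ≡ true
∧⁻ˡ {true} p = refl

∧⁻ʳ : ∀ {a b} → a ∧ b ≡ true → b ≡ true
∧⁻ʳ {true} p = p

∨⁻ : ∀ {a b} → a ∨ b ≡ true → a ≡ true ⊎ b ≡ true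
∨⁻ {true}  p = inj₁ refl
∨⁻ {false} p = inj₂ p

∨⁺ˡ : ∀ {a b} → a ≡ true → a ∨ b ≡ true
∨⁺ˡ refl = refl

∨⁺ʳ : ∀ {a b} → b ≡ true → a ∨ b ≡ true
∨⁺ʳ {true}  q = refl
∨⁺ʳ {false} q = q

⇒ᵇ⁺ : ∀ {a b} → (a ≡ true → b ≡ true) → not a ∨ b ≡ true
⇒ᵇ⁺ {true}  p = p refl
⇒ᵇ⁺ {false} p = refl

⇒ᵇ⁻ : ∀ {a b} → not a ∨ b ≡ true → a ≡ true → b ≡ true
⇒ᵇ⁻ p refl = p

not⁺ : ∀ {a} → ¬ (a ≡ true) → not a ≡ true
not⁺ {true}  p = ⊥-elim (p refl)
not⁺ {false} p = refl

not⁻ : ∀ {a} → not a ≡ true → ¬ (a ≡ true)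
not⁻ () refl

true? : ∀ a → a ≡ true ⊎ ¬ (a ≡ true)
true? true  = inj₁ refl
true? false = inj₂ λ ()

iffB⁺ : ∀ {a b} → a ≡ b → iffB a b ≡ true
iffB⁺ {true}  refl = refl
iffB⁺ {false} refl = refl

iffB⁻ : ∀ {a b} → iffB a b ≡ true → a ≡ b
iffB⁻ {true}  {true}  p = refl
iffB⁻ {false} {false} p = refl

≡ᵇ⁺ : ∀ {m n} → m ≡ n → (m ≡ᵇ n) ≡ true
≡ᵇ⁺ {m} {n} p = Equivalence.to T-≡ (≡⇒≡ᵇ m n p)

≡ᵇ⁻ : ∀ {m n} → (m ≡ᵇ n) ≡ true → m ≡ n
≡ᵇ⁻ {m} {n} p = ≡ᵇ⇒≡ m n (Equivalence.from T-≡ p)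

finEq⁺ : ∀ {m} {i j : Fin m} → i ≡ j → finEq i j ≡ true
finEq⁺ p = ≡ᵇ⁺ (cong toℕ p)

finEq⁻ : ∀ {m} {i j : Fin m} → finEq i j ≡ true → i ≡ j
finEq⁻ p = toℕ-injective (≡ᵇ⁻ p)

finLt⁺ : ∀ {m} {i j : Fin m} → i F.< j → finLt i j ≡ true
finLt⁺ p = Equivalence.to T-≡ (<⇒<ᵇ p)

finLt⁻ : ∀ {m} {i j : Fin m} → finLt i j ≡ true → i F.< j
finLt⁻ {i = i} {j} p = <ᵇ⇒< (toℕ i) (toℕ j) (Equivalence.from T-≡ p)

natListEq⁺ : ∀ {a b} → a ≡ b → natListEq a b ≡ true
natListEq⁺ {[]}    refl = refl
natListEq⁺ {x ∷ a} refl = ∧⁺ (≡ᵇ⁺ {x} refl) (natListEq⁺ {a} refl)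

natListEq⁻ : ∀ {a b} → natListEq a b ≡ true → a ≡ b
natListEq⁻ {[]}    {[]}    p = refl
natListEq⁻ {x ∷ a} {y ∷ b} p = cong₂ _∷_ (≡ᵇ⁻ (∧⁻ˡ p)) (natListEq⁻ (∧⁻ʳ {x ≡ᵇ y} p))

boolVecEq⁺ : ∀ {n} {U W : Vec Bool n} → U ≡ W → boolVecEq U W ≡ true
boolVecEq⁺ {U = []}    refl = refl
boolVecEq⁺ {U = a ∷ U} refl = ∧⁺ (iffB⁺ {a} refl) (boolVecEq⁺ {U = U} refl)

boolVecEq⁻ : ∀ {n} {U W : Vec Bool n} → boolVecEq U W ≡ true → U ≡ W
boolVecEq⁻ {U = []}    {[]}    p = refl
boolVecEq⁻ {U = a ∷ U} {b ∷ W} p = cong₂ _∷_ (iffB⁻ (∧⁻ˡ p)) (boolVecEq⁻ (∧⁻ʳ {iffB a b} p))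

allB⁺ : ∀ {A : Set} {p : A → Bool} xs → (∀ x → p x ≡ true) → allB p xs ≡ true
allB⁺ []       h = refl
allB⁺ (x ∷ xs) h = ∧⁺ (h x) (allB⁺ xs h)

allB⁻ : ∀ {A : Set} {p : A → Bool} {xs x} → allB p xs ≡ true → x ∈ xs → p x ≡ true
allB⁻ h (here refl) = ∧⁻ˡ h
allB⁻ {p = p} {y ∷ _} h (there i) = allB⁻ (∧⁻ʳ {p y} h) i

anyB⁺ : ∀ {A : Set} {p : A → Bool} {xs x} → x ∈ xs → p x ≡ true → anyB p xs ≡ true
anyB⁺ (here refl) h = ∨⁺ˡ h
anyB⁺ (there i)   h = ∨⁺ʳ (anyB⁺ i h)

anyB⁻ : ∀ {A : Set} {p : A → Bool} xs → anyB p xs ≡ true → ∃ λ x → p x ≡ true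
anyB⁻ {p = p} (x ∷ xs) h with ∨⁻ {p x} h
... | inj₁ q = x , q
... | inj₂ q = anyB⁻ xs q

∈-subsets : ∀ {n} (W : Vec Bool n) → W ∈ subsets n
∈-subsets []          = here refl
∈-subsets (true ∷ W)  = ∈-concatMap⁺ _ (Any.map (λ where refl → here refl) (∈-subsets W))
∈-subsets (false ∷ W) = ∈-concatMap⁺ _ (Any.map (λ where refl → there (here refl)) (∈-subsets W))

allFinB⁻ : ∀ {n} {p : Fin n → Bool} → allB p (allFin n) ≡ true → ∀ i → p i ≡ true
allFinB⁻ h i = allB⁻ h (∈-allFin i)

anyFinB⁺ : ∀ {n} {p : Fin n → Bool} i → p i ≡ true → anyB p (allFin n) ≡ true
anyFinB⁺ i = anyB⁺ (∈-allFin i)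

allSubsetsB⁻ : ∀ {n} {p : Vec Bool n → Bool} → allB p (subsets n) ≡ true → ∀ W → p W ≡ true
allSubsetsB⁻ h W = allB⁻ h (∈-subsets W)

anySubsetsB⁺ : ∀ {n} {p : Vec Bool n → Bool} W → p W ≡ true → anyB p (subsets n) ≡ true
anySubsetsB⁺ W = anyB⁺ (∈-subsets W)

-- Finite sums of natural numbers

⟦_⟧ : Bool → ℕ
⟦ true ⟧  = 1
⟦ false ⟧ = 0

∑ : {A : Set} → List A → (A → ℕ) → ℕ
∑ []       f = 0
∑ (x ∷ xs) f = f x + ∑ xs f

⟦∧⟧ : ∀ a b → ⟦ a ∧ b ⟧ ≡ ⟦ a ⟧ * ⟦ b ⟧
⟦∧⟧ true  b = sym (+-identityʳ ⟦ b ⟧)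
⟦∧⟧ false b = refl

+-congʳ : ∀ {a b c : ℕ} → b ≡ c → a + b ≡ a + c
+-congʳ refl = refl

+-congˡ : ∀ {a b c : ℕ} → a ≡ b → a + c ≡ b + c
+-congˡ refl = refl

guard : ∀ b {x y} → (b ≡ true → x ≡ y) → ⟦ b ⟧ * x ≡ ⟦ b ⟧ * y
guard true  p = cong (1 *_) (p refl)
guard false p = refl

-- Used to impose a condition that every nonzero term satisfies anyway, so that a sum can be cut
-- down to the terms where it holds.
guard-drop : ∀ b {x} → (¬ (b ≡ true) → x ≡ 0) → ⟦ b ⟧ * x ≡ x
guard-drop true  p = +-identityʳ _
guard-drop false p = sym (p λ ())

⟦⟧-false : ∀ {b} → ¬ (b ≡ true) → ⟦ b ⟧ ≡ 0
⟦⟧-false {true}  p = ⊥-elim (p refl)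
⟦⟧-false {false} p = refl

module _ {A : Set} where

  ∑-cong : ∀ xs {f g : A → ℕ} → (∀ x → f x ≡ g x) → ∑ xs f ≡ ∑ xs g
  ∑-cong []       p = refl
  ∑-cong (x ∷ xs) p = cong₂ _+_ (p x) (∑-cong xs p)

  ∑-zero : ∀ xs {f : A → ℕ} → (∀ x → f x ≡ 0) → ∑ xs f ≡ 0
  ∑-zero []       p = refl
  ∑-zero (x ∷ xs) p = cong₂ _+_ (p x) (∑-zero xs p)

  ∑-++ : ∀ xs ys {f : A → ℕ} → ∑ (xs ++ ys) f ≡ ∑ xs f + ∑ ys f
  ∑-++ []       ys     = refl
  ∑-++ (x ∷ xs) ys {f} = trans (cong (f x +_) (∑-++ xs ys)) (sym (+-assoc (f x) _ _))

  ∑-+ : ∀ xs {f g : A → ℕ} → ∑ xs (λ x → f x + g x) ≡ ∑ xs f + ∑ xs g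
  ∑-+ [] = refl
  ∑-+ (x ∷ xs) {f} {g} rewrite ∑-+ xs {f} {g} =
    solve 4 (λ a b c d → a :+ b :+ (c :+ d) := a :+ c :+ (b :+ d)) refl (f x) (g x) _ _

  ∑-*ˡ : ∀ xs a {f : A → ℕ} → ∑ xs (λ x → a * f x) ≡ a * ∑ xs f
  ∑-*ˡ []       a     = sym (*-zeroʳ a)
  ∑-*ˡ (x ∷ xs) a {f} = trans (cong (a * f x +_) (∑-*ˡ xs a)) (sym (*-distribˡ-+ a (f x) _))

  ∑-*ʳ : ∀ xs a {f : A → ℕ} → ∑ xs (λ x → f x * a) ≡ ∑ xs f * a
  ∑-*ʳ []       a     = refl
  ∑-*ʳ (x ∷ xs) a {f} = trans (cong (f x * a +_) (∑-*ʳ xs a)) (sym (*-distribʳ-+ a (f x) _))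

  ∑-map : ∀ {B : Set} (h : B → A) xs {f : A → ℕ} → ∑ (L.map h xs) f ≡ ∑ xs (f ∘ h)
  ∑-map h []       = refl
  ∑-map h (x ∷ xs) = +-congʳ (∑-map h xs)

  ∑-concatMap : ∀ {B : Set} (h : B → List A) xs {f : A → ℕ} →
                ∑ (concatMap h xs) f ≡ ∑ xs (λ x → ∑ (h x) f)
  ∑-concatMap h []       = refl
  ∑-concatMap h (x ∷ xs) = trans (∑-++ (h x) _) (+-congʳ (∑-concatMap h xs))

  ∑-filterB : ∀ (p : A → Bool) xs {f : A → ℕ} → ∑ (filterB p xs) f ≡ ∑ xs (λ x → ⟦ p x ⟧ * f x)
  ∑-filterB p [] = refl
  ∑-filterB p (x ∷ xs) {f} with p x
  ... | true  = cong₂ _+_ (sym (+-identityʳ (f x))) (∑-filterB p xs)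
  ... | false = ∑-filterB p xs

  countB-∑ : ∀ (p : A → Bool) xs → countB p xs ≡ ∑ xs (λ x → ⟦ p x ⟧)
  countB-∑ p [] = refl
  countB-∑ p (x ∷ xs) with p x
  ... | true  = cong suc (countB-∑ p xs)
  ... | false = countB-∑ p xs

∑-swap : ∀ {A B : Set} xs ys {f : A → B → ℕ} →
         ∑ xs (λ x → ∑ ys (f x)) ≡ ∑ ys (λ y → ∑ xs (λ x → f x y))
∑-swap []       ys = sym (∑-zero ys λ _ → refl)
∑-swap (x ∷ xs) ys = trans (+-congʳ (∑-swap xs ys)) (sym (∑-+ ys))

∑-product : ∀ {A B : Set} xs ys {f : A → ℕ} {g : B → ℕ} →
            ∑ xs f * ∑ ys g ≡ ∑ xs (λ x → ∑ ys (λ y → f x * g y))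
∑-product xs ys {f} = trans (sym (∑-*ʳ xs _)) (∑-cong xs λ x → sym (∑-*ˡ ys (f x)))

∑-tabulate : ∀ {A : Set} {n} (g : Fin n → A) {f : A → ℕ} → ∑ (L.tabulate g) f ≡ ∑ (allFin n) (f ∘ g)
∑-tabulate g {f} = trans (cong (λ xs → ∑ xs f) (sym (map-tabulate id g))) (∑-map g (allFin _))

∑-allFin-suc : ∀ n (f : Fin (suc n) → ℕ) →
               ∑ (allFin (suc n)) f ≡ f F.zero + ∑ (allFin n) (f ∘ F.suc)
∑-allFin-suc n f = +-congʳ {f F.zero} (∑-tabulate {n = n} F.suc {f})

sum-tabulate : ∀ {n} (g : Fin n → ℕ) → sum (L.tabulate g) ≡ ∑ (allFin n) g
sum-tabulate {zero}  g = refl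
sum-tabulate {suc n} g = trans (cong (g F.zero +_) (sum-tabulate (g ∘ F.suc))) (sym (∑-allFin-suc n g))

∑-allFin-+ : ∀ m {n} {f : Fin (m + n) → ℕ} →
             ∑ (allFin (m + n)) f ≡ ∑ (allFin m) (λ i → f (i ↑ˡ n)) + ∑ (allFin n) (λ i → f (m ↑ʳ i))
∑-allFin-+ zero = refl
∑-allFin-+ (suc m) {n} {f} = begin
  ∑ (allFin (suc m + n)) f                      ≡⟨ ∑-allFin-suc (m + n) f ⟩
  f F.zero + ∑ (allFin (m + n)) (f ∘ F.suc)     ≡⟨ cong (f F.zero +_) (∑-allFin-+ m) ⟩
  f F.zero + (∑ (allFin m) (λ i → f (F.suc i ↑ˡ n)) + R)  ≡⟨ +-assoc (f F.zero) _ R ⟨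
  f F.zero + ∑ (allFin m) (λ i → f (F.suc i ↑ˡ n)) + R    ≡⟨ cong (_+ R) (∑-allFin-suc m (λ i → f (i ↑ˡ n))) ⟨
  ∑ (allFin (suc m)) (λ i → f (i ↑ˡ n)) + R               ∎
  where
  open ≡-Reasoning
  R = ∑ (allFin n) (λ i → f (suc m ↑ʳ i))

∑-allFin-* : ∀ p m {f : Fin (p * m) → ℕ} →
             ∑ (allFin (p * m)) f ≡ ∑ (allFin p) (λ i → ∑ (allFin m) (λ j → f (combine i j)))
∑-allFin-* zero    m = refl
∑-allFin-* (suc p) m {f} =
  trans (∑-allFin-+ m)
        (trans (cong (∑ (allFin m) (λ j → f (combine {suc p} F.zero j)) +_) (∑-allFin-* p m))
               (sym (∑-allFin-suc p (λ i → ∑ (allFin m) (λ j → f (combine i j))))))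

∑-allFin-δ : ∀ {n} (i : Fin n) → ∑ (allFin n) (λ j → ⟦ finEq i j ⟧) ≡ 1
∑-allFin-δ {suc n} F.zero    = trans (∑-allFin-suc n (λ j → ⟦ finEq F.zero j ⟧)) (cong suc (∑-zero (allFin n) λ _ → refl))
∑-allFin-δ {suc n} (F.suc i) = trans (∑-allFin-suc n (λ j → ⟦ finEq (F.suc i) j ⟧)) (∑-allFin-δ i)

-- The generator `h` is arbitrary so that the induction can pass to `h ∘ suc`. The last hypothesis
-- covers an index beyond the range: its term is then absent from the sum and must itself be zero.
∑-applyUpTo-single : ∀ n (h : ℕ → ℕ) l (f : ℕ → ℕ) → (∀ k → ¬ (k ≡ l) → f (h k) ≡ 0) →
                     (n ≤ l → f (h l) ≡ 0) → ∑ (applyUpTo h n) f ≡ f (h l)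
∑-applyUpTo-single zero h l f off out = sym (out z≤n)
∑-applyUpTo-single (suc n) h zero f off out =
  trans (cong (f (h 0) +_) (rest n (h ∘ suc) (λ k → off (suc k) λ ()))) (+-identityʳ _)
  where
  rest : ∀ n (h : ℕ → ℕ) → (∀ k → f (h k) ≡ 0) → ∑ (applyUpTo h n) f ≡ 0
  rest zero    h p = refl
  rest (suc n) h p = cong₂ _+_ (p 0) (rest n (h ∘ suc) (p ∘ suc))
∑-applyUpTo-single (suc n) h (suc l) f off out =
  trans (+-congˡ {f (h 0)} (off 0 λ ()))
        (∑-applyUpTo-single n (h ∘ suc) l f (λ k ne → off (suc k) (ne ∘ suc-injective)) (out ∘ s≤s))

∑-upTo-single : ∀ n l (f : ℕ → ℕ) → (∀ k → ¬ (k ≡ l) → f k ≡ 0) → (n ≤ l → f l ≡ 0) →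
                ∑ (upTo n) f ≡ f l
∑-upTo-single n = ∑-applyUpTo-single n id

-- Sums over maps

∑-maps-suc : ∀ m n {f : Vec (Fin m) (suc n) → ℕ} →
             ∑ (maps m (suc n)) f ≡ ∑ (maps m n) (λ v → ∑ (allFin m) (λ i → f (i ∷ v)))
∑-maps-suc m n = trans (∑-concatMap _ (maps m n)) (∑-cong (maps m n) λ v → ∑-map _ (allFin m))

∑-maps-++ : ∀ m n₁ n₂ {f : Vec (Fin m) (n₁ + n₂) → ℕ} →
            ∑ (maps m (n₁ + n₂)) f ≡ ∑ (maps m n₁) (λ u → ∑ (maps m n₂) (λ v → f (u V.++ v)))
∑-maps-++ m zero n₂ = sym (+-identityʳ _)
∑-maps-++ m (suc n₁) n₂ {f} = begin
  ∑ (maps m (suc n₁ + n₂)) f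
    ≡⟨ ∑-maps-suc m (n₁ + n₂) ⟩
  ∑ (maps m (n₁ + n₂)) (λ w → ∑ (allFin m) (λ i → f (i ∷ w)))
    ≡⟨ ∑-maps-++ m n₁ n₂ ⟩
  ∑ (maps m n₁) (λ u → ∑ (maps m n₂) (λ v → ∑ (allFin m) (λ i → f (i ∷ (u V.++ v)))))
    ≡⟨ ∑-cong (maps m n₁) (λ u → ∑-swap (maps m n₂) (allFin m)) ⟩
  ∑ (maps m n₁) (λ u → ∑ (allFin m) (λ i → ∑ (maps m n₂) (λ v → f (i ∷ (u V.++ v)))))
    ≡⟨ ∑-maps-suc m n₁ ⟨
  _ ∎
  where open ≡-Reasoning

-- `combine` numbers the pairs row by row, so the order of `Fin (p * m)` is the lexicographic one
-- with the first coordinate dominant; in this form pairs (g , f) enter the internal coproduct.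
∑-maps-* : ∀ p m n {f : Vec (Fin (p * m)) n → ℕ} →
           ∑ (maps (p * m) n) f ≡
           ∑ (maps p n) (λ g → ∑ (maps m n) (λ h → f (V.zipWith combine g h)))
∑-maps-* p m zero = sym (+-identityʳ _)
∑-maps-* p m (suc n) {f} = begin
  ∑ (maps (p * m) (suc n)) f
    ≡⟨ ∑-maps-suc (p * m) n ⟩
  ∑ (maps (p * m) n) (λ w → ∑ (allFin (p * m)) (λ k → f (k ∷ w)))
    ≡⟨ ∑-maps-* p m n ⟩
  ∑ (maps p n) (λ g → ∑ (maps m n) (λ h → ∑ (allFin (p * m)) (λ k → f (k ∷ V.zipWith combine g h))))
    ≡⟨ ∑-cong (maps p n) (λ g → trans (∑-cong (maps m n) λ h → ∑-allFin-* p m) (∑-swap (maps m n) (allFin p))) ⟩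
  ∑ (maps p n) (λ g → ∑ (allFin p) (λ i → ∑ (maps m n) (λ h → ∑ (allFin m) (λ j → f (combine i j ∷ V.zipWith combine g h)))))
    ≡⟨ ∑-cong (maps p n) (λ g → ∑-cong (allFin p) λ i → ∑-maps-suc m n) ⟨
  ∑ (maps p n) (λ g → ∑ (allFin p) (λ i → ∑ (maps m (suc n)) (λ h → f (V.zipWith combine (i ∷ g) h))))
    ≡⟨ ∑-maps-suc p n ⟨
  _ ∎
  where open ≡-Reasoning

allV : {A : Set} {n : ℕ} → (A → Bool) → Vec A n → Bool
allV p []      = true
allV p (x ∷ v) = p x ∧ allV p v

allV⁺ : ∀ {A : Set} {n} {p : A → Bool} (v : Vec A n) → (∀ i → p (V.lookup v i) ≡ true) → allV p v ≡ true
allV⁺ []      h = refl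
allV⁺ (x ∷ v) h = ∧⁺ (h F.zero) (allV⁺ v (h ∘ F.suc))

-- The hypothesis says that `ι` runs once through the values satisfying `p`; the induction applies
-- it coordinate by coordinate. It serves for the nonzero values (`ι` the successor) and for the
-- support of a weak composition (`ι` its increasing enumeration).
∑-maps-image : ∀ {m′ m} (p : Fin m → Bool) (ι : Fin m′ → Fin m) →
  (∀ (g : Fin m → ℕ) → ∑ (allFin m) (λ i → ⟦ p i ⟧ * g i) ≡ ∑ (allFin m′) (g ∘ ι)) →
  ∀ n {f : Vec (Fin m) n → ℕ} →
  ∑ (maps m n) (λ v → ⟦ allV p v ⟧ * f v) ≡ ∑ (maps m′ n) (λ v → f (V.map ι v))
∑-maps-image p ι enum zero = cong (_+ 0) (+-identityʳ _)
∑-maps-image {m′} {m} p ι enum (suc n) {f} = begin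
  ∑ (maps m (suc n)) (λ v → ⟦ allV p v ⟧ * f v)
    ≡⟨ ∑-maps-suc m n ⟩
  ∑ (maps m n) (λ v → ∑ (allFin m) (λ i → ⟦ p i ∧ allV p v ⟧ * f (i ∷ v)))
    ≡⟨ ∑-cong (maps m n) (λ v → trans (∑-cong (allFin m) λ i → factor i v) (∑-*ˡ (allFin m) ⟦ allV p v ⟧)) ⟩
  ∑ (maps m n) (λ v → ⟦ allV p v ⟧ * ∑ (allFin m) (λ i → ⟦ p i ⟧ * f (i ∷ v)))
    ≡⟨ ∑-maps-image p ι enum n ⟩
  ∑ (maps m′ n) (λ v → ∑ (allFin m) (λ i → ⟦ p i ⟧ * f (i ∷ V.map ι v)))
    ≡⟨ ∑-cong (maps m′ n) (λ v → enum _) ⟩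
  ∑ (maps m′ n) (λ v → ∑ (allFin m′) (λ i → f (ι i ∷ V.map ι v)))
    ≡⟨ ∑-maps-suc m′ n ⟨
  _ ∎
  where
  open ≡-Reasoning
  factor : ∀ i v → ⟦ p i ∧ allV p v ⟧ * f (i ∷ v) ≡ ⟦ allV p v ⟧ * (⟦ p i ⟧ * f (i ∷ v))
  factor i v rewrite ⟦∧⟧ (p i) (allV p v) =
    solve 3 (λ a b c → a :* b :* c := b :* (a :* c)) refl ⟦ p i ⟧ ⟦ allV p v ⟧ (f (i ∷ v))

∑-emb : ∀ {n} (Y : Vec Bool n) (g : Fin n → ℕ) →
        ∑ (allFin n) (λ i → ⟦ V.lookup Y i ⟧ * g i) ≡ ∑ (allFin (card Y)) (g ∘ emb Y)
∑-emb [] g = refl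
∑-emb {suc n} (true ∷ Y) g =
  trans (∑-allFin-suc n (λ i → ⟦ V.lookup (true ∷ Y) i ⟧ * g i))
        (trans (cong₂ _+_ (+-identityʳ (g F.zero)) (∑-emb Y (g ∘ F.suc)))
               (sym (∑-allFin-suc (card Y) (g ∘ emb (true ∷ Y)))))
∑-emb {suc n} (false ∷ Y) g =
  trans (∑-allFin-suc n (λ i → ⟦ V.lookup (false ∷ Y) i ⟧ * g i)) (∑-emb Y (g ∘ F.suc))

*-congˡ : ∀ {a b c : ℕ} → a ≡ b → a * c ≡ b * c
*-congˡ refl = refl

∑-cong-∈ : ∀ {A : Set} xs {f g : A → ℕ} → (∀ x → x ∈ xs → f x ≡ g x) → ∑ xs f ≡ ∑ xs g
∑-cong-∈ []       p = refl
∑-cong-∈ (x ∷ xs) p = cong₂ _+_ (p x (here refl)) (∑-cong-∈ xs λ y i → p y (there i))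

-- Weak compositions

posB : List ℕ → Bool
posB []          = true
posB (zero  ∷ c) = false
posB (suc x ∷ c) = posB c

consᶜ : ℕ → List ℕ → List ℕ
consᶜ zero    c = c
consᶜ (suc x) c = suc x ∷ c

compress : List ℕ → List ℕ
compress []      = []
compress (x ∷ c) = consᶜ x (compress c)

compress-pos : ∀ {c} → posB c ≡ true → compress c ≡ c
compress-pos {[]}        p = refl
compress-pos {suc x ∷ c} p = cong (suc x ∷_) (compress-pos p)

posB-compress : ∀ c → posB (compress c) ≡ true
posB-compress []          = refl
posB-compress (zero  ∷ c) = posB-compress c
posB-compress (suc x ∷ c) = posB-compress c

compress-++ : ∀ a b → compress (a ++ b) ≡ compress a ++ compress b
compress-++ []          b = refl
compress-++ (zero  ∷ a) b = compress-++ a b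
compress-++ (suc x ∷ a) b = cong (suc x ∷_) (compress-++ a b)

sum-compress : ∀ c → sum (compress c) ≡ sum c
sum-compress []          = refl
sum-compress (zero  ∷ c) = sum-compress c
sum-compress (suc x ∷ c) = cong (suc x +_) (sum-compress c)

posB-tabulate⁺ : ∀ {n} (g : Fin n → ℕ) → (∀ i → ¬ (g i ≡ 0)) → posB (L.tabulate g) ≡ true
posB-tabulate⁺ {zero}  g h = refl
posB-tabulate⁺ {suc n} g h with g F.zero in eq
... | zero  = ⊥-elim (h F.zero eq)
... | suc _ = posB-tabulate⁺ (g ∘ F.suc) (h ∘ F.suc)

posB-tabulate⁻ : ∀ {n} (g : Fin n → ℕ) → posB (L.tabulate g) ≡ true → ∀ i → ¬ (g i ≡ 0)
posB-tabulate⁻ {suc n} g h i with g F.zero in eq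
posB-tabulate⁻ {suc n} g h F.zero    | suc _ = λ p → case trans (sym eq) p of λ ()
posB-tabulate⁻ {suc n} g h (F.suc i) | suc _ = posB-tabulate⁻ (g ∘ F.suc) h i

natListEq-zeros : ∀ c → natListEq c (L.tabulate {n = length c} (λ _ → 0)) ≡ natListEq (compress c) []
natListEq-zeros []          = refl
natListEq-zeros (zero  ∷ c) = natListEq-zeros c
natListEq-zeros (suc x ∷ c) = refl

natListEq-++ : ∀ a b {a′ b′} → length a ≡ length a′ →
               natListEq (a ++ b) (a′ ++ b′) ≡ natListEq a a′ ∧ natListEq b b′
natListEq-++ []      b {[]}     p = refl
natListEq-++ (x ∷ a) b {y ∷ a′} p with x ≡ᵇ y
... | true  = natListEq-++ a b (suc-injective p)
... | false = refl

natListEq-tabulate⁻ : ∀ {c k} (g : Fin k → ℕ) → natListEq c (L.tabulate g) ≡ true → k ≡ length c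
natListEq-tabulate⁻ {c} g p = trans (sym (length-tabulate g)) (cong length (sym (natListEq⁻ {c} p)))

splitℕ : ℕ → List (ℕ × ℕ)
splitℕ zero    = (0 , 0) ∷ []
splitℕ (suc x) = (0 , suc x) ∷ L.map (map₁ suc) (splitℕ x)

-- All pairs (α , β) of weak compositions of the length of c with α + β = c entrywise.
splits : List ℕ → List (List ℕ × List ℕ)
splits []      = ([] , []) ∷ []
splits (x ∷ c) = concatMap (λ (α , β) → L.map (λ (i , j) → i ∷ α , j ∷ β) (splitℕ x)) (splits c)

∑-splits-∷ : ∀ x c {f : List ℕ × List ℕ → ℕ} →
  ∑ (splits (x ∷ c)) f ≡ ∑ (splits c) (λ (α , β) → ∑ (splitℕ x) (λ (i , j) → f (i ∷ α , j ∷ β)))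
∑-splits-∷ x c = trans (∑-concatMap _ (splits c)) (∑-cong (splits c) λ _ → ∑-map _ (splitℕ x))

∑-cong-splits : ∀ c {f g : List ℕ × List ℕ → ℕ} →
  (∀ α β → length α ≡ length c → length β ≡ length c → f (α , β) ≡ g (α , β)) →
  ∑ (splits c) f ≡ ∑ (splits c) g
∑-cong-splits []      p = cong (_+ 0) (p [] [] refl refl)
∑-cong-splits (x ∷ c) p =
  trans (∑-splits-∷ x c)
    (trans (∑-cong-splits c λ α β ea eb → ∑-cong (splitℕ x) λ (i , j) → p (i ∷ α) (j ∷ β) (cong suc ea) (cong suc eb))
           (sym (∑-splits-∷ x c)))

splitℕ-δ : ∀ x a b → ∑ (splitℕ x) (λ (i , j) → ⟦ i ≡ᵇ a ⟧ * ⟦ j ≡ᵇ b ⟧) ≡ ⟦ x ≡ᵇ a + b ⟧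
splitℕ-δ zero    zero    b = solve 1 (λ z → z :+ con 0 :+ con 0 := z) refl ⟦ 0 ≡ᵇ b ⟧
splitℕ-δ zero    (suc a) b = refl
splitℕ-δ (suc x) zero    b =
  trans (cong₂ _+_ (+-identityʳ _) (trans (∑-map _ (splitℕ x)) (∑-zero (splitℕ x) λ _ → refl))) (+-identityʳ _)
splitℕ-δ (suc x) (suc a) b = trans (∑-map _ (splitℕ x)) (splitℕ-δ x a b)

_⊕_ : List ℕ → List ℕ → List ℕ
_⊕_ = zipWith _+_

tabulate-⊕ : ∀ {n} (f g : Fin n → ℕ) → L.tabulate f ⊕ L.tabulate g ≡ L.tabulate (λ i → f i + g i)
tabulate-⊕ {zero}  f g = refl
tabulate-⊕ {suc n} f g = cong₂ _∷_ refl (tabulate-⊕ (f ∘ F.suc) (g ∘ F.suc))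

-- The entries split independently, so the sum is a product of the one-entry sums `splitℕ-δ`. Equal
-- lengths matter because `⊕` truncates to the shorter list.
splits-δ : ∀ c a b → length a ≡ length b →
  ∑ (splits c) (λ (α , β) → ⟦ natListEq α a ⟧ * ⟦ natListEq β b ⟧) ≡ ⟦ natListEq c (a ⊕ b) ⟧
splits-δ []      []      []      p = refl
splits-δ []      (_ ∷ a) (_ ∷ b) p = refl
splits-δ (x ∷ c) []      []      p =
  trans (∑-splits-∷ x c) (∑-zero (splits c) λ _ → ∑-zero (splitℕ x) λ _ → refl)
splits-δ (x ∷ c) (y ∷ a) (z ∷ b) p = begin
  ∑ (splits (x ∷ c)) (λ (α , β) → ⟦ natListEq α (y ∷ a) ⟧ * ⟦ natListEq β (z ∷ b) ⟧)
    ≡⟨ ∑-splits-∷ x c ⟩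
  ∑ (splits c) (λ (α , β) → ∑ (splitℕ x) (λ (i , j) →
      ⟦ (i ≡ᵇ y) ∧ natListEq α a ⟧ * ⟦ (j ≡ᵇ z) ∧ natListEq β b ⟧))
    ≡⟨ ∑-cong (splits c) (λ (α , β) → trans (∑-cong (splitℕ x) λ (i , j) → factor (i ≡ᵇ y) (j ≡ᵇ z) (natListEq α a) (natListEq β b)) (∑-*ʳ (splitℕ x) (⟦ natListEq α a ⟧ * ⟦ natListEq β b ⟧))) ⟩
  ∑ (splits c) (λ (α , β) → ∑ (splitℕ x) (λ (i , j) → ⟦ i ≡ᵇ y ⟧ * ⟦ j ≡ᵇ z ⟧) * (⟦ natListEq α a ⟧ * ⟦ natListEq β b ⟧))
    ≡⟨ ∑-*ˡ (splits c) (∑ (splitℕ x) (λ (i , j) → ⟦ i ≡ᵇ y ⟧ * ⟦ j ≡ᵇ z ⟧)) ⟩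
  _ ≡⟨ cong₂ _*_ (splitℕ-δ x y z) (splits-δ c a b (suc-injective p)) ⟩
  ⟦ x ≡ᵇ y + z ⟧ * ⟦ natListEq c (a ⊕ b) ⟧
    ≡⟨ ⟦∧⟧ (x ≡ᵇ y + z) _ ⟨
  ⟦ natListEq (x ∷ c) ((y ∷ a) ⊕ (z ∷ b)) ⟧ ∎
  where
  open ≡-Reasoning
  factor : ∀ s t u v → ⟦ s ∧ u ⟧ * ⟦ t ∧ v ⟧ ≡ ⟦ s ⟧ * ⟦ t ⟧ * (⟦ u ⟧ * ⟦ v ⟧)
  factor s t u v rewrite ⟦∧⟧ s u | ⟦∧⟧ t v =
    solve 4 (λ s t u v → s :* u :* (t :* v) := s :* t :* (u :* v)) refl ⟦ s ⟧ ⟦ t ⟧ ⟦ u ⟧ ⟦ v ⟧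

-- Expanding the indicator of c = a + b by `splits-δ` decouples x from y. Both the quasi-shuffle
-- product of basis elements and the maps on a disjoint union are evaluated this way.
∑-convolution : ∀ {A B : Set} xs ys c (p : A → ℕ) (q : B → ℕ) (a : A → List ℕ) (b : B → List ℕ) →
  (∀ x y → length (a x) ≡ length (b y)) →
  ∑ xs (λ x → ∑ ys (λ y → p x * q y * ⟦ natListEq c (a x ⊕ b y) ⟧)) ≡
  ∑ (splits c) (λ (α , β) → ∑ xs (λ x → p x * ⟦ natListEq α (a x) ⟧) * ∑ ys (λ y → q y * ⟦ natListEq β (b y) ⟧))
∑-convolution xs ys c p q a b len = begin
  ∑ xs (λ x → ∑ ys (λ y → p x * q y * ⟦ natListEq c (a x ⊕ b y) ⟧))
    ≡⟨ ∑-cong xs (λ x → ∑-cong ys λ y → trans (cong (p x * q y *_) (sym (splits-δ c (a x) (b y) (len x y)))) (sym (∑-*ˡ (splits c) (p x * q y)))) ⟩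
  ∑ xs (λ x → ∑ ys (λ y → ∑ (splits c) (λ (α , β) → p x * q y * (⟦ natListEq α (a x) ⟧ * ⟦ natListEq β (b y) ⟧))))
    ≡⟨ ∑-cong xs (λ x → ∑-swap ys (splits c)) ⟩
  ∑ xs (λ x → ∑ (splits c) (λ (α , β) → ∑ ys (λ y → p x * q y * (⟦ natListEq α (a x) ⟧ * ⟦ natListEq β (b y) ⟧))))
    ≡⟨ ∑-swap xs (splits c) ⟩
  ∑ (splits c) (λ (α , β) → ∑ xs (λ x → ∑ ys (λ y → p x * q y * (⟦ natListEq α (a x) ⟧ * ⟦ natListEq β (b y) ⟧))))
    ≡⟨ ∑-cong (splits c) (λ (α , β) → trans (∑-cong xs λ x → ∑-cong ys λ y → interchange (p x) (q y) _ _) (sym (∑-product xs ys))) ⟩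
  _ ∎
  where
  open ≡-Reasoning
  interchange : ∀ s t u v → s * t * (u * v) ≡ s * u * (t * v)
  interchange = solve 4 (λ s t u v → s :* t :* (u :* v) := s :* u :* (t :* v)) refl

-- A zero of `c` can only split as 0 + 0, and `compress` erases it from both halves; hence the
-- summand is a function of the compressed halves.
∑-splits-compress : ∀ c (f : List ℕ → List ℕ → ℕ) →
  ∑ (splits (compress c)) (λ (α , β) → f (compress α) (compress β)) ≡
  ∑ (splits c) (λ (α , β) → f (compress α) (compress β))
∑-splits-compress []          f = refl
∑-splits-compress (zero  ∷ c) f =
  trans (∑-splits-compress c f) (sym (trans (∑-splits-∷ 0 c) (∑-cong (splits c) λ _ → +-identityʳ _)))
∑-splits-compress (suc x ∷ c) f =
  trans (∑-splits-∷ (suc x) (compress c))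
    (trans (∑-splits-compress c λ α β → ∑ (splitℕ (suc x)) λ (i , j) → f (consᶜ i α) (consᶜ j β))
           (sym (∑-splits-∷ (suc x) c)))

-- Coefficients of products

coeff-∑ : ∀ c p → coeff c p ≡ ∑ p (λ a → ⟦ natListEq c a ⟧)
coeff-∑ c p = countB-∑ (natListEq c) p

-- Stated on coefficients, not on entries of the list, because the coefficient formulas for products
-- and for λ(T) yield it at once; `coeff-∈` gives back the statement about entries.
record Positive (p : QS) : Set where
  constructor positive
  field vanish : ∀ c → ¬ (posB c ≡ true) → coeff c p ≡ 0

open Positive

coeff-∈ : ∀ {c p} → c ∈ p → ¬ (coeff c p ≡ 0)
coeff-∈ {c} {p} i eq = go p i (trans (sym (coeff-∑ c p)) eq)
  where
  go : ∀ p → c ∈ p → ¬ (∑ p (λ a → ⟦ natListEq c a ⟧) ≡ 0)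
  go (a ∷ p) (here refl) e rewrite natListEq⁺ {c} refl = case e of λ ()
  go (a ∷ p) (there i)   e = go p i (m+n≡0⇒n≡0 ⟦ natListEq c a ⟧ e)

∑-cong-Positive : ∀ {p} → Positive p → {f g : List ℕ → ℕ} → (∀ a → posB a ≡ true → f a ≡ g a) →
                  ∑ p f ≡ ∑ p g
∑-cong-Positive {p} pos h = ∑-cong-∈ p λ a i → case true? (posB a) of λ where
  (inj₁ q) → h a q
  (inj₂ q) → contradiction (vanish pos a q) (coeff-∈ i)

-- The exponent of the variable numbered `j` in the monomial that raises, for each position, the
-- variable named by `u` to the part of `a` in that position.
weight : ∀ {m} (a : List ℕ) → Vec (Fin m) (length a) → Fin m → ℕ
weight []      []      j = 0
weight (x ∷ a) (i ∷ u) j = ⟦ finEq i j ⟧ * x + weight a u j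

weight≢0⁺ : ∀ {m} (a : List ℕ) (u : Vec (Fin m) (length a)) x → posB a ≡ true → ¬ (weight a u (V.lookup u x) ≡ 0)
weight≢0⁺ (suc y ∷ a) (i ∷ u) F.zero p e rewrite finEq⁺ {i = i} refl = case e of λ ()
weight≢0⁺ (suc y ∷ a) (i ∷ u) (F.suc x) p e =
  weight≢0⁺ a u x p (m+n≡0⇒n≡0 (⟦ finEq i (V.lookup u x) ⟧ * suc y) e)

weight≢0⁻ : ∀ {m} (a : List ℕ) (u : Vec (Fin m) (length a)) j → ¬ (weight a u j ≡ 0) → ∃ λ x → V.lookup u x ≡ j
weight≢0⁻ []      []      j ne = ⊥-elim (ne refl)
weight≢0⁻ (y ∷ a) (i ∷ u) j ne with true? (finEq i j)
... | inj₁ eq = F.zero , finEq⁻ eq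
... | inj₂ q with weight≢0⁻ a u j (λ e → ne (cong₂ _+_ (cong (_* y) (⟦⟧-false q)) e))
...   | x , eq = F.suc x , eq

packComp-weight : ∀ m (a : List ℕ) (u : Vec (Fin m) (length a)) (b : List ℕ) (v : Vec (Fin m) (length b)) →
  packComp m (V.toList (u V.++ v)) (a ++ b) ≡
  L.tabulate (λ j → weight a u j + weight b v j)
packComp-weight m a u b v =
  trans (map-tabulate id _) (tabulate-cong λ j → trans (entry j (L.zip (V.toList (u V.++ v)) (a ++ b))) (go a u j))
  where
  sum-∑ : ∀ xs → sum (L.map proj₂ xs) ≡ ∑ {Fin m × ℕ} xs proj₂
  sum-∑ []       = refl
  sum-∑ (x ∷ xs) = cong (proj₂ x +_) (sum-∑ xs)
  entry : ∀ j xs → sum (L.map proj₂ (filterB (λ p → finEq (proj₁ p) j) xs)) ≡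
                   ∑ xs (λ p → ⟦ finEq (proj₁ p) j ⟧ * proj₂ p)
  entry j xs = trans (sum-∑ (filterB (λ p → finEq (proj₁ p) j) xs)) (∑-filterB _ xs)
  go₀ : ∀ b (v : Vec (Fin m) (length b)) j →
        ∑ (L.zip (V.toList v) b) (λ p → ⟦ finEq (proj₁ p) j ⟧ * proj₂ p) ≡ weight b v j
  go₀ []      []      j = refl
  go₀ (y ∷ b) (i ∷ v) j = +-congʳ {⟦ finEq i j ⟧ * y} (go₀ b v j)
  go : ∀ a (u : Vec (Fin m) (length a)) j →
       ∑ (L.zip (V.toList (u V.++ v)) (a ++ b)) (λ p → ⟦ finEq (proj₁ p) j ⟧ * proj₂ p) ≡
       weight a u j + weight b v j
  go []      []      j = go₀ b v j
  go (y ∷ a) (i ∷ u) j = trans (+-congʳ {⟦ finEq i j ⟧ * y} (go a u j)) (sym (+-assoc (⟦ finEq i j ⟧ * y) _ _))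

isSuc : ∀ {m} → Fin m → Bool
isSuc F.zero    = false
isSuc (F.suc i) = true

∑-isSuc : ∀ m (g : Fin (suc m) → ℕ) → ∑ (allFin (suc m)) (λ i → ⟦ isSuc i ⟧ * g i) ≡ ∑ (allFin m) (g ∘ F.suc)
∑-isSuc m g = trans (∑-allFin-suc m (λ i → ⟦ isSuc i ⟧ * g i)) (∑-cong (allFin m) λ i → +-identityʳ _)

incrList-suc∷ : ∀ {m k} (i : Fin m) (v : Vec (Fin (suc m)) k) →
                incrList (F.suc i ∷ V.toList v) ≡ true → allV isSuc v ≡ true
incrList-suc∷ i []            p = refl
incrList-suc∷ i (F.suc j ∷ v) p = incrList-suc∷ j v (∧⁻ʳ {finLt i j} p)

-- Strict increase after 0 amounts to avoiding 0 in the tail, which splits off the first placement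
-- and leaves a map into the positive indices.
incrList-zero∷ : ∀ {m k} (v : Vec (Fin (suc m)) k) →
                 incrList (F.zero ∷ V.toList v) ≡ allV isSuc v ∧ incrList (V.toList v)
incrList-zero∷ []            = refl
incrList-zero∷ (F.zero ∷ v)  = refl
incrList-zero∷ (F.suc j ∷ v) = bool-ext (λ p → ∧⁺ (incrList-suc∷ j v p) p) (∧⁻ʳ {allV isSuc v})

incrList-map-suc : ∀ {m k} (v : Vec (Fin m) k) → incrList (V.toList (V.map F.suc v)) ≡ incrList (V.toList v)
incrList-map-suc []          = refl
incrList-map-suc (i ∷ [])    = refl
incrList-map-suc (i ∷ j ∷ v) = cong (finLt i j ∧_) (incrList-map-suc (j ∷ v))

weight-map-suc-zero : ∀ {m} (a : List ℕ) (u : Vec (Fin m) (length a)) → weight a (V.map F.suc u) F.zero ≡ 0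
weight-map-suc-zero []      []      = refl
weight-map-suc-zero (x ∷ a) (i ∷ u) = weight-map-suc-zero a u

weight-map-suc : ∀ {m} (a : List ℕ) (u : Vec (Fin m) (length a)) j → weight a (V.map F.suc u) (F.suc j) ≡ weight a u j
weight-map-suc []      []      j = refl
weight-map-suc (x ∷ a) (i ∷ u) j = +-congʳ {⟦ finEq i j ⟧ * x} (weight-map-suc a u j)

-- A weak composition α arises from exactly one increasing placement of the parts of compress α.
∑-incr : ∀ α a → posB a ≡ true →
  ∑ (maps (length α) (length a))
    (λ u → ⟦ incrList (V.toList u) ⟧ * ⟦ natListEq α (L.tabulate (weight a u)) ⟧)
  ≡ ⟦ natListEq (compress α) a ⟧
∑-incr [] [] p = refl
∑-incr [] (x ∷ a) p = trans (∑-maps-suc 0 (length a)) (∑-zero (maps 0 (length a)) λ _ → refl)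
∑-incr (y ∷ α) [] p =
  trans (+-identityʳ _) (trans (+-identityʳ _) (cong ⟦_⟧ (natListEq-zeros (y ∷ α))))
∑-incr (y ∷ α) (suc x ∷ a) p = begin
  ∑ (maps (suc m) (suc k)) F
    ≡⟨ ∑-maps-suc (suc m) k ⟩
  ∑ (maps (suc m) k) (λ v → ∑ (allFin (suc m)) (λ i → F (i ∷ v)))
    ≡⟨ ∑-cong (maps (suc m) k) (λ v → ∑-allFin-suc m (λ i → F (i ∷ v))) ⟩
  ∑ (maps (suc m) k) (λ v → F (F.zero ∷ v) + ∑ (allFin m) (λ i → F (F.suc i ∷ v)))
    ≡⟨ ∑-+ (maps (suc m) k) ⟩
  ∑ (maps (suc m) k) (λ v → F (F.zero ∷ v)) + ∑ (maps (suc m) k) (λ v → ∑ (allFin m) (λ i → F (F.suc i ∷ v)))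
    -- The first part lands on index 0, where `y` must equal it and the later parts are pushed to
    -- positive indices, or on a positive index, and then all parts do so and `y` must be 0.
    ≡⟨ cong₂ _+_ head-zero head-suc ⟩
  ⟦ y ≡ᵇ suc x ⟧ * ⟦ natListEq (compress α) a ⟧ + ⟦ y ≡ᵇ 0 ⟧ * ⟦ natListEq (compress α) (suc x ∷ a) ⟧
    ≡⟨ combined y ⟩
  ⟦ natListEq (compress (y ∷ α)) (suc x ∷ a) ⟧ ∎
  where
  open ≡-Reasoning
  m = length α
  k = length a
  F : Vec (Fin (suc m)) (suc k) → ℕ
  F u = ⟦ incrList (V.toList u) ⟧ * ⟦ natListEq (y ∷ α) (L.tabulate (weight (suc x ∷ a) u)) ⟧

  combined : ∀ y → ⟦ y ≡ᵇ suc x ⟧ * ⟦ natListEq (compress α) a ⟧ + ⟦ y ≡ᵇ 0 ⟧ * ⟦ natListEq (compress α) (suc x ∷ a) ⟧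
             ≡ ⟦ natListEq (compress (y ∷ α)) (suc x ∷ a) ⟧
  combined zero    = +-identityʳ _
  combined (suc y) = trans (+-identityʳ _) (sym (⟦∧⟧ (y ≡ᵇ x) _))

  rearrange : ∀ s t u → s * (t * u) ≡ t * (s * u)
  rearrange = solve 3 (λ s t u → s :* (t :* u) := t :* (s :* u)) refl

  placed-zero : ∀ v → natListEq (y ∷ α) (L.tabulate (weight (suc x ∷ a) (F.zero ∷ V.map F.suc v)))
                    ≡ (y ≡ᵇ suc x) ∧ natListEq α (L.tabulate (weight a v))
  placed-zero v = cong₂ (λ z c → (y ≡ᵇ z) ∧ natListEq α c)
    (cong suc (trans (cong₂ _+_ (+-identityʳ x) (weight-map-suc-zero a v)) (+-identityʳ x)))
    (tabulate-cong λ j → weight-map-suc a v j)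

  head-zero : ∑ (maps (suc m) k) (λ v → F (F.zero ∷ v)) ≡ ⟦ y ≡ᵇ suc x ⟧ * ⟦ natListEq (compress α) a ⟧
  head-zero = begin
    ∑ (maps (suc m) k) (λ v → F (F.zero ∷ v))
      ≡⟨ ∑-cong (maps (suc m) k) (λ v → trans (*-congˡ (trans (cong ⟦_⟧ (incrList-zero∷ v)) (⟦∧⟧ (allV isSuc v) _))) (*-assoc ⟦ allV isSuc v ⟧ _ _)) ⟩
    ∑ (maps (suc m) k) (λ v → ⟦ allV isSuc v ⟧ * (⟦ incrList (V.toList v) ⟧ * ⟦ natListEq (y ∷ α) (L.tabulate (weight (suc x ∷ a) (F.zero ∷ v))) ⟧))
      ≡⟨ ∑-maps-image isSuc F.suc (∑-isSuc m) k ⟩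
    ∑ (maps m k) (λ v → ⟦ incrList (V.toList (V.map F.suc v)) ⟧ * ⟦ natListEq (y ∷ α) (L.tabulate (weight (suc x ∷ a) (F.zero ∷ V.map F.suc v))) ⟧)
      ≡⟨ ∑-cong (maps m k) (λ v → trans (cong₂ (λ s t → ⟦ s ⟧ * t) (incrList-map-suc v) (trans (cong ⟦_⟧ (placed-zero v)) (⟦∧⟧ (y ≡ᵇ suc x) _))) (rearrange ⟦ incrList (V.toList v) ⟧ ⟦ y ≡ᵇ suc x ⟧ _)) ⟩
    ∑ (maps m k) (λ v → ⟦ y ≡ᵇ suc x ⟧ * (⟦ incrList (V.toList v) ⟧ * ⟦ natListEq α (L.tabulate (weight a v)) ⟧))
      ≡⟨ ∑-*ˡ (maps m k) ⟦ y ≡ᵇ suc x ⟧ ⟩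
    _ ≡⟨ cong (⟦ y ≡ᵇ suc x ⟧ *_) (∑-incr α a p) ⟩
    _ ∎

  placed-suc : ∀ u → natListEq (y ∷ α) (L.tabulate (weight (suc x ∷ a) (V.map F.suc u)))
                   ≡ (y ≡ᵇ 0) ∧ natListEq α (L.tabulate (weight (suc x ∷ a) u))
  placed-suc u = cong₂ (λ z c → (y ≡ᵇ z) ∧ natListEq α c)
    (weight-map-suc-zero (suc x ∷ a) u) (tabulate-cong λ j → weight-map-suc (suc x ∷ a) u j)

  head-suc : ∑ (maps (suc m) k) (λ v → ∑ (allFin m) (λ i → F (F.suc i ∷ v)))
             ≡ ⟦ y ≡ᵇ 0 ⟧ * ⟦ natListEq (compress α) (suc x ∷ a) ⟧
  head-suc = begin
    ∑ (maps (suc m) k) (λ v → ∑ (allFin m) (λ i → F (F.suc i ∷ v)))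
      -- An increasing list that starts at a successor contains successors only, so the guard may be
      -- inserted and the whole map factors through `F.suc`.
      ≡⟨ ∑-cong (maps (suc m) k) (λ v → guard-drop (allV isSuc v) (λ ns → ∑-zero (allFin m) λ i → *-congˡ (⟦⟧-false λ inc → ns (incrList-suc∷ i v inc)))) ⟨
    ∑ (maps (suc m) k) (λ v → ⟦ allV isSuc v ⟧ * ∑ (allFin m) (λ i → F (F.suc i ∷ v)))
      ≡⟨ ∑-maps-image isSuc F.suc (∑-isSuc m) k ⟩
    ∑ (maps m k) (λ v → ∑ (allFin m) (λ i → F (V.map F.suc (i ∷ v))))
      ≡⟨ ∑-maps-suc m k ⟨
    ∑ (maps m (suc k)) (λ u → F (V.map F.suc u))
      ≡⟨ ∑-cong (maps m (suc k)) (λ u → trans (cong₂ (λ s t → ⟦ s ⟧ * t) (incrList-map-suc u) (trans (cong ⟦_⟧ (placed-suc u)) (⟦∧⟧ (y ≡ᵇ 0) _))) (rearrange ⟦ incrList (V.toList u) ⟧ ⟦ y ≡ᵇ 0 ⟧ _)) ⟩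
    ∑ (maps m (suc k)) (λ u → ⟦ y ≡ᵇ 0 ⟧ * (⟦ incrList (V.toList u) ⟧ * ⟦ natListEq α (L.tabulate (weight (suc x ∷ a) u)) ⟧))
      ≡⟨ ∑-*ˡ (maps m (suc k)) ⟦ y ≡ᵇ 0 ⟧ ⟩
    _ ≡⟨ cong (⟦ y ≡ᵇ 0 ⟧ *_) (∑-incr α (suc x ∷ a) p) ⟩
    _ ∎

surjB⁻ : ∀ {m n} (u : Vec (Fin m) n) → surjB u ≡ true → ∀ j → ∃ λ x → V.lookup u x ≡ j
surjB⁻ {n = n} u s j = map₂ finEq⁻ (anyB⁻ (allFin n) (allFinB⁻ s j))

surjB⁺ : ∀ {m n} (u : Vec (Fin m) n) → (∀ j → ∃ λ x → V.lookup u x ≡ j) → surjB u ≡ true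
surjB⁺ {m} u h = allB⁺ (allFin m) λ j → anyFinB⁺ (proj₁ (h j)) (finEq⁺ (proj₂ (h j)))

surjB⇒≤ : ∀ {m n} (u : Vec (Fin m) n) → surjB u ≡ true → m ≤ n
surjB⇒≤ u s = FP.injective⇒≤ {f = λ j → proj₁ (surjB⁻ u s j)} λ {i} {j} eq →
  trans (sym (proj₂ (surjB⁻ u s i))) (trans (cong (V.lookup u) eq) (proj₂ (surjB⁻ u s j)))

take-++ : ∀ {A : Set} {m n} (u : Vec A m) (v : Vec A n) → V.take m (u V.++ v) ≡ u
take-++ []      v = refl
take-++ (x ∷ u) v = cong (x ∷_) (take-++ u v)

drop-++ : ∀ {A : Set} {m n} (u : Vec A m) (v : Vec A n) → V.drop m (u V.++ v) ≡ v
drop-++ []      v = refl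
drop-++ (x ∷ u) v = drop-++ u v

lookup-++-cases : ∀ {A : Set} {m n} (u : Vec A m) (v : Vec A n) {j} x → V.lookup (u V.++ v) x ≡ j →
                  (∃ λ y → V.lookup u y ≡ j) ⊎ (∃ λ y → V.lookup v y ≡ j)
lookup-++-cases []      v x         p = inj₂ (x , p)
lookup-++-cases (a ∷ u) v F.zero    p = inj₁ (F.zero , p)
lookup-++-cases (a ∷ u) v (F.suc x) p with lookup-++-cases u v x p
... | inj₁ (y , q) = inj₁ (F.suc y , q)
... | inj₂ q       = inj₂ q

-- All parts are positive, so an index is hit exactly when its total weight is nonzero.
surjB-weights : ∀ {m} (a b : List ℕ) (u : Vec (Fin m) (length a)) (v : Vec (Fin m) (length b)) →
  posB a ≡ true → posB b ≡ true →
  surjB (u V.++ v) ≡ posB (L.tabulate (λ j → weight a u j + weight b v j))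
surjB-weights a b u v pa pb = bool-ext
  (λ s → posB-tabulate⁺ _ λ j e → case surjB⁻ (u V.++ v) s j of λ where
    (x , eq) → case lookup-++-cases u v x eq of λ where
      (inj₁ (y , refl)) → weight≢0⁺ a u y pa (m+n≡0⇒m≡0 _ e)
      (inj₂ (y , refl)) → weight≢0⁺ b v y pb (m+n≡0⇒n≡0 (weight a u (V.lookup v y)) e))
  (λ p → surjB⁺ (u V.++ v) λ j → hit j (posB-tabulate⁻ _ p j))
  where
  hit : ∀ j → ¬ (weight a u j + weight b v j ≡ 0) → ∃ λ x → V.lookup (u V.++ v) x ≡ j
  hit j ne with weight a u j ≟ 0
  ... | no q with weight≢0⁻ a u j q
  ...   | y , eq = y ↑ˡ length b , trans (VP.lookup-++ˡ u v y) eq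
  hit j ne | yes q with weight≢0⁻ b v j (λ e → ne (cong₂ _+_ q e))
  ...   | y , eq = length a ↑ʳ y , trans (VP.lookup-++ʳ u v y) eq

-- Only maps into `length c` values can produce `c`, and for those that do, surjectivity says no
-- more than positivity of `c`. What remains is a pair of independent increasing placements, counted
-- by `∑-convolution` and `∑-incr`.
coeff-mulM : ∀ c a b → posB a ≡ true → posB b ≡ true →
  coeff c (mulM a b) ≡
  ⟦ posB c ⟧ * ∑ (splits c) (λ (α , β) → ⟦ natListEq (compress α) a ⟧ * ⟦ natListEq (compress β) b ⟧)
coeff-mulM c a b pa pb = begin
  coeff c (mulM a b)
    ≡⟨ coeff-∑ c (mulM a b) ⟩
  ∑ (mulM a b) (λ e → ⟦ natListEq c e ⟧)
    ≡⟨ trans (∑-map (λ (m , u) → packComp m (V.toList u) (a ++ b)) (QSh k l)) (trans (∑-concatMap shuffles (upTo (suc (k + l)))) (∑-cong (upTo (suc (k + l))) λ m →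
         trans (∑-map {Σ ℕ λ m → Vec (Fin m) (k + l)} (λ u → m , u) (filterB (shuffle m) (maps m (k + l)))) (∑-filterB (shuffle m) (maps m (k + l))))) ⟩
  ∑ (upTo (suc (k + l))) (λ m → ∑ (maps m (k + l)) (term m))
    -- A packed composition has as many entries as there are values, which fixes `m`; when
    -- `length c` exceeds the range of the sum, no surjection from `k + l` points exists.
    ≡⟨ ∑-upTo-single (suc (k + l)) n (λ m → ∑ (maps m (k + l)) (term m))
         (λ m ne → ∑-zero (maps m (k + l)) λ u → trans (cong (⟦ shuffle m u ⟧ *_) (⟦⟧-false λ e → ne
            (natListEq-tabulate⁻ {c} (part m u) (trans (cong (natListEq c) (sym (map-tabulate id (part m u)))) e)))) (*-zeroʳ ⟦ shuffle m u ⟧))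
         (λ le → ∑-zero (maps n (k + l)) λ u → *-congˡ {c = ⟦ natListEq c (packComp n (V.toList u) (a ++ b)) ⟧} (⟦⟧-false λ s → ≤⇒≯ (surjB⇒≤ u (∧⁻ˡ {surjB u} s)) le)) ⟩
  ∑ (maps n (k + l)) (term n)
    ≡⟨ ∑-maps-++ n k l ⟩
  ∑ (maps n k) (λ u → ∑ (maps n l) (λ v → term n (u V.++ v)))
    ≡⟨ ∑-cong (maps n k) (λ u → trans (∑-cong (maps n l) (λ v → split-term u v)) (∑-*ˡ (maps n l) ⟦ posB c ⟧)) ⟩
  ∑ (maps n k) (λ u → ⟦ posB c ⟧ * ∑ (maps n l) (λ v → ⟦ incrList (V.toList u) ⟧ * ⟦ incrList (V.toList v) ⟧ * ⟦ natListEq c (L.tabulate (weight a u) ⊕ L.tabulate (weight b v)) ⟧))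
    ≡⟨ ∑-*ˡ (maps n k) ⟦ posB c ⟧ ⟩
  _ ≡⟨ cong (⟦ posB c ⟧ *_) (∑-convolution (maps n k) (maps n l) c (λ u → ⟦ incrList (V.toList u) ⟧) (λ v → ⟦ incrList (V.toList v) ⟧) (λ u → L.tabulate (weight a u)) (λ v → L.tabulate (weight b v))
         (λ u v → trans (length-tabulate (weight a u)) (sym (length-tabulate (weight b v))))) ⟩
  _ ≡⟨ cong (⟦ posB c ⟧ *_) (∑-cong-splits c λ α β ea eb → cong₂ _*_ (place α a pa ea) (place β b pb eb)) ⟩
  _ ∎
  where
  open ≡-Reasoning
  k = length a
  l = length b
  n = length c
  shuffle : ∀ m → Vec (Fin m) (k + l) → Bool
  shuffle m u = surjB u ∧ incrList (V.toList (V.take k u)) ∧ incrList (V.toList (V.drop k u))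
  shuffles : ℕ → List (Σ ℕ λ m → Vec (Fin m) (k + l))
  shuffles m = L.map (λ u → m , u) (filterB (shuffle m) (maps m (k + l)))
  part : ∀ m → Vec (Fin m) (k + l) → Fin m → ℕ
  part m u j = sum (L.map proj₂ (filterB (λ p → finEq (proj₁ p) j) (L.zip (V.toList u) (a ++ b))))
  term : ∀ m → Vec (Fin m) (k + l) → ℕ
  term m u = ⟦ shuffle m u ⟧ * ⟦ natListEq c (packComp m (V.toList u) (a ++ b)) ⟧

  place : ∀ α a → posB a ≡ true → length α ≡ n →
    ∑ (maps n (length a)) (λ u → ⟦ incrList (V.toList u) ⟧ * ⟦ natListEq α (L.tabulate (weight a u)) ⟧)
    ≡ ⟦ natListEq (compress α) a ⟧
  place α a pa ea = subst (λ m → ∑ (maps m (length a)) (λ u → ⟦ incrList (V.toList u) ⟧ * ⟦ natListEq α (L.tabulate (weight a u)) ⟧) ≡ ⟦ natListEq (compress α) a ⟧) ea (∑-incr α a pa)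

  -- Surjectivity may be exchanged for positivity only where the packed weights match `c`, which is
  -- where the indicator `e` is 1.
  indicators : ∀ s i j e p → (e ≡ true → s ≡ p) → ⟦ s ∧ i ∧ j ⟧ * ⟦ e ⟧ ≡ ⟦ p ⟧ * (⟦ i ⟧ * ⟦ j ⟧ * ⟦ e ⟧)
  indicators s i j true p h rewrite h refl | ⟦∧⟧ p (i ∧ j) | ⟦∧⟧ i j =
    solve 3 (λ p i j → p :* (i :* j) :* con 1 := p :* (i :* j :* con 1)) refl ⟦ p ⟧ ⟦ i ⟧ ⟦ j ⟧
  indicators s i j false p h =
    trans (*-zeroʳ ⟦ s ∧ i ∧ j ⟧) (sym (trans (cong (⟦ p ⟧ *_) (*-zeroʳ (⟦ i ⟧ * ⟦ j ⟧))) (*-zeroʳ ⟦ p ⟧)))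

  split-term : ∀ u v → term n (u V.++ v) ≡
    ⟦ posB c ⟧ * (⟦ incrList (V.toList u) ⟧ * ⟦ incrList (V.toList v) ⟧ * ⟦ natListEq c (L.tabulate (weight a u) ⊕ L.tabulate (weight b v)) ⟧)
  split-term u v
    rewrite take-++ u v | drop-++ u v | packComp-weight n a u b v | tabulate-⊕ (weight a u) (weight b v) =
    indicators (surjB (u V.++ v)) (incrList (V.toList u)) (incrList (V.toList v)) _ (posB c)
      λ e → trans (surjB-weights a b u v pa pb) (cong posB (sym (natListEq⁻ {c} e)))

coeff-mulQ : ∀ c p q → Positive p → Positive q →
  coeff c (mulQ p q) ≡
  ⟦ posB c ⟧ * ∑ (splits c) (λ (α , β) → coeff (compress α) p * coeff (compress β) q)
coeff-mulQ c p q pp pq = begin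
  coeff c (mulQ p q)
    ≡⟨ coeff-∑ c (mulQ p q) ⟩
  ∑ (mulQ p q) (λ e → ⟦ natListEq c e ⟧)
    ≡⟨ trans (∑-concatMap _ p) (∑-cong p λ a → trans (∑-concatMap _ q) (∑-cong q λ b → sym (coeff-∑ c (mulM a b)))) ⟩
  ∑ p (λ a → ∑ q (λ b → coeff c (mulM a b)))
    ≡⟨ ∑-cong-Positive pp (λ a pa → ∑-cong-Positive pq (λ b pb → coeff-mulM c a b pa pb)) ⟩
  ∑ p (λ a → ∑ q (λ b → ⟦ posB c ⟧ * ∑ (splits c) (λ (α , β) → ⟦ natListEq (compress α) a ⟧ * ⟦ natListEq (compress β) b ⟧)))
    ≡⟨ trans (∑-cong p λ a → ∑-*ˡ q ⟦ posB c ⟧) (∑-*ˡ p ⟦ posB c ⟧) ⟩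
  ⟦ posB c ⟧ * ∑ p (λ a → ∑ q (λ b → ∑ (splits c) (λ (α , β) → ⟦ natListEq (compress α) a ⟧ * ⟦ natListEq (compress β) b ⟧)))
    ≡⟨ cong (⟦ posB c ⟧ *_) (trans (∑-cong p λ a → ∑-swap q (splits c)) (∑-swap p (splits c))) ⟩
  ⟦ posB c ⟧ * ∑ (splits c) (λ (α , β) → ∑ p (λ a → ∑ q (λ b → ⟦ natListEq (compress α) a ⟧ * ⟦ natListEq (compress β) b ⟧)))
    ≡⟨ cong (⟦ posB c ⟧ *_) (∑-cong (splits c) λ (α , β) →
         trans (sym (∑-product p q)) (sym (cong₂ _*_ (coeff-∑ (compress α) p) (coeff-∑ (compress β) q)))) ⟩
  _ ∎
  where open ≡-Reasoning

-- The coefficient of the weak composition c in the product of the M_s, s ∈ segs.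
mulAllCoeff : List (List ℕ) → List ℕ → ℕ
mulAllCoeff []         c = ⟦ natListEq (compress c) [] ⟧
mulAllCoeff (s ∷ segs) c = ∑ (splits c) (λ (α , β) → ⟦ natListEq (compress α) s ⟧ * mulAllCoeff segs β)

Positive-[] : Positive oneQ
Positive-[] = positive λ where
  []      p → ⊥-elim (p refl)
  (x ∷ c) p → refl

Positive-[-] : ∀ {s} → posB s ≡ true → Positive (s ∷ [])
Positive-[-] {s} ps = positive λ c nc →
  trans (coeff-∑ c (s ∷ [])) (trans (+-identityʳ _) (⟦⟧-false λ e → nc (trans (cong posB (natListEq⁻ {c} e)) ps)))

Positive-mulQ : ∀ {p q} → Positive p → Positive q → Positive (mulQ p q)
Positive-mulQ {p} {q} pp pq = positive λ c nc → trans (coeff-mulQ c p q pp pq) (*-congˡ (⟦⟧-false {posB c} nc))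

Positive-mulAll : ∀ segs → allB posB segs ≡ true → Positive (mulAll segs)
Positive-mulAll []         ps = Positive-[]
Positive-mulAll (s ∷ segs) ps =
  Positive-mulQ (Positive-[-] {s} (∧⁻ˡ ps)) (Positive-mulAll segs (∧⁻ʳ {posB s} ps))

-- At `compress c` the positivity factor of `coeff-mulQ` is 1, and `∑-splits-compress` brings the
-- splittings back to those of `c`, so the recursion closes on weak compositions.
coeff-mulAll : ∀ segs c → allB posB segs ≡ true → coeff (compress c) (mulAll segs) ≡ mulAllCoeff segs c
coeff-mulAll [] c ps = trans (coeff-∑ (compress c) oneQ) (+-identityʳ _)
coeff-mulAll (s ∷ segs) c ps = begin
  coeff (compress c) (mulQ (s ∷ []) (mulAll segs))
    ≡⟨ coeff-mulQ (compress c) (s ∷ []) (mulAll segs) (Positive-[-] {s} (∧⁻ˡ ps)) (Positive-mulAll segs (∧⁻ʳ {posB s} ps)) ⟩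
  ⟦ posB (compress c) ⟧ * ∑ (splits (compress c)) (λ (α , β) → coeff (compress α) (s ∷ []) * coeff (compress β) (mulAll segs))
    ≡⟨ trans (*-congˡ (cong ⟦_⟧ (posB-compress c))) (*-identityˡ _) ⟩
  ∑ (splits (compress c)) (λ (α , β) → coeff (compress α) (s ∷ []) * coeff (compress β) (mulAll segs))
    ≡⟨ ∑-splits-compress c (λ α β → coeff α (s ∷ []) * coeff β (mulAll segs)) ⟩
  ∑ (splits c) (λ (α , β) → coeff (compress α) (s ∷ []) * coeff (compress β) (mulAll segs))
    ≡⟨ ∑-cong (splits c) (λ (α , β) → cong₂ _*_ (trans (coeff-∑ (compress α) (s ∷ [])) (+-identityʳ _)) (coeff-mulAll segs β (∧⁻ʳ {posB s} ps))) ⟩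
  _ ∎
  where open ≡-Reasoning

-- Coefficients of the internal coproduct

-- Mirrors the extension step inside `cuts`: the new letter joins the first segment or opens one of
-- its own.
extSum : ℕ → (List (List ℕ) → ℕ) → List (List ℕ) → ℕ
extSum x f []         = f ((x ∷ []) ∷ [])
extSum x f (s ∷ segs) = f ((x ∷ s) ∷ segs) + f ((x ∷ []) ∷ s ∷ segs)

∑-cuts-∷ : ∀ x xs {f : List (List ℕ) → ℕ} → ∑ (cuts (x ∷ xs)) f ≡ ∑ (cuts xs) (extSum x f)
∑-cuts-∷ x xs {f} = trans (∑-concatMap _ (cuts xs)) (∑-cong (cuts xs) λ where
  []         → +-identityʳ _
  (s ∷ segs) → cong (f ((x ∷ s) ∷ segs) +_) (+-identityʳ _))

-- Empty segments are excluded as well as zero parts: the sum of an empty segment would put a zero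
-- into the right-hand composition of `ρ`.
segB : List ℕ → Bool
segB []      = false
segB (x ∷ s) = posB (x ∷ s)

segB⇒posB : ∀ segs → allB segB segs ≡ true → allB posB segs ≡ true
segB⇒posB []               ps = refl
segB⇒posB ((x ∷ s) ∷ segs) ps = ∧⁺ (∧⁻ˡ ps) (segB⇒posB segs (∧⁻ʳ {posB (x ∷ s)} ps))

posB-sums : ∀ segs → allB segB segs ≡ true → posB (L.map sum segs) ≡ true
posB-sums []                   ps = refl
posB-sums ((suc x ∷ s) ∷ segs) ps = posB-sums segs (∧⁻ʳ {posB s} ps)

∑-cong-cuts : ∀ e → posB e ≡ true → {f g : List (List ℕ) → ℕ} →
              (∀ segs → allB segB segs ≡ true → f segs ≡ g segs) → ∑ (cuts e) f ≡ ∑ (cuts e) g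
∑-cong-cuts []          pe h = cong (_+ 0) (h [] refl)
∑-cong-cuts (suc x ∷ e) pe {f} {g} h =
  trans (∑-cuts-∷ (suc x) e) (trans (∑-cong-cuts e pe step) (sym (∑-cuts-∷ (suc x) e)))
  where
  step : ∀ segs → allB segB segs ≡ true → extSum (suc x) f segs ≡ extSum (suc x) g segs
  step []               ps = h _ refl
  step ((z ∷ s) ∷ segs) ps = cong₂ _+_ (h _ ps) (h _ ps)

heads : List ℕ → List (List ℕ × List ℕ)
heads []       = []
heads (x ∷ xs) = (x ∷ [] , xs) ∷ L.map (map₁ (x ∷_)) (heads xs)

-- `cuts` grows by letters, while products of segments unfold segment by segment; this trades one
-- recursion for the other. The `null` term is the empty cut of the empty list.
∑-cuts-heads : ∀ e (f : List (List ℕ) → ℕ) →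
  ∑ (cuts e) f ≡ ⟦ null e ⟧ * f [] + ∑ (heads e) (λ (s , e′) → ∑ (cuts e′) (λ segs → f (s ∷ segs)))
∑-cuts-heads []       f = cong (_+ 0) (sym (+-identityʳ (f [])))
∑-cuts-heads (x ∷ xs) f = begin
  ∑ (cuts (x ∷ xs)) f
    ≡⟨ ∑-cuts-∷ x xs ⟩
  ∑ (cuts xs) (extSum x f)
    ≡⟨ ∑-cong (cuts xs) (λ where
         []         → sym (+-identityʳ _)
         (s ∷ segs) → +-comm (f ((x ∷ s) ∷ segs)) _) ⟩
  ∑ (cuts xs) (λ segs → f ((x ∷ []) ∷ segs) + longer segs)
    ≡⟨ ∑-+ (cuts xs) ⟩
  ∑ (cuts xs) (λ segs → f ((x ∷ []) ∷ segs)) + ∑ (cuts xs) longer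
    ≡⟨ +-congʳ {∑ (cuts xs) (λ segs → f ((x ∷ []) ∷ segs))} (∑-cuts-heads xs longer) ⟩
  ∑ (cuts xs) (λ segs → f ((x ∷ []) ∷ segs)) + (⟦ null xs ⟧ * 0 + ∑ (heads xs) (λ (s , e′) → ∑ (cuts e′) (λ segs → f ((x ∷ s) ∷ segs))))
    ≡⟨ +-congʳ {∑ (cuts xs) (λ segs → f ((x ∷ []) ∷ segs))} (trans (+-congˡ (*-zeroʳ ⟦ null xs ⟧)) (sym (∑-map (map₁ (x ∷_)) (heads xs)))) ⟩
  _ ∎
  where
  open ≡-Reasoning
  longer : List (List ℕ) → ℕ
  longer []         = 0
  longer (s ∷ segs) = f ((x ∷ s) ∷ segs)

heads-δ : ∀ e a b → ∑ (heads e) (λ (s , e′) → ⟦ natListEq a s ⟧ * ⟦ natListEq b e′ ⟧)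
                    ≡ ⟦ not (null a) ⟧ * ⟦ natListEq (a ++ b) e ⟧
heads-δ []       []      b = refl
heads-δ []       (y ∷ a) b = refl
heads-δ (x ∷ xs) []      b = trans (∑-map _ (heads xs)) (∑-zero (heads xs) λ _ → refl)
heads-δ (x ∷ xs) (y ∷ a) b = begin
  ⟦ (y ≡ᵇ x) ∧ natListEq a [] ⟧ * ⟦ natListEq b xs ⟧ + ∑ (L.map (map₁ (x ∷_)) (heads xs)) _
    ≡⟨ +-congʳ (trans (∑-map _ (heads xs)) (trans (∑-cong (heads xs) λ (s , e′) → trans (*-congˡ (⟦∧⟧ (y ≡ᵇ x) _)) (*-assoc ⟦ y ≡ᵇ x ⟧ _ _)) (∑-*ˡ (heads xs) ⟦ y ≡ᵇ x ⟧))) ⟩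
  ⟦ (y ≡ᵇ x) ∧ natListEq a [] ⟧ * ⟦ natListEq b xs ⟧ + ⟦ y ≡ᵇ x ⟧ * ∑ (heads xs) (λ (s , e′) → ⟦ natListEq a s ⟧ * ⟦ natListEq b e′ ⟧)
    ≡⟨ cong₂ _+_ (trans (*-congˡ (⟦∧⟧ (y ≡ᵇ x) _)) (*-assoc ⟦ y ≡ᵇ x ⟧ _ _)) (cong (⟦ y ≡ᵇ x ⟧ *_) (heads-δ xs a b)) ⟩
  ⟦ y ≡ᵇ x ⟧ * (⟦ natListEq a [] ⟧ * ⟦ natListEq b xs ⟧) + ⟦ y ≡ᵇ x ⟧ * (⟦ not (null a) ⟧ * ⟦ natListEq (a ++ b) xs ⟧)
    ≡⟨ *-distribˡ-+ ⟦ y ≡ᵇ x ⟧ _ _ ⟨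
  ⟦ y ≡ᵇ x ⟧ * (⟦ natListEq a [] ⟧ * ⟦ natListEq b xs ⟧ + ⟦ not (null a) ⟧ * ⟦ natListEq (a ++ b) xs ⟧)
    ≡⟨ cong (⟦ y ≡ᵇ x ⟧ *_) (either a) ⟩
  ⟦ y ≡ᵇ x ⟧ * ⟦ natListEq (a ++ b) xs ⟧
    ≡⟨ ⟦∧⟧ (y ≡ᵇ x) _ ⟨
  ⟦ (y ≡ᵇ x) ∧ natListEq (a ++ b) xs ⟧
    ≡⟨ +-identityʳ _ ⟨
  _ ∎
  where
  open ≡-Reasoning
  either : ∀ a → ⟦ natListEq a [] ⟧ * ⟦ natListEq b xs ⟧ + ⟦ not (null a) ⟧ * ⟦ natListEq (a ++ b) xs ⟧ ≡ ⟦ natListEq (a ++ b) xs ⟧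
  either []      = trans (+-identityʳ _) (+-identityʳ _)
  either (z ∷ a) = +-identityʳ _

-- The matrices with row sums d and column sums c, each flattened row by row.
matrices : List ℕ → List ℕ → List (List ℕ)
matrices []      c = filterB (λ _ → natListEq (compress c) []) ([] ∷ [])
matrices (y ∷ d) c =
  concatMap (λ (α , β) → L.map (α ++_) (matrices d β)) (filterB (λ (α , β) → y ≡ᵇ sum α) (splits c))

∑-matrices-∷ : ∀ y d c {f : List ℕ → ℕ} →
  ∑ (matrices (y ∷ d) c) f ≡
  ∑ (splits c) (λ (α , β) → ⟦ y ≡ᵇ sum α ⟧ * ∑ (matrices d β) (λ A → f (α ++ A)))
∑-matrices-∷ y d c =
  trans (∑-concatMap _ (filterB (λ (α , β) → y ≡ᵇ sum α) (splits c)))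
    (trans (∑-filterB (λ (α , β) → y ≡ᵇ sum α) (splits c))
      (∑-cong (splits c) λ (α , β) → cong (⟦ y ≡ᵇ sum α ⟧ *_) (∑-map (α ++_) (matrices d β))))

∑-matrices-[] : ∀ c {f : List ℕ → ℕ} → ∑ (matrices [] c) f ≡ ⟦ natListEq (compress c) [] ⟧ * f []
∑-matrices-[] c = trans (∑-filterB (λ _ → natListEq (compress c) []) ([] ∷ [])) (+-identityʳ _)

-- A matrix determines a cut of its compressed flattening: the segments are its compressed rows.
-- Positive row sums make these segments nonempty, as a cut requires.
∑-cuts-matrices : ∀ d c e → posB d ≡ true →
  ∑ (cuts e) (λ segs → ⟦ natListEq d (L.map sum segs) ⟧ * mulAllCoeff segs c) ≡
  ∑ (matrices d c) (λ A → ⟦ natListEq (compress A) e ⟧)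
∑-cuts-matrices [] c e pd = begin
  ∑ (cuts e) (λ segs → ⟦ natListEq [] (L.map sum segs) ⟧ * mulAllCoeff segs c)
    ≡⟨ ∑-cuts-heads e _ ⟩
  ⟦ null e ⟧ * (1 * ⟦ natListEq (compress c) [] ⟧) + ∑ (heads e) (λ (s , e′) → ∑ (cuts e′) (λ segs → 0))
    ≡⟨ cong₂ _+_ (null-eq e) (∑-zero (heads e) λ (s , e′) → ∑-zero (cuts e′) λ _ → refl) ⟩
  ⟦ natListEq (compress c) [] ⟧ * ⟦ natListEq [] e ⟧ + 0
    ≡⟨ trans (+-identityʳ _) (sym (∑-matrices-[] c)) ⟩
  _ ∎
  where
  open ≡-Reasoning
  null-eq : ∀ e → ⟦ null e ⟧ * (1 * ⟦ natListEq (compress c) [] ⟧) ≡ ⟦ natListEq (compress c) [] ⟧ * ⟦ natListEq [] e ⟧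
  null-eq []      = solve 1 (λ z → con 1 :* (con 1 :* z) := z :* con 1) refl ⟦ natListEq (compress c) [] ⟧
  null-eq (_ ∷ _) = sym (*-zeroʳ ⟦ natListEq (compress c) [] ⟧)
∑-cuts-matrices (suc y ∷ d) c e pd = begin
  ∑ (cuts e) (λ segs → ⟦ natListEq (suc y ∷ d) (L.map sum segs) ⟧ * mulAllCoeff segs c)
    ≡⟨ ∑-cuts-heads e _ ⟩
  ⟦ null e ⟧ * 0 + ∑ (heads e) (λ (s , e′) → ∑ (cuts e′) (λ segs →
      ⟦ (suc y ≡ᵇ sum s) ∧ natListEq d (L.map sum segs) ⟧ * ∑ (splits c) (λ (α , β) → ⟦ natListEq (compress α) s ⟧ * mulAllCoeff segs β)))
    ≡⟨ trans (+-congˡ (*-zeroʳ ⟦ null e ⟧)) (∑-cong (heads e) λ (s , e′) → first-row s e′) ⟩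
  ∑ (heads e) (λ (s , e′) → ∑ (splits c) (λ (α , β) → ∑ (matrices d β) (λ A →
      ⟦ suc y ≡ᵇ sum α ⟧ * (⟦ natListEq (compress α) s ⟧ * ⟦ natListEq (compress A) e′ ⟧))))
    ≡⟨ trans (∑-swap (heads e) (splits c)) (∑-cong (splits c) λ (α , β) → ∑-swap (heads e) (matrices d β)) ⟩
  ∑ (splits c) (λ (α , β) → ∑ (matrices d β) (λ A → ∑ (heads e) (λ (s , e′) →
      ⟦ suc y ≡ᵇ sum α ⟧ * (⟦ natListEq (compress α) s ⟧ * ⟦ natListEq (compress A) e′ ⟧))))
    ≡⟨ ∑-cong (splits c) (λ (α , β) → trans (∑-cong (matrices d β) λ A → glue α A) (∑-*ˡ (matrices d β) ⟦ suc y ≡ᵇ sum α ⟧)) ⟩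
  ∑ (splits c) (λ (α , β) → ⟦ suc y ≡ᵇ sum α ⟧ * ∑ (matrices d β) (λ A → ⟦ natListEq (compress (α ++ A)) e ⟧))
    ≡⟨ ∑-matrices-∷ (suc y) d c ⟨
  _ ∎
  where
  open ≡-Reasoning

  glue : ∀ α A → ∑ (heads e) (λ (s , e′) → ⟦ suc y ≡ᵇ sum α ⟧ * (⟦ natListEq (compress α) s ⟧ * ⟦ natListEq (compress A) e′ ⟧))
                 ≡ ⟦ suc y ≡ᵇ sum α ⟧ * ⟦ natListEq (compress (α ++ A)) e ⟧
  glue α A = begin
    _ ≡⟨ ∑-*ˡ (heads e) ⟦ suc y ≡ᵇ sum α ⟧ ⟩
    _ ≡⟨ cong (⟦ suc y ≡ᵇ sum α ⟧ *_) (heads-δ e (compress α) (compress A)) ⟩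
    ⟦ suc y ≡ᵇ sum α ⟧ * (⟦ not (null (compress α)) ⟧ * ⟦ natListEq (compress α ++ compress A) e ⟧)
      -- The row sum `suc y` is nonzero, so the compressed row is a nonempty segment and the guard
      -- coming from `heads-δ` is 1.
      ≡⟨ guard (suc y ≡ᵇ sum α) (λ q → trans (*-congˡ (nonempty (compress α) (trans (≡ᵇ⁻ q) (sym (sum-compress α))))) (*-identityˡ _)) ⟩
    _ ≡⟨ cong (λ a → ⟦ suc y ≡ᵇ sum α ⟧ * ⟦ natListEq a e ⟧) (compress-++ α A) ⟨
    _ ∎
    where
    nonempty : ∀ a → suc y ≡ sum a → ⟦ not (null a) ⟧ ≡ 1
    nonempty (_ ∷ _) q = refl

  factor : ∀ s t u v → ⟦ s ∧ t ⟧ * (u * v) ≡ ⟦ s ⟧ * u * (⟦ t ⟧ * v)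
  factor s t u v rewrite ⟦∧⟧ s t = solve 4 (λ s t u v → s :* t :* (u :* v) := s :* u :* (t :* v)) refl ⟦ s ⟧ ⟦ t ⟧ u v

  first-row : ∀ s e′ →
    ∑ (cuts e′) (λ segs → ⟦ (suc y ≡ᵇ sum s) ∧ natListEq d (L.map sum segs) ⟧ * ∑ (splits c) (λ (α , β) → ⟦ natListEq (compress α) s ⟧ * mulAllCoeff segs β))
    ≡ ∑ (splits c) (λ (α , β) → ∑ (matrices d β) (λ A → ⟦ suc y ≡ᵇ sum α ⟧ * (⟦ natListEq (compress α) s ⟧ * ⟦ natListEq (compress A) e′ ⟧)))
  first-row s e′ = begin
    _ ≡⟨ ∑-cong (cuts e′) (λ segs → trans (sym (∑-*ˡ (splits c) ⟦ (suc y ≡ᵇ sum s) ∧ natListEq d (L.map sum segs) ⟧))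
           (∑-cong (splits c) λ (α , β) → factor (suc y ≡ᵇ sum s) (natListEq d (L.map sum segs)) ⟦ natListEq (compress α) s ⟧ (mulAllCoeff segs β))) ⟩
    ∑ (cuts e′) (λ segs → ∑ (splits c) (λ (α , β) → ⟦ suc y ≡ᵇ sum s ⟧ * ⟦ natListEq (compress α) s ⟧ * (⟦ natListEq d (L.map sum segs) ⟧ * mulAllCoeff segs β)))
      ≡⟨ ∑-swap (cuts e′) (splits c) ⟩
    ∑ (splits c) (λ (α , β) → ∑ (cuts e′) (λ segs → ⟦ suc y ≡ᵇ sum s ⟧ * ⟦ natListEq (compress α) s ⟧ * (⟦ natListEq d (L.map sum segs) ⟧ * mulAllCoeff segs β)))
      ≡⟨ ∑-cong (splits c) (λ (α , β) → trans (∑-*ˡ (cuts e′) (⟦ suc y ≡ᵇ sum s ⟧ * ⟦ natListEq (compress α) s ⟧))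
           (trans (cong (⟦ suc y ≡ᵇ sum s ⟧ * ⟦ natListEq (compress α) s ⟧ *_) (∑-cuts-matrices d β e′ pd))
             (trans (sym (∑-*ˡ (matrices d β) (⟦ suc y ≡ᵇ sum s ⟧ * ⟦ natListEq (compress α) s ⟧))) (∑-cong (matrices d β) λ A → same-sum α A)))) ⟩
    _ ∎
    where
    same-sum : ∀ α A → ⟦ suc y ≡ᵇ sum s ⟧ * ⟦ natListEq (compress α) s ⟧ * ⟦ natListEq (compress A) e′ ⟧
                     ≡ ⟦ suc y ≡ᵇ sum α ⟧ * (⟦ natListEq (compress α) s ⟧ * ⟦ natListEq (compress A) e′ ⟧)
    same-sum α A with natListEq (compress α) s in eq
    ... | false = trans (*-congˡ (*-zeroʳ ⟦ suc y ≡ᵇ sum s ⟧)) (sym (*-zeroʳ ⟦ suc y ≡ᵇ sum α ⟧))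
    ... | true rewrite sym (natListEq⁻ {compress α} eq) | sum-compress α =
      solve 2 (λ s t → s :* con 1 :* t := s :* (con 1 :* t)) refl ⟦ suc y ≡ᵇ sum α ⟧ ⟦ natListEq (compress A) e′ ⟧

coeff⊗-∑ : ∀ c d p → coeff⊗ c d p ≡ ∑ p (λ (a , b) → ⟦ natListEq c a ⟧ * ⟦ natListEq d b ⟧)
coeff⊗-∑ c d p = trans (countB-∑ _ p) (∑-cong p λ (a , b) → ⟦∧⟧ (natListEq c a) _)

coeff-ρM : ∀ c d e → posB e ≡ true →
  coeff⊗ c d (ρM e) ≡
  ⟦ posB c ⟧ * ⟦ posB d ⟧ * ∑ (matrices d c) (λ A → ⟦ natListEq (compress A) e ⟧)
coeff-ρM c d e pe = begin
  coeff⊗ c d (ρM e)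
    ≡⟨ coeff⊗-∑ c d (ρM e) ⟩
  ∑ (ρM e) (λ (a , b) → ⟦ natListEq c a ⟧ * ⟦ natListEq d b ⟧)
    ≡⟨ trans (∑-concatMap _ (cuts e)) (∑-cong (cuts e) λ segs → trans (∑-map _ (mulAll segs)) (trans (∑-*ʳ (mulAll segs) ⟦ natListEq d (L.map sum segs) ⟧) (*-congˡ (sym (coeff-∑ c (mulAll segs)))))) ⟩
  ∑ (cuts e) (λ segs → coeff c (mulAll segs) * ⟦ natListEq d (L.map sum segs) ⟧)
    ≡⟨ ∑-cong-cuts e pe (λ segs ps → trans (cong₂ _*_ (coefficient segs ps) (row-sums segs ps)) (interchange ⟦ posB c ⟧ ⟦ posB d ⟧ (mulAllCoeff segs c) _)) ⟩
  ∑ (cuts e) (λ segs → ⟦ posB c ⟧ * ⟦ posB d ⟧ * (⟦ natListEq d (L.map sum segs) ⟧ * mulAllCoeff segs c))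
    ≡⟨ trans (∑-*ˡ (cuts e) (⟦ posB c ⟧ * ⟦ posB d ⟧)) (trans (*-assoc ⟦ posB c ⟧ ⟦ posB d ⟧ _)
         (trans (cong (⟦ posB c ⟧ *_) (guard (posB d) (∑-cuts-matrices d c e))) (sym (*-assoc ⟦ posB c ⟧ ⟦ posB d ⟧ _)))) ⟩
  _ ∎
  where
  open ≡-Reasoning
  interchange : ∀ c d m s → c * m * (d * s) ≡ c * d * (s * m)
  interchange = solve 4 (λ c d m s → c :* m :* (d :* s) := c :* d :* (s :* m)) refl

  coefficient : ∀ segs → allB segB segs ≡ true → coeff c (mulAll segs) ≡ ⟦ posB c ⟧ * mulAllCoeff segs c
  coefficient segs ps with true? (posB c)
  ... | inj₁ pc rewrite pc =
    trans (cong (λ a → coeff a (mulAll segs)) (sym (compress-pos {c} pc)))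
          (trans (coeff-mulAll segs c (segB⇒posB segs ps)) (sym (+-identityʳ _)))
  ... | inj₂ nc = trans (Positive.vanish (Positive-mulAll segs (segB⇒posB segs ps)) c nc) (sym (*-congˡ (⟦⟧-false {posB c} nc)))

  -- The extra factor changes nothing, since sums of segments are positive, and it makes the
  -- positivity of `d` available when `∑-cuts-matrices` is applied.
  row-sums : ∀ segs → allB segB segs ≡ true →
             ⟦ natListEq d (L.map sum segs) ⟧ ≡ ⟦ posB d ⟧ * ⟦ natListEq d (L.map sum segs) ⟧
  row-sums segs ps = sym (guard-drop (posB d) λ nd → ⟦⟧-false λ q →
    nd (trans (cong posB (natListEq⁻ {d} q)) (posB-sums segs ps)))

-- The coefficients of λ(T)

fibre : ∀ {m n} → Vec (Fin m) n → Fin m → ℕ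
fibre []      j = 0
fibre (i ∷ f) j = ⟦ finEq i j ⟧ + fibre f j

fibre-∑ : ∀ {m n} (f : Vec (Fin m) n) j → fibre f j ≡ ∑ (allFin n) (λ x → ⟦ finEq (V.lookup f x) j ⟧)
fibre-∑ []      j = refl
fibre-∑ {n = suc n} (i ∷ f) j =
  trans (+-congʳ {⟦ finEq i j ⟧} (fibre-∑ f j)) (sym (∑-allFin-suc n (λ x → ⟦ finEq (V.lookup (i ∷ f) x) j ⟧)))

sizes : ∀ {m n} → Vec (Fin m) n → List ℕ
sizes f = L.tabulate (fibre f)

blockSizes-sizes : ∀ {m n} (f : Vec (Fin m) n) → blockSizes f ≡ sizes f
blockSizes-sizes {m} {n} f =
  trans (map-tabulate id _) (tabulate-cong λ j → trans (countB-∑ _ (allFin n)) (sym (fibre-∑ f j)))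

fibre-++ : ∀ {m n₁ n₂} (f : Vec (Fin m) n₁) (g : Vec (Fin m) n₂) j → fibre (f V.++ g) j ≡ fibre f j + fibre g j
fibre-++ []      g j = refl
fibre-++ (i ∷ f) g j = trans (+-congʳ {⟦ finEq i j ⟧} (fibre-++ f g j)) (sym (+-assoc ⟦ finEq i j ⟧ _ _))

fibre≢0⁺ : ∀ {m n} (f : Vec (Fin m) n) x → ¬ (fibre f (V.lookup f x) ≡ 0)
fibre≢0⁺ (i ∷ f) F.zero    e rewrite finEq⁺ {i = i} refl = case e of λ ()
fibre≢0⁺ (i ∷ f) (F.suc x) e = fibre≢0⁺ f x (m+n≡0⇒n≡0 ⟦ finEq i (V.lookup f x) ⟧ e)

fibre≢0⁻ : ∀ {m n} (f : Vec (Fin m) n) j → ¬ (fibre f j ≡ 0) → ∃ λ x → V.lookup f x ≡ j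
fibre≢0⁻ []      j ne = ⊥-elim (ne refl)
fibre≢0⁻ (i ∷ f) j ne with true? (finEq i j)
... | inj₁ eq = F.zero , finEq⁻ eq
... | inj₂ q with fibre≢0⁻ f j (λ e → ne (cong₂ _+_ (⟦⟧-false q) e))
...   | x , eq = F.suc x , eq

surjB-sizes : ∀ {m n} (f : Vec (Fin m) n) → surjB f ≡ posB (sizes f)
surjB-sizes f = bool-ext
  (λ s → posB-tabulate⁺ (fibre f) λ j → case surjB⁻ f s j of λ where (x , refl) → fibre≢0⁺ f x)
  (λ p → surjB⁺ f λ j → fibre≢0⁻ f j (posB-tabulate⁻ (fibre f) p j))

-- This is N_T(c) when `m` is the length of `c`. Keeping `m` separate lets equalities of lengths be
-- transported in that argument alone.
compatibleCount : Top → (m : ℕ) → List ℕ → ℕ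
compatibleCount T m c = ∑ (maps m (size T)) (λ f → ⟦ compatible T f ⟧ * ⟦ natListEq c (sizes f) ⟧)

-- As in `coeff-mulM`, the length of `c` fixes the number of blocks, and a map with fibre sizes `c`
-- is surjective exactly when `c` has no zero.
coeff-lam : ∀ T c → coeff c (lam T) ≡ ⟦ posB c ⟧ * compatibleCount T (length c) c
coeff-lam T c = begin
  coeff c (lam T)
    ≡⟨ coeff-∑ c (lam T) ⟩
  ∑ (lam T) (λ a → ⟦ natListEq c a ⟧)
    ≡⟨ trans (∑-concatMap parts (upTo (suc n))) (∑-cong (upTo (suc n)) λ k →
         trans (∑-map blockSizes (filterB (good k) (maps k n))) (∑-filterB (good k) (maps k n))) ⟩
  ∑ (upTo (suc n)) (λ k → ∑ (maps k n) (term k))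
    ≡⟨ ∑-upTo-single (suc n) m (λ k → ∑ (maps k n) (term k))
         (λ k ne → ∑-zero (maps k n) λ f → trans (cong (⟦ good k f ⟧ *_) (⟦⟧-false λ e → ne
            (natListEq-tabulate⁻ {c} (fibre f) (trans (cong (natListEq c) (sym (blockSizes-sizes f))) e)))) (*-zeroʳ ⟦ good k f ⟧))
         (λ le → ∑-zero (maps m n) λ f → *-congˡ {c = ⟦ natListEq c (blockSizes f) ⟧} (⟦⟧-false λ s → ≤⇒≯ (surjB⇒≤ f (∧⁻ˡ {surjB f} s)) le)) ⟩
  ∑ (maps m n) (term m)
    ≡⟨ ∑-cong (maps m n) (λ f → trans (cong (λ a → ⟦ good m f ⟧ * ⟦ natListEq c a ⟧) (blockSizes-sizes f))
         (indicators (surjB f) (compatible T f) (natListEq c (sizes f)) (posB c) (λ e → trans (surjB-sizes f) (cong posB (sym (natListEq⁻ {c} e)))))) ⟩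
  ∑ (maps m n) (λ f → ⟦ posB c ⟧ * (⟦ compatible T f ⟧ * ⟦ natListEq c (sizes f) ⟧))
    ≡⟨ ∑-*ˡ (maps m n) ⟦ posB c ⟧ ⟩
  _ ∎
  where
  open ≡-Reasoning
  n = size T
  m = length c
  good : ∀ k → Vec (Fin k) n → Bool
  good k f = surjB f ∧ compatible T f
  parts : ℕ → List (List ℕ)
  parts k = L.map blockSizes (filterB (good k) (maps k n))
  term : ∀ k → Vec (Fin k) n → ℕ
  term k f = ⟦ good k f ⟧ * ⟦ natListEq c (blockSizes f) ⟧
  indicators : ∀ s i e p → (e ≡ true → s ≡ p) → ⟦ s ∧ i ⟧ * ⟦ e ⟧ ≡ ⟦ p ⟧ * (⟦ i ⟧ * ⟦ e ⟧)
  indicators s i true p h rewrite h refl | ⟦∧⟧ p i = *-assoc ⟦ p ⟧ ⟦ i ⟧ 1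
  indicators s i false p h =
    trans (*-zeroʳ ⟦ s ∧ i ⟧) (sym (trans (cong (⟦ p ⟧ *_) (*-zeroʳ ⟦ i ⟧)) (*-zeroʳ ⟦ p ⟧)))

Positive-lam : ∀ T → Positive (lam T)
Positive-lam T = positive λ c nc → trans (coeff-lam T c) (*-congˡ (⟦⟧-false {posB c} nc))

-- Quasi-symmetry of the counts

allB-cong : ∀ {A : Set} {p q : A → Bool} xs → (∀ x → p x ≡ q x) → allB p xs ≡ allB q xs
allB-cong []       h = refl
allB-cong (x ∷ xs) h = cong₂ _∧_ (h x) (allB-cong xs h)

finEq-emb : ∀ {n} (Y : Vec Bool n) i j → finEq (emb Y i) (emb Y j) ≡ finEq i j
finEq-emb (true  ∷ Y) F.zero    F.zero    = refl
finEq-emb (true  ∷ Y) F.zero    (F.suc j) = refl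
finEq-emb (true  ∷ Y) (F.suc i) F.zero    = refl
finEq-emb (true  ∷ Y) (F.suc i) (F.suc j) = finEq-emb Y i j
finEq-emb (false ∷ Y) i         j         = finEq-emb Y i j

finLt-emb : ∀ {n} (Y : Vec Bool n) i j → finLt (emb Y i) (emb Y j) ≡ finLt i j
finLt-emb (true  ∷ Y) F.zero    F.zero    = refl
finLt-emb (true  ∷ Y) F.zero    (F.suc j) = refl
finLt-emb (true  ∷ Y) (F.suc i) F.zero    = refl
finLt-emb (true  ∷ Y) (F.suc i) (F.suc j) = finLt-emb Y i j
finLt-emb (false ∷ Y) i         j         = finLt-emb Y i j

lookup-emb : ∀ {n} (Y : Vec Bool n) i → V.lookup Y (emb Y i) ≡ true
lookup-emb (true  ∷ Y) F.zero    = refl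
lookup-emb (true  ∷ Y) (F.suc i) = lookup-emb Y i
lookup-emb (false ∷ Y) i         = lookup-emb Y i

-- Compatibility only compares values, and `emb Y` preserves and reflects both order and equality.
compatible-emb : ∀ T {m} (Y : Vec Bool m) (f : Vec (Fin (card Y)) (size T)) →
                 compatible T (V.map (emb Y) f) ≡ compatible T f
compatible-emb T Y f = allB-cong (allFin n) λ x → allB-cong (allFin n) λ y → cong₂ _∧_
  (cong (not (ltT T x y) ∨_) (trans (cong₂ finLt (VP.lookup-map x (emb Y) f) (VP.lookup-map y (emb Y) f)) (finLt-emb Y _ _)))
  (cong (not (simT T x y) ∨_) (trans (cong₂ finEq (VP.lookup-map x (emb Y) f) (VP.lookup-map y (emb Y) f)) (finEq-emb Y _ _)))
  where n = size T

fibre-map-emb : ∀ {m n} (Y : Vec Bool m) (f : Vec (Fin (card Y)) n) j → fibre (V.map (emb Y) f) (emb Y j) ≡ fibre f j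
fibre-map-emb Y []      j = refl
fibre-map-emb Y (i ∷ f) j = cong₂ _+_ (cong ⟦_⟧ (finEq-emb Y i j)) (fibre-map-emb Y f j)

fibre-map-emb-outside : ∀ {m n} (Y : Vec Bool m) (f : Vec (Fin (card Y)) n) j → V.lookup Y j ≡ false →
                        fibre (V.map (emb Y) f) j ≡ 0
fibre-map-emb-outside Y []      j out = refl
fibre-map-emb-outside Y (i ∷ f) j out = cong₂ _+_
  (⟦⟧-false λ e → case trans (sym (lookup-emb Y i)) (trans (cong (V.lookup Y) (finEq⁻ {i = emb Y i} e)) out) of λ ())
  (fibre-map-emb-outside Y f j out)

support : (c : List ℕ) → Vec Bool (length c)
support []          = []
support (zero  ∷ c) = false ∷ support c
support (suc x ∷ c) = true ∷ support c

card-support : ∀ c → card (support c) ≡ length (compress c)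
card-support []          = refl
card-support (zero  ∷ c) = card-support c
card-support (suc x ∷ c) = cong suc (card-support c)

lookup-support : ∀ c (g : Fin (length c) → ℕ) → natListEq c (L.tabulate g) ≡ true →
                 ∀ i → ¬ (g i ≡ 0) → V.lookup (support c) i ≡ true
lookup-support (zero  ∷ c) g e F.zero    ne = ⊥-elim (ne (sym (≡ᵇ⁻ (∧⁻ˡ e))))
lookup-support (suc x ∷ c) g e F.zero    ne = refl
lookup-support (zero  ∷ c) g e (F.suc i) ne = lookup-support c (g ∘ F.suc) (∧⁻ʳ {0 ≡ᵇ g F.zero} e) i ne
lookup-support (suc x ∷ c) g e (F.suc i) ne = lookup-support c (g ∘ F.suc) (∧⁻ʳ {suc x ≡ᵇ g F.zero} e) i ne

-- Outside its support `c` has zeros, which meet the zeros of `g`; on the support the comparison is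
-- that of the compressed lists.
natListEq-support : ∀ c (g : Fin (length c) → ℕ) (g′ : Fin (card (support c)) → ℕ) →
  (∀ j → g (emb (support c) j) ≡ g′ j) → (∀ i → V.lookup (support c) i ≡ false → g i ≡ 0) →
  natListEq c (L.tabulate g) ≡ natListEq (compress c) (L.tabulate g′)
natListEq-support []          g g′ on off = refl
natListEq-support (zero  ∷ c) g g′ on off rewrite off F.zero refl =
  natListEq-support c (g ∘ F.suc) g′ on (off ∘ F.suc)
natListEq-support (suc x ∷ c) g g′ on off =
  cong₂ _∧_ (cong (suc x ≡ᵇ_) (on F.zero)) (natListEq-support c (g ∘ F.suc) (g′ ∘ F.suc) (on ∘ F.suc) (off ∘ F.suc))

-- Quasi-symmetry: a map with fibre sizes c takes its values in the support of c.
compatibleCount-compress : ∀ T c →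
  compatibleCount T (length c) c ≡ compatibleCount T (length (compress c)) (compress c)
compatibleCount-compress T c = begin
  ∑ (maps (length c) n) (λ f → ⟦ compatible T f ⟧ * ⟦ natListEq c (sizes f) ⟧)
    ≡⟨ ∑-cong (maps (length c) n) (λ f → guard-drop (allV (V.lookup Y) f) (λ out →
         trans (cong (⟦ compatible T f ⟧ *_) (⟦⟧-false λ e → out (allV⁺ f λ x → lookup-support c (fibre f) e (V.lookup f x) (fibre≢0⁺ f x)))) (*-zeroʳ ⟦ compatible T f ⟧))) ⟨
  ∑ (maps (length c) n) (λ f → ⟦ allV (V.lookup Y) f ⟧ * (⟦ compatible T f ⟧ * ⟦ natListEq c (sizes f) ⟧))
    ≡⟨ ∑-maps-image (V.lookup Y) (emb Y) (∑-emb Y) n ⟩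
  ∑ (maps (card Y) n) (λ f → ⟦ compatible T (V.map (emb Y) f) ⟧ * ⟦ natListEq c (sizes (V.map (emb Y) f)) ⟧)
    ≡⟨ ∑-cong (maps (card Y) n) (λ f → cong₂ (λ a b → ⟦ a ⟧ * ⟦ b ⟧) (compatible-emb T Y f)
         (natListEq-support c _ (fibre f) (fibre-map-emb Y f) (fibre-map-emb-outside Y f))) ⟩
  compatibleCount T (card Y) (compress c)
    ≡⟨ cong (λ k → compatibleCount T k (compress c)) (card-support c) ⟩
  _ ∎
  where
  open ≡-Reasoning
  n = size T
  Y = support c

-- Extends the counting interpretation to weak compositions, the form needed once splittings and
-- matrices bring in zeros.
coeff-compress-lam : ∀ T c → coeff (compress c) (lam T) ≡ compatibleCount T (length c) c
coeff-compress-lam T c =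
  trans (coeff-lam T (compress c))
    (trans (*-congˡ (cong ⟦_⟧ (posB-compress c)))
      (trans (*-identityˡ _) (sym (compatibleCount-compress T c))))

-- Coefficients in the tensor square and of deconcatenation

coeff⊗-lam⊗ : ∀ c d ps → coeff⊗ c d (lam⊗ ps) ≡ ∑ ps (λ (T , U) → coeff c (lam T) * coeff d (lam U))
coeff⊗-lam⊗ c d ps =
  trans (coeff⊗-∑ c d (lam⊗ ps))
    (trans (∑-concatMap _ ps) (∑-cong ps λ (T , U) →
      trans (∑-concatMap _ (lam T))
        (trans (∑-cong (lam T) λ a → ∑-map _ (lam U))
          (trans (sym (∑-product (lam T) (lam U))) (sym (cong₂ _*_ (coeff-∑ c (lam T)) (coeff-∑ d (lam U))))))))

-- Deconcatenation cuts `e` once at each place, and only the cut after `length c` letters can leave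
-- `c` on the left.
coeff⊗-ΔM : ∀ c d e → coeff⊗ c d (ΔM e) ≡ ⟦ natListEq (c ++ d) e ⟧
coeff⊗-ΔM c d e = trans (coeff⊗-∑ c d (ΔM e)) (trans (∑-map _ (upTo (suc (length e)))) (go c e))
  where
  go : ∀ c e → ∑ (upTo (suc (length e))) (λ i → ⟦ natListEq c (L.take i e) ⟧ * ⟦ natListEq d (L.drop i e) ⟧)
               ≡ ⟦ natListEq (c ++ d) e ⟧
  go []      []      = trans (+-identityʳ _) (+-identityʳ _)
  go (y ∷ c) []      = refl
  go c       (x ∷ e) =
    trans (+-congʳ {⟦ natListEq c [] ⟧ * ⟦ natListEq d (x ∷ e) ⟧}
      (trans (cong (λ is → ∑ is (λ i → ⟦ natListEq c (L.take i (x ∷ e)) ⟧ * ⟦ natListEq d (L.drop i (x ∷ e)) ⟧)) (sym (map-upTo suc (suc (length e)))))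
             (∑-map suc (upTo (suc (length e)))))) (step c)
    where
    step : ∀ c → ⟦ natListEq c [] ⟧ * ⟦ natListEq d (x ∷ e) ⟧ +
           ∑ (upTo (suc (length e))) (λ i → ⟦ natListEq c (x ∷ L.take i e) ⟧ * ⟦ natListEq d (L.drop i e) ⟧)
           ≡ ⟦ natListEq (c ++ d) (x ∷ e) ⟧
    step []      = trans (cong₂ _+_ (+-identityʳ _) (∑-zero (upTo (suc (length e))) λ _ → refl)) (+-identityʳ _)
    step (y ∷ c) = trans (∑-cong (upTo (suc (length e))) λ i → trans (*-congˡ (⟦∧⟧ (y ≡ᵇ x) _)) (*-assoc ⟦ y ≡ᵇ x ⟧ _ _))
      (trans (∑-*ˡ (upTo (suc (length e))) ⟦ y ≡ᵇ x ⟧) (trans (cong (⟦ y ≡ᵇ x ⟧ *_) (go c e)) (sym (⟦∧⟧ (y ≡ᵇ x) _))))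

coeff⊗-ΔQ : ∀ c d p → coeff⊗ c d (ΔQ p) ≡ coeff (c ++ d) p
coeff⊗-ΔQ c d p =
  trans (coeff⊗-∑ c d (ΔQ p))
    (trans (∑-concatMap ΔM p)
      (trans (∑-cong p λ e → trans (sym (coeff⊗-∑ c d (ΔM e))) (coeff⊗-ΔM c d e)) (sym (coeff-∑ (c ++ d) p))))

-- Matrices of fibre sizes and maps into a lexicographic product

tabulate-+ : ∀ {A : Set} m {n} (g : Fin (m + n) → A) →
             L.tabulate g ≡ L.tabulate (λ i → g (i ↑ˡ n)) ++ L.tabulate (λ j → g (m ↑ʳ j))
tabulate-+ zero    g = refl
tabulate-+ (suc m) g = cong₂ _∷_ refl (tabulate-+ m (g ∘ F.suc))

-- The two-dimensional analogue of `splits-δ`: a given matrix occurs once, and only under its own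
-- row and column sums. The induction removes the first row α, which leaves the column sums β with c
-- = α + β.
matrices-δ : ∀ d c m → length c ≡ m → (g : Fin (length d * m) → ℕ) →
  ∑ (matrices d c) (λ A → ⟦ natListEq A (L.tabulate g) ⟧) ≡
  ⟦ natListEq d (L.tabulate {n = length d} (λ i → ∑ (allFin m) (λ j → g (combine i j)))) ⟧ *
  ⟦ natListEq c (L.tabulate (λ j → ∑ (allFin (length d)) (λ i → g (combine i j)))) ⟧
matrices-δ [] c m refl g =
  trans (∑-matrices-[] c) (trans (*-identityʳ _) (trans (cong ⟦_⟧ (sym (natListEq-zeros c))) (sym (+-identityʳ _))))
matrices-δ (y ∷ d) c m len g = begin
  ∑ (matrices (y ∷ d) c) (λ A → ⟦ natListEq A (L.tabulate g) ⟧)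
    ≡⟨ ∑-matrices-∷ y d c ⟩
  ∑ (splits c) (λ (α , β) → ⟦ y ≡ᵇ sum α ⟧ * ∑ (matrices d β) (λ A → ⟦ natListEq (α ++ A) (L.tabulate g) ⟧))
    ≡⟨ ∑-cong-splits c (λ α β ea eb → split-first α β (trans ea len) (trans eb len)) ⟩
  ∑ (splits c) (λ (α , β) → ⟦ y ≡ᵇ ∑ (allFin m) g₁ ⟧ * ⟦ natListEq d rows ⟧ * (⟦ natListEq α (L.tabulate g₁) ⟧ * ⟦ natListEq β (L.tabulate cols) ⟧))
    ≡⟨ ∑-*ˡ (splits c) (⟦ y ≡ᵇ ∑ (allFin m) g₁ ⟧ * ⟦ natListEq d rows ⟧) ⟩
  _ ≡⟨ cong₂ _*_ (sym (⟦∧⟧ (y ≡ᵇ ∑ (allFin m) g₁) _))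
         (trans (splits-δ c (L.tabulate g₁) (L.tabulate cols) (trans (length-tabulate g₁) (sym (length-tabulate cols))))
           (cong (λ e → ⟦ natListEq c e ⟧) (trans (tabulate-⊕ g₁ cols) (tabulate-cong λ j → sym (∑-allFin-suc (length d) (λ i → g (combine i j))))))) ⟩
  _ ∎
  where
  open ≡-Reasoning
  g₁ : Fin m → ℕ
  g₁ j = g (j ↑ˡ (length d * m))
  g₂ : Fin (length d * m) → ℕ
  g₂ k = g (m ↑ʳ k)
  rows = L.tabulate {n = length d} (λ i → ∑ (allFin m) (λ j → g₂ (combine i j)))
  cols : Fin m → ℕ
  cols j = ∑ (allFin (length d)) (λ i → g₂ (combine i j))

  rearrange : ∀ s t u v w → (t ≡ true → s ≡ v) → ⟦ s ⟧ * (⟦ t ⟧ * (u * w)) ≡ ⟦ v ⟧ * u * (⟦ t ⟧ * w)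
  rearrange s true  u v w h rewrite h refl =
    solve 3 (λ u v w → v :* (con 1 :* (u :* w)) := v :* u :* (con 1 :* w)) refl u ⟦ v ⟧ w
  rearrange s false u v w h = trans (*-zeroʳ ⟦ s ⟧) (sym (*-zeroʳ (⟦ v ⟧ * u)))

  split-first : ∀ α β → length α ≡ m → length β ≡ m →
    ⟦ y ≡ᵇ sum α ⟧ * ∑ (matrices d β) (λ A → ⟦ natListEq (α ++ A) (L.tabulate g) ⟧) ≡
    ⟦ y ≡ᵇ ∑ (allFin m) g₁ ⟧ * ⟦ natListEq d rows ⟧ * (⟦ natListEq α (L.tabulate g₁) ⟧ * ⟦ natListEq β (L.tabulate cols) ⟧)
  split-first α β la lb = begin
    ⟦ y ≡ᵇ sum α ⟧ * ∑ (matrices d β) (λ A → ⟦ natListEq (α ++ A) (L.tabulate g) ⟧)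
      ≡⟨ cong (⟦ y ≡ᵇ sum α ⟧ *_) (∑-cong (matrices d β) λ A →
           trans (cong ⟦_⟧ (trans (cong (natListEq (α ++ A)) (tabulate-+ m g)) (natListEq-++ α A (trans la (sym (length-tabulate g₁))))))
                 (⟦∧⟧ (natListEq α (L.tabulate g₁)) _)) ⟩
    ⟦ y ≡ᵇ sum α ⟧ * ∑ (matrices d β) (λ A → ⟦ natListEq α (L.tabulate g₁) ⟧ * ⟦ natListEq A (L.tabulate g₂) ⟧)
      ≡⟨ cong (⟦ y ≡ᵇ sum α ⟧ *_) (trans (∑-*ˡ (matrices d β) ⟦ natListEq α (L.tabulate g₁) ⟧) (cong (⟦ natListEq α (L.tabulate g₁) ⟧ *_) (matrices-δ d β m lb g₂))) ⟩
    ⟦ y ≡ᵇ sum α ⟧ * (⟦ natListEq α (L.tabulate g₁) ⟧ * (⟦ natListEq d rows ⟧ * ⟦ natListEq β (L.tabulate cols) ⟧))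
      -- Where the indicator is nonzero, α is the first row, so its sum may be computed from `g₁`.
      ≡⟨ rearrange (y ≡ᵇ sum α) (natListEq α (L.tabulate g₁)) ⟦ natListEq d rows ⟧ (y ≡ᵇ ∑ (allFin m) g₁) _
           (λ e → cong (y ≡ᵇ_) (trans (cong sum (natListEq⁻ {α} e)) (sum-tabulate g₁))) ⟩
    _ ∎

∑-cong-matrices : ∀ d c m → length c ≡ m → {f g : List ℕ → ℕ} →
  (∀ A → length A ≡ length d * m → f A ≡ g A) → ∑ (matrices d c) f ≡ ∑ (matrices d c) g
∑-cong-matrices [] c m len h =
  trans (∑-matrices-[] c) (trans (cong (⟦ natListEq (compress c) [] ⟧ *_) (h [] refl)) (sym (∑-matrices-[] c)))
∑-cong-matrices (y ∷ d) c m len h =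
  trans (∑-matrices-∷ y d c)
    (trans (∑-cong-splits c λ α β ea eb → cong (⟦ y ≡ᵇ sum α ⟧ *_) (∑-cong-matrices d β m (trans eb len) λ A eA →
              h (α ++ A) (trans (length-++ α) (cong₂ _+_ (trans ea len) eA))))
           (sym (∑-matrices-∷ y d c)))

finEq-combine : ∀ {p m} (i i′ : Fin p) (j j′ : Fin m) → finEq (combine i j) (combine i′ j′) ≡ finEq i i′ ∧ finEq j j′
finEq-combine i i′ j j′ = bool-ext
  (λ e → let (ei , ej) = FP.combine-injective i j i′ j′ (finEq⁻ e) in ∧⁺ (finEq⁺ ei) (finEq⁺ ej))
  (λ e → finEq⁺ {i = combine i j} (cong₂ combine (finEq⁻ {i = i} (∧⁻ˡ e)) (finEq⁻ {i = j} (∧⁻ʳ {finEq i i′} e))))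

-- Summing over `j` forgets the second coordinate, so the row sums of the matrix of fibre sizes are
-- the sizes for `g`; in the same way its column sums are those for `f`.
fibre-combine-row : ∀ {p m n} (g : Vec (Fin p) n) (f : Vec (Fin m) n) i →
  ∑ (allFin m) (λ j → fibre (V.zipWith combine g f) (combine i j)) ≡ fibre g i
fibre-combine-row {m = m} []        []        i = ∑-zero (allFin m) λ _ → refl
fibre-combine-row {m = m} (i′ ∷ g) (j′ ∷ f) i =
  trans (∑-+ (allFin m)) (cong₂ _+_
    (trans (∑-cong (allFin m) λ j → trans (cong ⟦_⟧ (finEq-combine i′ i j′ j)) (⟦∧⟧ (finEq i′ i) _))
      (trans (∑-*ˡ (allFin m) ⟦ finEq i′ i ⟧) (trans (cong (⟦ finEq i′ i ⟧ *_) (∑-allFin-δ j′)) (*-identityʳ _))))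
    (fibre-combine-row g f i))

fibre-combine-col : ∀ {p m n} (g : Vec (Fin p) n) (f : Vec (Fin m) n) j →
  ∑ (allFin p) (λ i → fibre (V.zipWith combine g f) (combine i j)) ≡ fibre f j
fibre-combine-col {p} []        []        j = ∑-zero (allFin p) λ _ → refl
fibre-combine-col {p} (i′ ∷ g) (j′ ∷ f) j =
  trans (∑-+ (allFin p)) (cong₂ _+_
    (trans (∑-cong (allFin p) λ i → trans (cong ⟦_⟧ (finEq-combine i′ i j′ j)) (⟦∧⟧ (finEq i′ i) _))
      (trans (∑-*ʳ (allFin p) ⟦ finEq j′ j ⟧) (trans (*-congˡ (∑-allFin-δ i′)) (*-identityˡ _))))
    (fibre-combine-col g f j))

coeff-ρQ-lam : ∀ T c d → coeff⊗ c d (ρQ (lam T)) ≡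
  ⟦ posB c ⟧ * ⟦ posB d ⟧ *
  ∑ (maps (length d) (size T)) (λ g → ∑ (maps (length c) (size T)) (λ f →
    ⟦ compatible T (V.zipWith combine g f) ⟧ * (⟦ natListEq d (sizes g) ⟧ * ⟦ natListEq c (sizes f) ⟧)))
coeff-ρQ-lam T c d = begin
  coeff⊗ c d (ρQ (lam T))
    ≡⟨ trans (coeff⊗-∑ c d (ρQ (lam T))) (trans (∑-concatMap ρM (lam T)) (∑-cong (lam T) λ e → sym (coeff⊗-∑ c d (ρM e)))) ⟩
  ∑ (lam T) (λ e → coeff⊗ c d (ρM e))
    ≡⟨ trans (∑-cong-Positive (Positive-lam T) (coeff-ρM c d)) (∑-*ˡ (lam T) (⟦ posB c ⟧ * ⟦ posB d ⟧)) ⟩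
  both * ∑ (lam T) (λ e → ∑ (matrices d c) (λ A → ⟦ natListEq (compress A) e ⟧))
    ≡⟨ cong (both *_) (∑-swap (lam T) (matrices d c)) ⟩
  both * ∑ (matrices d c) (λ A → ∑ (lam T) (λ e → ⟦ natListEq (compress A) e ⟧))
    -- Quasi-symmetry enters here: the coefficient at the compressed matrix counts maps into all p *
    -- m cells, empty ones included.
    ≡⟨ cong (both *_) (∑-cong-matrices d c m refl λ A eA → trans (sym (coeff-∑ (compress A) (lam T)))
         (trans (coeff-compress-lam T A) (cong (λ k → compatibleCount T k A) eA))) ⟩
  both * ∑ (matrices d c) (λ A → ∑ (maps (p * m) n) (λ h → ⟦ compatible T h ⟧ * ⟦ natListEq A (sizes h) ⟧))
    ≡⟨ cong (both *_) (trans (∑-swap (matrices d c) (maps (p * m) n)) (∑-cong (maps (p * m) n) λ h →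
         trans (∑-*ˡ (matrices d c) ⟦ compatible T h ⟧) (cong (⟦ compatible T h ⟧ *_) (matrices-δ d c m refl (fibre h))))) ⟩
  both * ∑ (maps (p * m) n) (λ h → ⟦ compatible T h ⟧ *
    (⟦ natListEq d (L.tabulate {n = p} (λ i → ∑ (allFin m) (λ j → fibre h (combine i j)))) ⟧ *
     ⟦ natListEq c (L.tabulate (λ j → ∑ (allFin p) (λ i → fibre h (combine i j)))) ⟧))
    ≡⟨ cong (both *_) (∑-maps-* p m n) ⟩
  _ ≡⟨ cong (both *_) (∑-cong (maps p n) λ g → ∑-cong (maps m n) λ f → cong (⟦ compatible T (V.zipWith combine g f) ⟧ *_)
         (cong₂ (λ a b → ⟦ natListEq d a ⟧ * ⟦ natListEq c b ⟧) (tabulate-cong (fibre-combine-row g f)) (tabulate-cong (fibre-combine-col g f)))) ⟩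
  _ ∎
  where
  open ≡-Reasoning
  p = length d
  m = length c
  n = size T
  both = ⟦ posB c ⟧ * ⟦ posB d ⟧

-- Finite topologies as preorders

vec-ext : ∀ {A : Set} {n} {u v : Vec A n} → (∀ i → V.lookup u i ≡ V.lookup v i) → u ≡ v
vec-ext {u = u} {v} h =
  trans (sym (VP.tabulate∘lookup u)) (trans (VP.tabulate-cong h) (VP.tabulate∘lookup v))

_≤⟨_⟩_ : ∀ {n} → Fin n → (Vec Bool n → Bool) → Fin n → Set
x ≤⟨ O ⟩ y = leqT (top _ O) x y ≡ true

≤⟨⟩⁻ : ∀ {n} {O : Vec Bool n → Bool} {x y} → x ≤⟨ O ⟩ y →
       ∀ W → O W ≡ true → V.lookup W x ≡ true → V.lookup W y ≡ true
≤⟨⟩⁻ le W o wx = ⇒ᵇ⁻ (allSubsetsB⁻ le W) (∧⁺ o wx)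

≤⟨⟩⁺ : ∀ {n} {O : Vec Bool n → Bool} {x y} →
       (∀ W → O W ≡ true → V.lookup W x ≡ true → V.lookup W y ≡ true) → x ≤⟨ O ⟩ y
≤⟨⟩⁺ {n} {O} h = allB⁺ (subsets n) λ W → ⇒ᵇ⁺ λ ow → h W (∧⁻ˡ ow) (∧⁻ʳ {O W} ow)

≤⟨⟩-refl : ∀ {n} (O : Vec Bool n → Bool) x → x ≤⟨ O ⟩ x
≤⟨⟩-refl O x = ≤⟨⟩⁺ {O = O} λ W o wx → wx

≤⟨⟩-trans : ∀ {n} (O : Vec Bool n → Bool) {x y z} → x ≤⟨ O ⟩ y → y ≤⟨ O ⟩ z → x ≤⟨ O ⟩ z
≤⟨⟩-trans O p q = ≤⟨⟩⁺ {O = O} λ W o wx → ≤⟨⟩⁻ {O = O} q W o (≤⟨⟩⁻ {O = O} p W o wx)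

record Topology {n : ℕ} (O : Vec Bool n → Bool) : Set where
  field
    open-∅ : O (∅ₛ n) ≡ true
    open-X : O (Xₛ n) ≡ true
    open-∪ : ∀ U W → O U ≡ true → O W ≡ true → O (U ∪ₛ W) ≡ true
    open-∩ : ∀ U W → O U ≡ true → O W ≡ true → O (U ∩ₛ W) ≡ true

isTopology⁻ : ∀ {n} {O : Vec Bool n → Bool} → IsTopology (top n O) → Topology O
isTopology⁻ {n} {O} t = record
  { open-∅ = ∧⁻ˡ t
  ; open-X = ∧⁻ˡ (∧⁻ʳ {O (∅ₛ n)} t)
  ; open-∪ = λ U W oU oW → ∧⁻ˡ (closed U W oU oW)
  ; open-∩ = λ U W oU oW → ∧⁻ʳ {O (U ∪ₛ W)} (closed U W oU oW)
  }
  where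
  closed : ∀ U W → O U ≡ true → O W ≡ true → O (U ∪ₛ W) ∧ O (U ∩ₛ W) ≡ true
  closed U W oU oW =
    ⇒ᵇ⁻ (allSubsetsB⁻ (allSubsetsB⁻ (∧⁻ʳ {O (Xₛ n)} (∧⁻ʳ {O (∅ₛ n)} t)) U) W) (∧⁺ oU oW)

isTopology⁺ : ∀ {n} {O : Vec Bool n → Bool} → Topology O → IsTopology (top n O)
isTopology⁺ {n} {O} t = ∧⁺ open-∅ (∧⁺ open-X
  (allB⁺ (subsets n) λ U → allB⁺ (subsets n) λ W → ⇒ᵇ⁺ λ o →
    ∧⁺ (open-∪ U W (∧⁻ˡ o) (∧⁻ʳ {O U} o)) (open-∩ U W (∧⁻ˡ o) (∧⁻ʳ {O U} o))))
  where open Topology t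

module _ {n : ℕ} {O : Vec Bool n → Bool} (t : Topology O) where
  open Topology t

  private
    -- Over the list of all subsets this is the smallest open neighbourhood of x, formed as a finite
    -- intersection.
    meet : Fin n → List (Vec Bool n) → Vec Bool n
    meet x []       = Xₛ n
    meet x (W ∷ ws) = if O W ∧ V.lookup W x then W ∩ₛ meet x ws else meet x ws

    meet-open : ∀ x ws → O (meet x ws) ≡ true
    meet-open x []       = open-X
    meet-open x (W ∷ ws) with O W in oW | V.lookup W x
    ... | true  | true  = open-∩ W _ oW (meet-open x ws)
    ... | true  | false = meet-open x ws
    ... | false | _     = meet-open x ws

    ∈-meet : ∀ x ws → V.lookup (meet x ws) x ≡ true
    ∈-meet x []       = VP.lookup-replicate x true
    ∈-meet x (W ∷ ws) with O W | V.lookup W x in wx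
    ... | true  | true  = trans (VP.lookup-zipWith _∧_ x W _) (∧⁺ wx (∈-meet x ws))
    ... | true  | false = ∈-meet x ws
    ... | false | _     = ∈-meet x ws

    meet-least : ∀ x y ws → V.lookup (meet x ws) y ≡ true →
                 ∀ {W} → W ∈ ws → O W ≡ true → V.lookup W x ≡ true → V.lookup W y ≡ true
    meet-least x y (W ∷ ws) h (here refl) oW wx rewrite oW | wx =
      ∧⁻ˡ (trans (sym (VP.lookup-zipWith _∧_ y W _)) h)
    meet-least x y (V ∷ ws) h (there i) oW wx with O V | V.lookup V x
    ... | true  | true  = meet-least x y ws (∧⁻ʳ {V.lookup V y} (trans (sym (VP.lookup-zipWith _∧_ y V _)) h)) i oW wx
    ... | true  | false = meet-least x y ws h i oW wx
    ... | false | _     = meet-least x y ws h i oW wx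

    -- Over all points this is the union of the smallest neighbourhoods of the points of `Y`, which
    -- is open for every `Y`.
    join : Vec Bool n → List (Fin n) → Vec Bool n
    join Y []       = ∅ₛ n
    join Y (x ∷ xs) = if V.lookup Y x then meet x (subsets n) ∪ₛ join Y xs else join Y xs

    join-open : ∀ Y xs → O (join Y xs) ≡ true
    join-open Y []       = open-∅
    join-open Y (x ∷ xs) with V.lookup Y x
    ... | true  = open-∪ _ _ (meet-open x (subsets n)) (join-open Y xs)
    ... | false = join-open Y xs

    ∈-join⁺ : ∀ Y x xs → x ∈ xs → V.lookup Y x ≡ true → V.lookup (join Y xs) x ≡ true
    ∈-join⁺ Y x (x ∷ xs) (here refl) yx rewrite yx =
      trans (VP.lookup-zipWith _∨_ x (meet x (subsets n)) _) (∨⁺ˡ (∈-meet x (subsets n)))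
    ∈-join⁺ Y x (z ∷ xs) (there i) yx with V.lookup Y z
    ... | true  = trans (VP.lookup-zipWith _∨_ x (meet z (subsets n)) _)
                        (∨⁺ʳ {V.lookup (meet z (subsets n)) x} (∈-join⁺ Y x xs i yx))
    ... | false = ∈-join⁺ Y x xs i yx

    ∈-join⁻ : ∀ Y y xs → V.lookup (join Y xs) y ≡ true → ∃ λ x → V.lookup Y x ≡ true × x ≤⟨ O ⟩ y
    ∈-join⁻ Y y [] h = case trans (sym (VP.lookup-replicate y false)) h of λ ()
    ∈-join⁻ Y y (x ∷ xs) h with V.lookup Y x in yx
    ... | false = ∈-join⁻ Y y xs h
    ... | true with ∨⁻ {V.lookup (meet x (subsets n)) y} (trans (sym (VP.lookup-zipWith _∨_ y (meet x (subsets n)) _)) h)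
    ...   | inj₁ q = x , yx , ≤⟨⟩⁺ {O = O} (λ W → meet-least x y (subsets n) q (∈-subsets W))
    ...   | inj₂ q = ∈-join⁻ Y y xs q

  -- In a finite topology an up-closed set is the union of the smallest open neighbourhoods of its
  -- points. This is the passage from the quasi-order back to the open sets.
  upclosed⇒open : ∀ Y → (∀ {x y} → x ≤⟨ O ⟩ y → V.lookup Y x ≡ true → V.lookup Y y ≡ true) → O Y ≡ true
  upclosed⇒open Y up = subst (λ W → O W ≡ true) (vec-ext λ y → bool-ext
      (λ h → case ∈-join⁻ Y y (allFin n) h of λ where (x , yx , le) → up le yx)
      (∈-join⁺ Y y (allFin n) (∈-allFin y)))
    (join-open Y (allFin n))

record StrictMap {m n : ℕ} (O : Vec Bool n → Bool) (f : Vec (Fin m) n) : Set where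
  constructor strictMap
  field
    strict : ∀ {x y} → x ≤⟨ O ⟩ y → ¬ (y ≤⟨ O ⟩ x) → V.lookup f x F.< V.lookup f y
    const  : ∀ {x y} → x ≤⟨ O ⟩ y → y ≤⟨ O ⟩ x → V.lookup f x ≡ V.lookup f y

open StrictMap

compatible⁻ : ∀ {m n} O (f : Vec (Fin m) n) → compatible (top n O) f ≡ true → StrictMap O f
compatible⁻ O f h = strictMap
  (λ {x} {y} p q → finLt⁻ (⇒ᵇ⁻ (∧⁻ˡ (allFinB⁻ (allFinB⁻ h x) y)) (∧⁺ p (not⁺ q))))
  (λ {x} {y} p q → finEq⁻ (⇒ᵇ⁻ (∧⁻ʳ {not (ltT (top _ O) x y) ∨ _} (allFinB⁻ (allFinB⁻ h x) y)) (∧⁺ p q)))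

compatible⁺ : ∀ {m n} O (f : Vec (Fin m) n) → StrictMap O f → compatible (top n O) f ≡ true
compatible⁺ {n = n} O f h = allB⁺ (allFin n) λ x → allB⁺ (allFin n) λ y → ∧⁺
  (⇒ᵇ⁺ λ lt → finLt⁺ (strict h {x} {y} (∧⁻ˡ lt) (not⁻ (∧⁻ʳ {leqT (top n O) x y} lt))))
  (⇒ᵇ⁺ λ eq → finEq⁺ (const h {x} {y} (∧⁻ˡ eq) (∧⁻ʳ {leqT (top n O) x y} eq)))

-- Invariance under homeomorphism

-- A bijection expressed by counting: every b has one preimage in `xs` and one occurrence in `ys`.
-- Inserting the indicator of φ a = b and exchanging the sums moves `f` from `φ a` to b.
∑-reindex : ∀ {A B : Set} (xs : List A) (ys : List B) (_==_ : B → B → Bool) (φ : A → B) →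
  (∀ {b b′} → (b == b′) ≡ true → b ≡ b′) →
  (∀ b → ∑ xs (λ a → ⟦ φ a == b ⟧) ≡ 1) → (∀ b → ∑ ys (λ b′ → ⟦ b == b′ ⟧) ≡ 1) →
  (f : B → ℕ) → ∑ xs (f ∘ φ) ≡ ∑ ys f
∑-reindex xs ys _==_ φ sound hit total f = begin
  ∑ xs (λ a → f (φ a))
    ≡⟨ ∑-cong xs (λ a → trans (∑-*ʳ ys (f (φ a))) (trans (*-congˡ (total (φ a))) (*-identityˡ _))) ⟨
  ∑ xs (λ a → ∑ ys (λ b → ⟦ φ a == b ⟧ * f (φ a)))
    ≡⟨ ∑-cong xs (λ a → ∑-cong ys λ b → guard (φ a == b) (λ e → cong f (sound e))) ⟩
  ∑ xs (λ a → ∑ ys (λ b → ⟦ φ a == b ⟧ * f b))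
    ≡⟨ ∑-swap xs ys ⟩
  ∑ ys (λ b → ∑ xs (λ a → ⟦ φ a == b ⟧ * f b))
    ≡⟨ ∑-cong ys (λ b → trans (∑-*ʳ xs (f b)) (trans (*-congˡ (hit b)) (*-identityˡ _))) ⟩
  ∑ ys f ∎
  where open ≡-Reasoning

mapEq : ∀ {m n} → Vec (Fin m) n → Vec (Fin m) n → Bool
mapEq []      []      = true
mapEq (i ∷ u) (j ∷ v) = finEq i j ∧ mapEq u v

mapEq⁺ : ∀ {m n} {u v : Vec (Fin m) n} → u ≡ v → mapEq u v ≡ true
mapEq⁺ {u = []}    refl = refl
mapEq⁺ {u = i ∷ u} refl = ∧⁺ (finEq⁺ {i = i} refl) (mapEq⁺ {u = u} refl)

mapEq⁻ : ∀ {m n} {u v : Vec (Fin m) n} → mapEq u v ≡ true → u ≡ v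
mapEq⁻ {u = []}    {[]}    p = refl
mapEq⁻ {u = i ∷ u} {j ∷ v} p = cong₂ _∷_ (finEq⁻ (∧⁻ˡ p)) (mapEq⁻ (∧⁻ʳ {finEq i j} p))

∑-maps-δ : ∀ {m n} (u : Vec (Fin m) n) → ∑ (maps m n) (λ v → ⟦ mapEq u v ⟧) ≡ 1
∑-maps-δ []      = refl
∑-maps-δ {m} {suc n} (i ∷ u) =
  trans (∑-maps-suc m n)
    (trans (∑-cong (maps m n) λ v →
              trans (∑-cong (allFin m) λ j → ⟦∧⟧ (finEq i j) (mapEq u v))
                (trans (∑-*ʳ (allFin m) ⟦ mapEq u v ⟧) (trans (*-congˡ (∑-allFin-δ i)) (*-identityˡ _))))
           (∑-maps-δ u))

module _ {n₁ n₂ : ℕ} {O₁ : Vec Bool n₁ → Bool} {O₂ : Vec Bool n₂ → Bool}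
         (homeo : Homeomorphic (top n₁ O₁) (top n₂ O₂)) where

  private
    to : Fin n₁ → Fin n₂
    to = Bijection.to (proj₁ homeo)
    from : Fin n₂ → Fin n₁
    from y = proj₁ (Bijection.surjective (proj₁ homeo) y)
    to∘from : ∀ y → to (from y) ≡ y
    to∘from y = proj₂ (Bijection.surjective (proj₁ homeo) y) refl
    from∘to : ∀ x → from (to x) ≡ x
    from∘to x = Bijection.injective (proj₁ homeo) (to∘from (to x))

    pull : ∀ {A : Set} → Vec A n₂ → Vec A n₁
    pull W = V.tabulate (V.lookup W ∘ to)
    push : ∀ {A : Set} → Vec A n₁ → Vec A n₂
    push W = V.tabulate (V.lookup W ∘ from)
    lookup-pull : ∀ {A : Set} (W : Vec A n₂) x → V.lookup (pull W) x ≡ V.lookup W (to x)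
    lookup-pull W x = VP.lookup∘tabulate _ x
    pull∘push : ∀ {A : Set} (W : Vec A n₁) → pull (push W) ≡ W
    pull∘push W = vec-ext λ x →
      trans (lookup-pull (push W) x) (trans (VP.lookup∘tabulate _ (to x)) (cong (V.lookup W) (from∘to x)))
    push∘pull : ∀ {A : Set} (W : Vec A n₂) → push (pull W) ≡ W
    push∘pull W = vec-ext λ y →
      trans (VP.lookup∘tabulate _ y) (trans (lookup-pull W (from y)) (cong (V.lookup W) (to∘from y)))

    -- Pulling back and pushing forward are inverse on subsets and preserve openness, so both orders
    -- are tested by the same sets.
    leq-to : ∀ x y → leqT (top n₂ O₂) (to x) (to y) ≡ leqT (top n₁ O₁) x y
    leq-to x y = bool-ext
      (λ le → ≤⟨⟩⁺ {O = O₁} λ W o wx →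
        let W≡ = pull∘push W in
        subst (λ V → V.lookup V y ≡ true) W≡ (trans (lookup-pull (push W) y)
          (≤⟨⟩⁻ {O = O₂} le (push W) (trans (proj₂ homeo (push W)) (trans (cong O₁ W≡) o))
            (trans (sym (lookup-pull (push W) x)) (trans (cong (λ V → V.lookup V x) W≡) wx)))))
      (λ le → ≤⟨⟩⁺ {O = O₂} λ W o wx → trans (sym (lookup-pull W y))
        (≤⟨⟩⁻ {O = O₁} le (pull W) (trans (sym (proj₂ homeo W)) o) (trans (lookup-pull W x) wx)))

    -- Since `to` has the right inverse `from`, an arbitrary point may be taken to be an image.
    at-to : ∀ {P : Fin n₂ → Set} → (∀ x → P (to x)) → ∀ y → P y
    at-to {P} h y = subst P (to∘from y) (h (from y))

    compatible-pull : ∀ {m} (f : Vec (Fin m) n₂) → compatible (top n₁ O₁) (pull f) ≡ compatible (top n₂ O₂) f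
    compatible-pull f = bool-ext
      (λ c → let sm = compatible⁻ O₁ (pull f) c in compatible⁺ O₂ f (strictMap
        (λ {x} {y} → at-to {λ x → ∀ y → x ≤⟨ O₂ ⟩ y → ¬ (y ≤⟨ O₂ ⟩ x) → V.lookup f x F.< V.lookup f y}
          (λ x → at-to λ y p q → subst₂ F._<_ (lookup-pull f x) (lookup-pull f y)
            (strict sm (trans (sym (leq-to x y)) p) (λ r → q (trans (leq-to y x) r)))) x y)
        (λ {x} {y} → at-to {λ x → ∀ y → x ≤⟨ O₂ ⟩ y → y ≤⟨ O₂ ⟩ x → V.lookup f x ≡ V.lookup f y}
          (λ x → at-to λ y p q → subst₂ _≡_ (lookup-pull f x) (lookup-pull f y)
            (const sm (trans (sym (leq-to x y)) p) (trans (sym (leq-to y x)) q))) x y)))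
      (λ c → let sm = compatible⁻ O₂ f c in compatible⁺ O₁ (pull f) (strictMap
        (λ {x} {y} p q → subst₂ F._<_ (sym (lookup-pull f x)) (sym (lookup-pull f y))
          (strict sm (trans (leq-to x y) p) (λ r → q (trans (sym (leq-to y x)) r))))
        (λ {x} {y} p q → subst₂ _≡_ (sym (lookup-pull f x)) (sym (lookup-pull f y))
          (const sm (trans (leq-to x y) p) (trans (leq-to y x) q)))))

    ∑-to : (h : Fin n₂ → ℕ) → ∑ (allFin n₁) (h ∘ to) ≡ ∑ (allFin n₂) h
    ∑-to = ∑-reindex (allFin n₁) (allFin n₂) finEq to finEq⁻
      (λ y → trans (∑-cong (allFin n₁) λ x → cong ⟦_⟧ (bool-ext
          (λ e → finEq⁺ {i = from y} (trans (cong from (sym (finEq⁻ {i = to x} e))) (from∘to x)))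
          (λ e → finEq⁺ {i = to x} (trans (cong to (sym (finEq⁻ {i = from y} e))) (to∘from y)))))
        (∑-allFin-δ (from y)))
      ∑-allFin-δ

    sizes-pull : ∀ {m} (f : Vec (Fin m) n₂) → sizes (pull f) ≡ sizes f
    sizes-pull f = tabulate-cong λ j → trans (fibre-∑ (pull f) j)
      (trans (∑-cong (allFin n₁) λ x → cong (λ i → ⟦ finEq i j ⟧) (lookup-pull f x))
        (trans (∑-to λ y → ⟦ finEq (V.lookup f y) j ⟧) (sym (fibre-∑ f j))))

  lam-homeomorphic : lam (top n₁ O₁) ≈Q lam (top n₂ O₂)
  lam-homeomorphic c = trans (coeff-lam (top n₁ O₁) c) (trans (cong (⟦ posB c ⟧ *_) (sym count))
                             (sym (coeff-lam (top n₂ O₂) c)))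
    where
    m = length c
    count : compatibleCount (top n₂ O₂) m c ≡ compatibleCount (top n₁ O₁) m c
    count = trans (∑-cong (maps m n₂) λ f → sym (cong₂ (λ a b → ⟦ a ⟧ * ⟦ natListEq c b ⟧) (compatible-pull f) (sizes-pull f)))
      -- Precomposition with the homeomorphism is a bijection of maps; its inverse `push` supplies
      -- the unique preimage.
      (∑-reindex (maps m n₂) (maps m n₁) mapEq pull mapEq⁻
        (λ u → trans (∑-cong (maps m n₂) λ f → cong ⟦_⟧ (bool-ext
            (λ e → mapEq⁺ {u = push u} (trans (cong push (sym (mapEq⁻ {u = pull f} e))) (push∘pull f)))
            (λ e → mapEq⁺ {u = pull f} (trans (cong pull (sym (mapEq⁻ {u = push u} e))) (pull∘push u)))))
          (∑-maps-δ (push u)))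
        ∑-maps-δ (λ f → ⟦ compatible (top n₁ O₁) f ⟧ * ⟦ natListEq c (sizes f) ⟧))

-- Products

↑-cases : ∀ m {n} (x : Fin (m + n)) → (∃ λ i → x ≡ i ↑ˡ n) ⊎ (∃ λ j → x ≡ m ↑ʳ j)
↑-cases zero    x         = inj₂ (x , refl)
↑-cases (suc m) F.zero    = inj₁ (F.zero , refl)
↑-cases (suc m) (F.suc x) with ↑-cases m x
... | inj₁ (i , eq) = inj₁ (F.suc i , cong F.suc eq)
... | inj₂ (j , eq) = inj₂ (j , cong F.suc eq)

module _ {n₁ n₂ : ℕ} {O₁ : Vec Bool n₁ → Bool} {O₂ : Vec Bool n₂ → Bool}
         (t₁ : Topology O₁) (t₂ : Topology O₂) where
  private
    module T₁ = Topology t₁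
    module T₂ = Topology t₂
    O : Vec Bool (n₁ + n₂) → Bool
    O = isOpen (prodT (top n₁ O₁) (top n₂ O₂))

    O-++ : ∀ U W → O₁ U ≡ true → O₂ W ≡ true → O (U V.++ W) ≡ true
    O-++ U W oU oW rewrite take-++ U W | drop-++ U W = ∧⁺ oU oW

    lookup-take : ∀ (W : Vec Bool (n₁ + n₂)) (i : Fin n₁) → V.lookup (V.take n₁ W) i ≡ V.lookup W (i ↑ˡ n₂)
    lookup-take W i = trans (sym (VP.lookup-++ˡ (V.take n₁ W) (V.drop n₁ W) i))
                            (cong (λ V → V.lookup V (i ↑ˡ n₂)) (VP.take++drop≡id n₁ W))
    lookup-drop : ∀ (W : Vec Bool (n₁ + n₂)) (j : Fin n₂) → V.lookup (V.drop n₁ W) j ≡ V.lookup W (n₁ ↑ʳ j)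
    lookup-drop W j = trans (sym (VP.lookup-++ʳ (V.take n₁ W) (V.drop n₁ W) j))
                            (cong (λ V → V.lookup V (n₁ ↑ʳ j)) (VP.take++drop≡id n₁ W))

    -- To test the order of the first summand, an open set of it is completed by the empty set of
    -- the second.
    left⁻ : ∀ {i j} → (i ↑ˡ n₂) ≤⟨ O ⟩ (j ↑ˡ n₂) → i ≤⟨ O₁ ⟩ j
    left⁻ {i} {j} le = ≤⟨⟩⁺ {O = O₁} λ W o wi → trans (sym (VP.lookup-++ˡ W (∅ₛ n₂) j))
      (≤⟨⟩⁻ {O = O} le (W V.++ ∅ₛ n₂) (O-++ W _ o T₂.open-∅) (trans (VP.lookup-++ˡ W (∅ₛ n₂) i) wi))
    left⁺ : ∀ {i j} → i ≤⟨ O₁ ⟩ j → (i ↑ˡ n₂) ≤⟨ O ⟩ (j ↑ˡ n₂)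
    left⁺ {i} {j} le = ≤⟨⟩⁺ {O = O} λ W o wi → trans (sym (lookup-take W j))
      (≤⟨⟩⁻ {O = O₁} le (V.take n₁ W) (∧⁻ˡ o) (trans (lookup-take W i) wi))
    right⁻ : ∀ {i j} → (n₁ ↑ʳ i) ≤⟨ O ⟩ (n₁ ↑ʳ j) → i ≤⟨ O₂ ⟩ j
    right⁻ {i} {j} le = ≤⟨⟩⁺ {O = O₂} λ W o wi → trans (sym (VP.lookup-++ʳ (∅ₛ n₁) W j))
      (≤⟨⟩⁻ {O = O} le (∅ₛ n₁ V.++ W) (O-++ _ W T₁.open-∅ o) (trans (VP.lookup-++ʳ (∅ₛ n₁) W i) wi))
    right⁺ : ∀ {i j} → i ≤⟨ O₂ ⟩ j → (n₁ ↑ʳ i) ≤⟨ O ⟩ (n₁ ↑ʳ j)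
    right⁺ {i} {j} le = ≤⟨⟩⁺ {O = O} λ W o wi → trans (sym (lookup-drop W j))
      (≤⟨⟩⁻ {O = O₂} le (V.drop n₁ W) (∧⁻ʳ {O₁ (V.take n₁ W)} o) (trans (lookup-drop W i) wi))
    -- The first summand is itself open in the disjoint union and misses the second.
    left≰right : ∀ {i j} → ¬ ((i ↑ˡ n₂) ≤⟨ O ⟩ (n₁ ↑ʳ j))
    left≰right {i} {j} le = case trans (sym (≤⟨⟩⁻ {O = O} le (Xₛ n₁ V.++ ∅ₛ n₂) (O-++ _ _ T₁.open-X T₂.open-∅)
      (trans (VP.lookup-++ˡ (Xₛ n₁) (∅ₛ n₂) i) (VP.lookup-replicate i true))))
      (trans (VP.lookup-++ʳ (Xₛ n₁) (∅ₛ n₂) j) (VP.lookup-replicate j false)) of λ ()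
    right≰left : ∀ {i j} → ¬ ((n₁ ↑ʳ j) ≤⟨ O ⟩ (i ↑ˡ n₂))
    right≰left {i} {j} le = case trans (sym (≤⟨⟩⁻ {O = O} le (∅ₛ n₁ V.++ Xₛ n₂) (O-++ _ _ T₁.open-∅ T₂.open-X)
      (trans (VP.lookup-++ʳ (∅ₛ n₁) (Xₛ n₂) j) (VP.lookup-replicate j true))))
      (trans (VP.lookup-++ˡ (∅ₛ n₁) (Xₛ n₂) i) (VP.lookup-replicate i false)) of λ ()

  compatible-prodT : ∀ {m} (f : Vec (Fin m) n₁) (g : Vec (Fin m) n₂) →
    compatible (prodT (top n₁ O₁) (top n₂ O₂)) (f V.++ g) ≡ compatible (top n₁ O₁) f ∧ compatible (top n₂ O₂) g
  compatible-prodT f g = bool-ext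
    (λ c → let sm = compatible⁻ O (f V.++ g) c in ∧⁺
      (compatible⁺ O₁ f (strictMap
        (λ {x} {y} p q → subst₂ F._<_ (VP.lookup-++ˡ f g x) (VP.lookup-++ˡ f g y) (strict sm (left⁺ p) (q ∘ left⁻)))
        (λ {x} {y} p q → subst₂ _≡_ (VP.lookup-++ˡ f g x) (VP.lookup-++ˡ f g y) (const sm (left⁺ p) (left⁺ q)))))
      (compatible⁺ O₂ g (strictMap
        (λ {x} {y} p q → subst₂ F._<_ (VP.lookup-++ʳ f g x) (VP.lookup-++ʳ f g y) (strict sm (right⁺ p) (q ∘ right⁻)))
        (λ {x} {y} p q → subst₂ _≡_ (VP.lookup-++ʳ f g x) (VP.lookup-++ʳ f g y) (const sm (right⁺ p) (right⁺ q))))))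
    (λ c → compatible⁺ O (f V.++ g) (strictMap
      (λ {x} {y} → str (compatible⁻ O₁ f (∧⁻ˡ c)) (compatible⁻ O₂ g (∧⁻ʳ {compatible (top n₁ O₁) f} c)) x y)
      (λ {x} {y} → con′ (compatible⁻ O₁ f (∧⁻ˡ c)) (compatible⁻ O₂ g (∧⁻ʳ {compatible (top n₁ O₁) f} c)) x y)))
    where
    str : StrictMap O₁ f → StrictMap O₂ g → ∀ x y → x ≤⟨ O ⟩ y → ¬ (y ≤⟨ O ⟩ x) → V.lookup (f V.++ g) x F.< V.lookup (f V.++ g) y
    str s₁ s₂ x y p q with ↑-cases n₁ x | ↑-cases n₁ y
    ... | inj₁ (i , refl) | inj₁ (j , refl) =
      subst₂ F._<_ (sym (VP.lookup-++ˡ f g i)) (sym (VP.lookup-++ˡ f g j)) (strict s₁ (left⁻ p) (q ∘ left⁺))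
    ... | inj₁ (i , refl) | inj₂ (j , refl) = ⊥-elim (left≰right p)
    ... | inj₂ (i , refl) | inj₁ (j , refl) = ⊥-elim (right≰left p)
    ... | inj₂ (i , refl) | inj₂ (j , refl) =
      subst₂ F._<_ (sym (VP.lookup-++ʳ f g i)) (sym (VP.lookup-++ʳ f g j)) (strict s₂ (right⁻ p) (q ∘ right⁺))
    con′ : StrictMap O₁ f → StrictMap O₂ g → ∀ x y → x ≤⟨ O ⟩ y → y ≤⟨ O ⟩ x → V.lookup (f V.++ g) x ≡ V.lookup (f V.++ g) y
    con′ s₁ s₂ x y p q with ↑-cases n₁ x | ↑-cases n₁ y
    ... | inj₁ (i , refl) | inj₁ (j , refl) =
      subst₂ _≡_ (sym (VP.lookup-++ˡ f g i)) (sym (VP.lookup-++ˡ f g j)) (const s₁ (left⁻ p) (left⁻ q))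
    ... | inj₁ (i , refl) | inj₂ (j , refl) = ⊥-elim (left≰right p)
    ... | inj₂ (i , refl) | inj₁ (j , refl) = ⊥-elim (right≰left p)
    ... | inj₂ (i , refl) | inj₂ (j , refl) =
      subst₂ _≡_ (sym (VP.lookup-++ʳ f g i)) (sym (VP.lookup-++ʳ f g j)) (const s₂ (right⁻ p) (right⁻ q))

  lam-prodT : lam (prodT (top n₁ O₁) (top n₂ O₂)) ≈Q mulQ (lam (top n₁ O₁)) (lam (top n₂ O₂))
  lam-prodT c = begin
    coeff c (lam P)
      ≡⟨ coeff-lam P c ⟩
    ⟦ posB c ⟧ * ∑ (maps m (n₁ + n₂)) (λ h → ⟦ compatible P h ⟧ * ⟦ natListEq c (sizes h) ⟧)
      ≡⟨ cong (⟦ posB c ⟧ *_) (trans (∑-maps-++ m n₁ n₂) (∑-cong (maps m n₁) λ f → ∑-cong (maps m n₂) λ g →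
           cong₂ _*_ (trans (cong ⟦_⟧ (compatible-prodT f g)) (⟦∧⟧ (compatible U₁ f) _))
             (cong (λ a → ⟦ natListEq c a ⟧) (trans (tabulate-cong (fibre-++ f g)) (sym (tabulate-⊕ (fibre f) (fibre g))))))) ⟩
    ⟦ posB c ⟧ * ∑ (maps m n₁) (λ f → ∑ (maps m n₂) (λ g → ⟦ compatible U₁ f ⟧ * ⟦ compatible U₂ g ⟧ * ⟦ natListEq c (sizes f ⊕ sizes g) ⟧))
      ≡⟨ cong (⟦ posB c ⟧ *_) (∑-convolution (maps m n₁) (maps m n₂) c (λ f → ⟦ compatible U₁ f ⟧) (λ g → ⟦ compatible U₂ g ⟧) sizes sizes
           (λ f g → trans (length-tabulate (fibre f)) (sym (length-tabulate (fibre g))))) ⟩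
    ⟦ posB c ⟧ * ∑ (splits c) (λ (α , β) → compatibleCount U₁ m α * compatibleCount U₂ m β)
      -- The halves of a splitting may contain zeros, so the counts are read as coefficients at
      -- compressed lists, the form that `coeff-mulQ` delivers.
      ≡⟨ cong (⟦ posB c ⟧ *_) (∑-cong-splits c λ α β ea eb → sym (cong₂ _*_
           (trans (coeff-compress-lam U₁ α) (cong (λ k → compatibleCount U₁ k α) ea))
           (trans (coeff-compress-lam U₂ β) (cong (λ k → compatibleCount U₂ k β) eb)))) ⟩
    ⟦ posB c ⟧ * ∑ (splits c) (λ (α , β) → coeff (compress α) (lam U₁) * coeff (compress β) (lam U₂))
      ≡⟨ coeff-mulQ c (lam U₁) (lam U₂) (Positive-lam U₁) (Positive-lam U₂) ⟨
    _ ∎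
    where
    open ≡-Reasoning
    U₁ = top n₁ O₁
    U₂ = top n₂ O₂
    P = prodT U₁ U₂
    m = length c

-- The empty composition asks for maps into zero blocks, and a nonempty set has none.
counit-lam : ∀ T → counitQ (lam T) ≡ counitH T
counit-lam (top zero O)    = coeff-lam (top zero O) []
counit-lam (top (suc n) O) =
  trans (coeff-lam (top (suc n) O) []) (trans (*-identityˡ _) (trans (∑-maps-suc 0 n) (∑-zero (maps 0 n) λ _ → refl)))

-- The coproduct

-- The points of `Y` get the last m₂ values, in accordance with open sets being final segments.
merge : ∀ {m₁ m₂ n} (Y : Vec Bool n) → Vec (Fin m₁) (card (V.map not Y)) → Vec (Fin m₂) (card Y) → Vec (Fin (m₁ + m₂)) n
merge           []          f       g       = []
merge {m₁}      (true  ∷ Y) f       (j ∷ g) = (m₁ ↑ʳ j) ∷ merge Y f g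
merge {m₂ = m₂} (false ∷ Y) (i ∷ f) g       = (i ↑ˡ m₂) ∷ merge Y f g

-- A map determines `Y` as the set of points with one of the last m₂ values; the induction decides
-- whether the first point is in `Y` by splitting `allFin (m₁ + m₂)` into its two blocks.
∑-merge : ∀ m₁ m₂ n (F : Vec (Fin (m₁ + m₂)) n → ℕ) →
  ∑ (subsets n) (λ Y → ∑ (maps m₁ (card (V.map not Y))) (λ f → ∑ (maps m₂ (card Y)) (λ g → F (merge Y f g)))) ≡
  ∑ (maps (m₁ + m₂) n) F
∑-merge m₁ m₂ zero F = trans (+-identityʳ _) (+-identityʳ _)
∑-merge m₁ m₂ (suc n) F = begin
  ∑ (subsets (suc n)) G
    ≡⟨ trans (∑-concatMap _ (subsets n)) (∑-cong (subsets n) λ Y → cong (G (true ∷ Y) +_) (+-identityʳ (G (false ∷ Y)))) ⟩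
  ∑ (subsets n) (λ Y → G (true ∷ Y) + G (false ∷ Y))
    ≡⟨ ∑-cong (subsets n) step ⟩
  ∑ (subsets n) (λ Y → ∑ (fs Y) (λ f → ∑ (gs Y) (λ g → ∑ (allFin (m₁ + m₂)) (λ k → F (k ∷ merge Y f g)))))
    ≡⟨ ∑-merge m₁ m₂ n (λ h → ∑ (allFin (m₁ + m₂)) (λ k → F (k ∷ h))) ⟩
  ∑ (maps (m₁ + m₂) n) (λ h → ∑ (allFin (m₁ + m₂)) (λ k → F (k ∷ h)))
    ≡⟨ ∑-maps-suc (m₁ + m₂) n ⟨
  _ ∎
  where
  open ≡-Reasoning
  fs : ∀ {n} (Y : Vec Bool n) → List (Vec (Fin m₁) (card (V.map not Y)))
  fs Y = maps m₁ (card (V.map not Y))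
  gs : ∀ {n} (Y : Vec Bool n) → List (Vec (Fin m₂) (card Y))
  gs Y = maps m₂ (card Y)
  G : Vec Bool (suc n) → ℕ
  G Y = ∑ (fs Y) (λ f → ∑ (gs Y) (λ g → F (merge Y f g)))
  step : ∀ Y → G (true ∷ Y) + G (false ∷ Y) ≡
         ∑ (fs Y) (λ f → ∑ (gs Y) (λ g → ∑ (allFin (m₁ + m₂)) (λ k → F (k ∷ merge Y f g))))
  step Y = begin
    G (true ∷ Y) + G (false ∷ Y)
      ≡⟨ cong₂ _+_ (∑-cong (fs Y) λ f → ∑-maps-suc m₂ (card Y))
                   (trans (∑-maps-suc m₁ (card (V.map not Y))) (∑-cong (fs Y) λ f → ∑-swap (allFin m₁) (gs Y))) ⟩
    ∑ (fs Y) (λ f → ∑ (gs Y) (λ g → ∑ (allFin m₂) (λ j → F ((m₁ ↑ʳ j) ∷ merge Y f g)))) +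
    ∑ (fs Y) (λ f → ∑ (gs Y) (λ g → ∑ (allFin m₁) (λ i → F ((i ↑ˡ m₂) ∷ merge Y f g))))
      ≡⟨ trans (sym (∑-+ (fs Y))) (∑-cong (fs Y) λ f → sym (∑-+ (gs Y))) ⟩
    _ ≡⟨ ∑-cong (fs Y) (λ f → ∑-cong (gs Y) λ g → trans (+-comm (∑ (allFin m₂) (λ j → F ((m₁ ↑ʳ j) ∷ merge Y f g))) _) (sym (∑-allFin-+ m₁))) ⟩
    _ ∎

emb-cases : ∀ {n} (Y : Vec Bool n) x → (∃ λ j → x ≡ emb Y j) ⊎ (∃ λ i → x ≡ emb (V.map not Y) i)
emb-cases (true  ∷ Y) F.zero = inj₁ (F.zero , refl)
emb-cases (false ∷ Y) F.zero = inj₂ (F.zero , refl)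
emb-cases (true  ∷ Y) (F.suc x) with emb-cases Y x
... | inj₁ (j , eq) = inj₁ (F.suc j , cong F.suc eq)
... | inj₂ (i , eq) = inj₂ (i , cong F.suc eq)
emb-cases (false ∷ Y) (F.suc x) with emb-cases Y x
... | inj₁ (j , eq) = inj₁ (j , cong F.suc eq)
... | inj₂ (i , eq) = inj₂ (F.suc i , cong F.suc eq)

lookup-emb-not : ∀ {n} (Y : Vec Bool n) i → ¬ (V.lookup Y (emb (V.map not Y) i) ≡ true)
lookup-emb-not Y i = not⁻ (trans (sym (VP.lookup-map (emb (V.map not Y) i) not Y)) (lookup-emb (V.map not Y) i))

module _ {m₁ m₂ : ℕ} where

  lookup-merge-in : ∀ {n} (Y : Vec Bool n) (f : Vec (Fin m₁) (card (V.map not Y))) (g : Vec (Fin m₂) (card Y)) j →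
                    V.lookup (merge Y f g) (emb Y j) ≡ m₁ ↑ʳ V.lookup g j
  lookup-merge-in (true  ∷ Y) f       (k ∷ g) F.zero    = refl
  lookup-merge-in (true  ∷ Y) f       (k ∷ g) (F.suc j) = lookup-merge-in Y f g j
  lookup-merge-in (false ∷ Y) (k ∷ f) g       j         = lookup-merge-in Y f g j

  lookup-merge-out : ∀ {n} (Y : Vec Bool n) (f : Vec (Fin m₁) (card (V.map not Y))) (g : Vec (Fin m₂) (card Y)) i →
                     V.lookup (merge Y f g) (emb (V.map not Y) i) ≡ V.lookup f i ↑ˡ m₂
  lookup-merge-out (true  ∷ Y) f       (k ∷ g) i         = lookup-merge-out Y f g i
  lookup-merge-out (false ∷ Y) (k ∷ f) g       F.zero    = refl
  lookup-merge-out (false ∷ Y) (k ∷ f) g       (F.suc i) = lookup-merge-out Y f g i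

  ↑ˡ-mono : ∀ {i j : Fin m₁} → i F.< j → i ↑ˡ m₂ F.< j ↑ˡ m₂
  ↑ˡ-mono {i} {j} = subst₂ _<_ (sym (FP.toℕ-↑ˡ i m₂)) (sym (FP.toℕ-↑ˡ j m₂))

  ↑ˡ-mono⁻ : ∀ {i j : Fin m₁} → i ↑ˡ m₂ F.< j ↑ˡ m₂ → i F.< j
  ↑ˡ-mono⁻ {i} {j} = subst₂ _<_ (FP.toℕ-↑ˡ i m₂) (FP.toℕ-↑ˡ j m₂)

  ↑ʳ-mono : ∀ {i j : Fin m₂} → i F.< j → m₁ ↑ʳ i F.< m₁ ↑ʳ j
  ↑ʳ-mono {i} {j} p = subst₂ _<_ (sym (FP.toℕ-↑ʳ m₁ i)) (sym (FP.toℕ-↑ʳ m₁ j)) (+-monoʳ-< m₁ p)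

  ↑ʳ-mono⁻ : ∀ {i j : Fin m₂} → m₁ ↑ʳ i F.< m₁ ↑ʳ j → i F.< j
  ↑ʳ-mono⁻ {i} {j} p = +-cancelˡ-< m₁ (toℕ i) (toℕ j) (subst₂ _<_ (FP.toℕ-↑ʳ m₁ i) (FP.toℕ-↑ʳ m₁ j) p)

  ↑ˡ<↑ʳ : ∀ (i : Fin m₁) (j : Fin m₂) → i ↑ˡ m₂ F.< m₁ ↑ʳ j
  ↑ˡ<↑ʳ i j = subst₂ _<_ (sym (FP.toℕ-↑ˡ i m₂)) (sym (FP.toℕ-↑ʳ m₁ j)) (<-≤-trans (FP.toℕ<n i) (m≤m+n m₁ (toℕ j)))

  finEq-↑ˡ : ∀ (i j : Fin m₁) → finEq (i ↑ˡ m₂) (j ↑ˡ m₂) ≡ finEq i j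
  finEq-↑ˡ i j = cong₂ _≡ᵇ_ (FP.toℕ-↑ˡ i m₂) (FP.toℕ-↑ˡ j m₂)

  finEq-↑ʳ : ∀ (i j : Fin m₂) → finEq (m₁ ↑ʳ i) (m₁ ↑ʳ j) ≡ finEq i j
  finEq-↑ʳ i j = bool-ext
    (λ e → finEq⁺ {i = i} (FP.↑ʳ-injective m₁ i j (finEq⁻ e)))
    (λ e → finEq⁺ {i = m₁ ↑ʳ i} (cong (m₁ ↑ʳ_) (finEq⁻ e)))

  finEq-↑ˡ-↑ʳ : ∀ (i : Fin m₁) (j : Fin m₂) → ¬ (finEq (i ↑ˡ m₂) (m₁ ↑ʳ j) ≡ true)
  finEq-↑ˡ-↑ʳ i j e = <⇒≢ (↑ˡ<↑ʳ i j) (cong toℕ (finEq⁻ {i = i ↑ˡ m₂} e))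

  finEq-↑ʳ-↑ˡ : ∀ (i : Fin m₁) (j : Fin m₂) → ¬ (finEq (m₁ ↑ʳ j) (i ↑ˡ m₂) ≡ true)
  finEq-↑ʳ-↑ˡ i j e = <⇒≢ (↑ˡ<↑ʳ i j) (cong toℕ (sym (finEq⁻ {i = m₁ ↑ʳ j} e)))

  fibre-merge-out : ∀ {n} (Y : Vec Bool n) (f : Vec (Fin m₁) (card (V.map not Y))) (g : Vec (Fin m₂) (card Y)) i →
                    fibre (merge Y f g) (i ↑ˡ m₂) ≡ fibre f i
  fibre-merge-out []          []      []      i = refl
  fibre-merge-out (true  ∷ Y) f       (k ∷ g) i = cong₂ _+_ (⟦⟧-false (finEq-↑ʳ-↑ˡ i k)) (fibre-merge-out Y f g i)
  fibre-merge-out (false ∷ Y) (k ∷ f) g       i = cong₂ _+_ (cong ⟦_⟧ (finEq-↑ˡ k i)) (fibre-merge-out Y f g i)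

  fibre-merge-in : ∀ {n} (Y : Vec Bool n) (f : Vec (Fin m₁) (card (V.map not Y))) (g : Vec (Fin m₂) (card Y)) j →
                   fibre (merge Y f g) (m₁ ↑ʳ j) ≡ fibre g j
  fibre-merge-in []          []      []      j = refl
  fibre-merge-in (true  ∷ Y) f       (k ∷ g) j = cong₂ _+_ (cong ⟦_⟧ (finEq-↑ʳ k j)) (fibre-merge-in Y f g j)
  fibre-merge-in (false ∷ Y) (k ∷ f) g       j = cong₂ _+_ (⟦⟧-false (finEq-↑ˡ-↑ʳ k j)) (fibre-merge-in Y f g j)

  sizes-merge : ∀ {n} (Y : Vec Bool n) (f : Vec (Fin m₁) (card (V.map not Y))) (g : Vec (Fin m₂) (card Y)) →
                sizes (merge Y f g) ≡ sizes f ++ sizes g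
  sizes-merge Y f g = trans (tabulate-+ m₁ (fibre (merge Y f g)))
    (cong₂ _++_ (tabulate-cong (fibre-merge-out Y f g)) (tabulate-cong (fibre-merge-in Y f g)))

restrictOpen : ∀ {n} → (Vec Bool n → Bool) → (Y : Vec Bool n) → Vec Bool (card Y) → Bool
restrictOpen {n} O Y = isOpen (restrict (top n O) Y)

restrict-≤⁻ : ∀ {n} (O : Vec Bool n → Bool) Y {i j} → i ≤⟨ restrictOpen O Y ⟩ j → emb Y i ≤⟨ O ⟩ emb Y j
restrict-≤⁻ O Y {i} {j} le = ≤⟨⟩⁺ {O = O} λ W o wi →
  trans (sym (VP.lookup∘tabulate _ j))
    (≤⟨⟩⁻ {O = restrictOpen O Y} le (V.tabulate (λ k → V.lookup W (emb Y k)))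
      (anySubsetsB⁺ W (∧⁺ o (boolVecEq⁺ {U = V.tabulate (λ k → V.lookup W (emb Y k))} refl)))
      (trans (VP.lookup∘tabulate _ i) wi))

restrict-≤⁺ : ∀ {n} (O : Vec Bool n → Bool) Y {i j} → emb Y i ≤⟨ O ⟩ emb Y j → i ≤⟨ restrictOpen O Y ⟩ j
restrict-≤⁺ {n} O Y {i} {j} le = ≤⟨⟩⁺ {O = restrictOpen O Y} λ U o ui → case anyB⁻ (subsets n) o of λ where
  (W , h) → let U≡ = boolVecEq⁻ {U = U} (∧⁻ʳ {O W} h) in
    trans (cong (λ V → V.lookup V j) U≡) (trans (VP.lookup∘tabulate _ j)
      (≤⟨⟩⁻ {O = O} le W (∧⁻ˡ h) (trans (sym (VP.lookup∘tabulate _ i)) (trans (cong (λ V → V.lookup V i) (sym U≡)) ui))))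

module _ {n : ℕ} {O : Vec Bool n → Bool} (t : Topology O) {m₁ m₂ : ℕ}
         (Y : Vec Bool n) (f : Vec (Fin m₁) (card (V.map not Y))) (g : Vec (Fin m₂) (card Y)) where
  private
    Yᶜ = V.map not Y
    h = merge Y f g
    inY = lookup-merge-in Y f g
    outY = lookup-merge-out Y f g

    out<in : ∀ i j → V.lookup h (emb Yᶜ i) F.< V.lookup h (emb Y j)
    out<in i j = subst₂ F._<_ (sym (outY i)) (sym (inY j)) (↑ˡ<↑ʳ _ _)

    module _ (o : O Y ≡ true) (sf : StrictMap (restrictOpen O Yᶜ) f) (sg : StrictMap (restrictOpen O Y) g) where
      in≰out : ∀ {i j} → ¬ (emb Y j ≤⟨ O ⟩ emb Yᶜ i)
      in≰out {i} {j} le = lookup-emb-not Y i (≤⟨⟩⁻ {O = O} le Y o (lookup-emb Y j))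

      merge-strict : ∀ x y → x ≤⟨ O ⟩ y → ¬ (y ≤⟨ O ⟩ x) → V.lookup h x F.< V.lookup h y
      merge-strict x y p q with emb-cases Y x | emb-cases Y y
      ... | inj₁ (i , refl) | inj₁ (j , refl) =
        subst₂ F._<_ (sym (inY i)) (sym (inY j)) (↑ʳ-mono (strict sg (restrict-≤⁺ O Y p) (q ∘ restrict-≤⁻ O Y)))
      ... | inj₁ (i , refl) | inj₂ (j , refl) = ⊥-elim (in≰out p)
      ... | inj₂ (i , refl) | inj₁ (j , refl) = out<in i j
      ... | inj₂ (i , refl) | inj₂ (j , refl) =
        subst₂ F._<_ (sym (outY i)) (sym (outY j)) (↑ˡ-mono (strict sf (restrict-≤⁺ O Yᶜ p) (q ∘ restrict-≤⁻ O Yᶜ)))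

      merge-const : ∀ x y → x ≤⟨ O ⟩ y → y ≤⟨ O ⟩ x → V.lookup h x ≡ V.lookup h y
      merge-const x y p q with emb-cases Y x | emb-cases Y y
      ... | inj₁ (i , refl) | inj₁ (j , refl) =
        trans (inY i) (trans (cong (m₁ ↑ʳ_) (const sg (restrict-≤⁺ O Y p) (restrict-≤⁺ O Y q))) (sym (inY j)))
      ... | inj₁ (i , refl) | inj₂ (j , refl) = ⊥-elim (in≰out p)
      ... | inj₂ (i , refl) | inj₁ (j , refl) = ⊥-elim (in≰out q)
      ... | inj₂ (i , refl) | inj₂ (j , refl) =
        trans (outY i) (trans (cong (_↑ˡ m₂) (const sf (restrict-≤⁺ O Yᶜ p) (restrict-≤⁺ O Yᶜ q))) (sym (outY j)))

    module _ (sh : StrictMap O h) where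
      -- A relation x ≤ y leaving `Y` would lead from the upper values to the lower ones; by
      -- `out<in` this is impossible both for equivalent and for strictly related points.
      upper-open : O Y ≡ true
      upper-open = upclosed⇒open t Y λ {x} {y} → up x y
        where
        up : ∀ x y → x ≤⟨ O ⟩ y → V.lookup Y x ≡ true → V.lookup Y y ≡ true
        up x y le yx with emb-cases Y x | emb-cases Y y
        ... | _               | inj₁ (j , refl) = lookup-emb Y j
        ... | inj₂ (i , refl) | _               = ⊥-elim (lookup-emb-not Y i yx)
        ... | inj₁ (j , refl) | inj₂ (i , refl) with true? (leqT (top n O) (emb Yᶜ i) (emb Y j))
        ...   | inj₁ ge = ⊥-elim (<⇒≢ (out<in i j) (cong toℕ (sym (const sh le ge))))
        ...   | inj₂ ng = ⊥-elim (<-asym (out<in i j) (strict sh le ng))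

      lower-map : StrictMap (restrictOpen O Yᶜ) f
      lower-map = strictMap
        (λ {x} {y} p q → ↑ˡ-mono⁻ {m₁} {m₂} (subst₂ F._<_ (outY x) (outY y) (strict sh (restrict-≤⁻ O Yᶜ p) (q ∘ restrict-≤⁺ O Yᶜ))))
        (λ {x} {y} p q → FP.↑ˡ-injective m₂ _ _ (subst₂ _≡_ (outY x) (outY y) (const sh (restrict-≤⁻ O Yᶜ p) (restrict-≤⁻ O Yᶜ q))))

      upper-map : StrictMap (restrictOpen O Y) g
      upper-map = strictMap
        (λ {x} {y} p q → ↑ʳ-mono⁻ {m₁} {m₂} (subst₂ F._<_ (inY x) (inY y) (strict sh (restrict-≤⁻ O Y p) (q ∘ restrict-≤⁺ O Y))))
        (λ {x} {y} p q → FP.↑ʳ-injective m₁ _ _ (subst₂ _≡_ (inY x) (inY y) (const sh (restrict-≤⁻ O Y p) (restrict-≤⁻ O Y q))))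

  -- Openness of `Y` excludes relations from `Y` to its complement, and relations in the other
  -- direction are respected because the lower values precede the upper ones.
  compatible-merge : O Y ∧ (compatible (restrict (top n O) Yᶜ) f ∧ compatible (restrict (top n O) Y) g) ≡ compatible (top n O) h
  compatible-merge = bool-ext
    (λ c → let o  = ∧⁻ˡ c
               cc = ∧⁻ʳ {O Y} c
               sf = compatible⁻ (restrictOpen O Yᶜ) f (∧⁻ˡ cc)
               sg = compatible⁻ (restrictOpen O Y) g (∧⁻ʳ {compatible (restrict (top n O) Yᶜ) f} cc)
           in compatible⁺ O h (strictMap (λ {x} {y} → merge-strict o sf sg x y) (λ {x} {y} → merge-const o sf sg x y)))
    (λ c → let sh = compatible⁻ O h c in
      ∧⁺ (upper-open sh) (∧⁺ (compatible⁺ (restrictOpen O Yᶜ) f (lower-map sh)) (compatible⁺ (restrictOpen O Y) g (upper-map sh))))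

posB-++ : ∀ c d → posB (c ++ d) ≡ posB c ∧ posB d
posB-++ []          d = refl
posB-++ (zero  ∷ c) d = refl
posB-++ (suc x ∷ c) d = posB-++ c d

lam-ΔH : ∀ {n} {O : Vec Bool n → Bool} → Topology O → lam⊗ (ΔH (top n O)) ≈⊗ ΔQ (lam (top n O))
lam-ΔH {n} {O} t c d = begin
  coeff⊗ c d (lam⊗ (ΔH T))
    ≡⟨ trans (coeff⊗-lam⊗ c d (ΔH T)) (trans (∑-map _ (filterB O (subsets n))) (∑-filterB O (subsets n))) ⟩
  ∑ (subsets n) (λ Y → ⟦ O Y ⟧ * (coeff c (lam (lo Y)) * coeff d (lam (hi Y))))
    ≡⟨ trans (∑-cong (subsets n) λ Y → trans (cong (⟦ O Y ⟧ *_) (cong₂ _*_ (coeff-lam (lo Y) c) (coeff-lam (hi Y) d)))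
         (rearrange ⟦ O Y ⟧ ⟦ posB c ⟧ ⟦ posB d ⟧ _ _)) (∑-*ˡ (subsets n) (⟦ posB c ⟧ * ⟦ posB d ⟧)) ⟩
  both * ∑ (subsets n) (λ Y → ⟦ O Y ⟧ * (compatibleCount (lo Y) k c * compatibleCount (hi Y) l d))
    ≡⟨ cong (both *_) (∑-cong (subsets n) λ Y → expand Y) ⟩
  both * ∑ (subsets n) (λ Y → ∑ (maps k (card (V.map not Y))) (λ f → ∑ (maps l (card Y)) (λ g →
      ⟦ compatible T (merge Y f g) ⟧ * ⟦ natListEq (c ++ d) (sizes (merge Y f g)) ⟧)))
    ≡⟨ cong (both *_) (∑-merge k l n (λ h → ⟦ compatible T h ⟧ * ⟦ natListEq (c ++ d) (sizes h) ⟧)) ⟩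
  both * compatibleCount T (k + l) (c ++ d)
    ≡⟨ cong₂ _*_ (trans (sym (⟦∧⟧ (posB c) (posB d))) (cong ⟦_⟧ (sym (posB-++ c d))))
         (cong (λ m → compatibleCount T m (c ++ d)) (sym (length-++ c))) ⟩
  ⟦ posB (c ++ d) ⟧ * compatibleCount T (length (c ++ d)) (c ++ d)
    ≡⟨ coeff-lam T (c ++ d) ⟨
  coeff (c ++ d) (lam T)
    ≡⟨ coeff⊗-ΔQ c d (lam T) ⟨
  _ ∎
  where
  open ≡-Reasoning
  T = top n O
  k = length c
  l = length d
  both = ⟦ posB c ⟧ * ⟦ posB d ⟧
  lo hi : Vec Bool n → Top
  lo Y = restrict T (V.map not Y)
  hi Y = restrict T Y

  rearrange : ∀ o p q a b → o * (p * a * (q * b)) ≡ p * q * (o * (a * b))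
  rearrange = solve 5 (λ o p q a b → o :* (p :* a :* (q :* b)) := p :* q :* (o :* (a :* b))) refl

  regroup : ∀ o a e b e′ → ⟦ o ⟧ * (⟦ a ⟧ * ⟦ e ⟧ * (⟦ b ⟧ * ⟦ e′ ⟧)) ≡ ⟦ o ∧ (a ∧ b) ⟧ * ⟦ e ∧ e′ ⟧
  regroup o a e b e′ rewrite ⟦∧⟧ o (a ∧ b) | ⟦∧⟧ a b | ⟦∧⟧ e e′ =
    solve 5 (λ o a e b e′ → o :* (a :* e :* (b :* e′)) := o :* (a :* b) :* (e :* e′)) refl ⟦ o ⟧ ⟦ a ⟧ ⟦ e ⟧ ⟦ b ⟧ ⟦ e′ ⟧

  expand : ∀ Y → ⟦ O Y ⟧ * (compatibleCount (lo Y) k c * compatibleCount (hi Y) l d) ≡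
    ∑ (maps k (card (V.map not Y))) (λ f → ∑ (maps l (card Y)) (λ g →
      ⟦ compatible T (merge Y f g) ⟧ * ⟦ natListEq (c ++ d) (sizes (merge Y f g)) ⟧))
  expand Y = trans (cong (⟦ O Y ⟧ *_) (∑-product (maps k (card (V.map not Y))) (maps l (card Y))))
    (trans (sym (∑-*ˡ (maps k (card (V.map not Y))) ⟦ O Y ⟧)) (∑-cong (maps k (card (V.map not Y))) λ f →
      trans (sym (∑-*ˡ (maps l (card Y)) ⟦ O Y ⟧)) (∑-cong (maps l (card Y)) λ g →
        trans (regroup (O Y) (compatible (lo Y) f) (natListEq c (sizes f)) (compatible (hi Y) g) (natListEq d (sizes g)))
          (cong₂ (λ a b → ⟦ a ⟧ * ⟦ b ⟧) (compatible-merge t Y f g)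
            (trans (sym (natListEq-++ c d (sym (length-tabulate (fibre f))))) (cong (natListEq (c ++ d)) (sym (sizes-merge Y f g))))))))

-- The internal coproduct

∑-sublists-∷ : ∀ {A : Set} (x : A) xs {f : List A → ℕ} →
               ∑ (sublists (x ∷ xs)) f ≡ ∑ (sublists xs) (λ s → f (x ∷ s) + f s)
∑-sublists-∷ x xs {f} =
  trans (∑-concatMap _ (sublists xs)) (∑-cong (sublists xs) λ s → cong (f (x ∷ s) +_) (+-identityʳ (f s)))

∑-cong-sublists : ∀ {A : Set} xs {f g : List A → ℕ} →
  (∀ s → (∀ {y} → y ∈ s → y ∈ xs) → f s ≡ g s) → ∑ (sublists xs) f ≡ ∑ (sublists xs) g
∑-cong-sublists []       h = cong (_+ 0) (h [] λ ())
∑-cong-sublists (x ∷ xs) h =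
  trans (∑-sublists-∷ x xs)
    (trans (∑-cong-sublists xs λ s s⊆ → cong₂ _+_
              (h (x ∷ s) λ where (here e) → here e ; (there i) → there (s⊆ i))
              (h s λ i → there (s⊆ i)))
           (sym (∑-sublists-∷ x xs)))

allB-cong-∈ : ∀ {A : Set} {p q : A → Bool} xs → (∀ x → x ∈ xs → p x ≡ q x) → allB p xs ≡ allB q xs
allB-cong-∈ []       h = refl
allB-cong-∈ (x ∷ xs) h = cong₂ _∧_ (h x (here refl)) (allB-cong-∈ xs λ y i → h y (there i))

¬true⇒false : ∀ {a} → ¬ (a ≡ true) → a ≡ false
¬true⇒false {true}  p = ⊥-elim (p refl)
¬true⇒false {false} p = refl

anyB⁻∈ : ∀ {A : Set} {p : A → Bool} xs → anyB p xs ≡ true → ∃ λ x → x ∈ xs × p x ≡ true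
anyB⁻∈ {p = p} (x ∷ xs) h with ∨⁻ {p x} h
... | inj₁ q = x , here refl , q
... | inj₂ q with anyB⁻∈ xs q
...   | y , i , r = y , there i , r

-- Guarantees that each predicate is enumerated once. For the head x, exactly one of taking and
-- leaving it agrees with `q x`, and the choice does not affect the membership of the other elements
-- because the list has no repetitions.
∑-sublists-δ : ∀ {n} (xs : List (Vec Bool n)) → Unique xs → (q : Vec Bool n → Bool) →
  ∑ (sublists xs) (λ s → ⟦ allB (λ x → iffB (memVec x s) (q x)) xs ⟧) ≡ 1
∑-sublists-δ []       u q = refl
∑-sublists-δ (x ∷ xs) (x∉ ∷ u) q =
  trans (∑-sublists-∷ x xs) (trans (∑-cong-sublists xs step) (∑-sublists-δ xs u q))
  where
  distinct : ∀ {y} → y ∈ xs → ¬ (x ≡ y)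
  distinct i = All.lookup x∉ i
  one : ∀ a b → ⟦ iffB true a ∧ b ⟧ + ⟦ iffB false a ∧ b ⟧ ≡ ⟦ b ⟧
  one true  b = +-identityʳ _
  one false b = refl
  step : ∀ s → (∀ {y} → y ∈ s → y ∈ xs) →
    ⟦ allB (λ y → iffB (memVec y (x ∷ s)) (q y)) (x ∷ xs) ⟧ + ⟦ allB (λ y → iffB (memVec y s) (q y)) (x ∷ xs) ⟧
    ≡ ⟦ allB (λ y → iffB (memVec y s) (q y)) xs ⟧
  step s s⊆ = trans (cong₂ (λ a b → ⟦ a ⟧ + ⟦ b ⟧)
    (cong₂ (λ a b → iffB a (q x) ∧ b)
      (∨⁺ˡ {boolVecEq x x} {memVec x s} (boolVecEq⁺ {U = x} refl))
      (allB-cong-∈ xs λ y i → cong (λ a → iffB (a ∨ memVec y s) (q y)) (¬true⇒false λ e → distinct i (sym (boolVecEq⁻ {U = y} e)))))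
    -- Here it matters that `s` is drawn from `xs`: the element x cannot itself be a member of `s`.
    (cong (λ a → iffB a (q x) ∧ allB (λ y → iffB (memVec y s) (q y)) xs)
      (¬true⇒false λ e → case anyB⁻∈ s e of λ where (y , i , r) → distinct (s⊆ i) (boolVecEq⁻ {U = x} r))))
    (one (q x) (allB (λ y → iffB (memVec y s) (q y)) xs))

Unique-subsets : ∀ n → Unique (subsets n)
Unique-subsets zero    = All.[] ∷ []
Unique-subsets (suc n) = concat⁺
  (AllP.map⁺ (All.universal (λ v → ((λ ()) All.∷ All.[]) ∷ (All.[] ∷ [])) (subsets n)))
  (AllPairsP.map⁺ (AllPairs.map disjoint (Unique-subsets n)))
  where
  disjoint : ∀ {v w : Vec Bool n} → ¬ (v ≡ w) → Disjoint ((true ∷ v) ∷ (false ∷ v) ∷ []) ((true ∷ w) ∷ (false ∷ w) ∷ [])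
  disjoint ne (here refl , here refl)                 = ne refl
  disjoint ne (here refl , there (here ()))
  disjoint ne (here refl , there (there ()))
  disjoint ne (there (here refl) , there (here refl)) = ne refl

-- Quotient orders, level topologies and admissibility

quotOpen : ∀ {n} → (O O′ : Vec Bool n → Bool) → Vec Bool n → Bool
quotOpen {n} O O′ = isOpen (quotT (top n O) O′)

module _ {n : ℕ} {O O′ : Vec Bool n → Bool} where

  -- The transitive closure in impredicative form: y lies above x when every predicate closed under
  -- the generating relation passes from x to y. The Boolean predicates of this kind are the
  -- characteristic functions of the open sets of the quotient.
  quot⁻ : ∀ {x y} → x ≤⟨ quotOpen O O′ ⟩ y → (b : Fin n → Bool) →
          (∀ z w → b z ≡ true → z ≤⟨ O ⟩ w ⊎ w ≤⟨ O′ ⟩ z → b w ≡ true) → b x ≡ true → b y ≡ true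
  quot⁻ {x} {y} le b closed bx = trans (sym (at y))
    (≤⟨⟩⁻ {O = quotOpen O O′} le (V.tabulate b)
      (allB⁺ (allFin n) λ z → allB⁺ (allFin n) λ w → ⇒ᵇ⁺ λ h → trans (at w)
        (closed z w (trans (sym (at z)) (∧⁻ˡ h)) (∨⁻ (∧⁻ʳ {V.lookup (V.tabulate b) z} h))))
      (trans (at x) bx))
    where
    at : ∀ z → V.lookup (V.tabulate b) z ≡ b z
    at = VP.lookup∘tabulate b

  quot⁺ : ∀ {x y} → ((b : Fin n → Bool) →
          (∀ z w → b z ≡ true → z ≤⟨ O ⟩ w ⊎ w ≤⟨ O′ ⟩ z → b w ≡ true) → b x ≡ true → b y ≡ true) →
          x ≤⟨ quotOpen O O′ ⟩ y
  quot⁺ h = ≤⟨⟩⁺ {O = quotOpen O O′} λ W o wx → h (V.lookup W)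
    (λ z w wz s → ⇒ᵇ⁻ (allFinB⁻ (allFinB⁻ o z) w) (∧⁺ wz (stepB z w s))) wx
    where
    stepB : ∀ z w → z ≤⟨ O ⟩ w ⊎ w ≤⟨ O′ ⟩ z → leqT (top n O) z w ∨ leqT (top n O′) w z ≡ true
    stepB z w (inj₁ p) = ∨⁺ˡ p
    stepB z w (inj₂ p) = ∨⁺ʳ {leqT (top n O) z w} p

  quot-forward : ∀ {x y} → x ≤⟨ O ⟩ y → x ≤⟨ quotOpen O O′ ⟩ y
  quot-forward le = quot⁺ λ b closed bx → closed _ _ bx (inj₁ le)

  quot-backward : ∀ {x y} → x ≤⟨ O′ ⟩ y → y ≤⟨ quotOpen O O′ ⟩ x
  quot-backward le = quot⁺ λ b closed by → closed _ _ by (inj₂ le)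

module _ {n p : ℕ} (O : Vec Bool n → Bool) (g : Vec (Fin p) n) where

  -- The order x ≤ y, g x = g y determines the only candidate for the subtopology T′ paired with g.
  nearB : Fin n → Fin n → Bool
  nearB x y = leqT (top n O) x y ∧ finEq (V.lookup g x) (V.lookup g y)

  levelOpen : Vec Bool n → Bool
  levelOpen W = allB (λ x → allB (λ y → not (V.lookup W x ∧ nearB x y) ∨ V.lookup W y) (allFin n)) (allFin n)

  Near : Fin n → Fin n → Set
  Near x y = x ≤⟨ O ⟩ y × V.lookup g x ≡ V.lookup g y

  levelOpen⁻ : ∀ W → levelOpen W ≡ true → ∀ {x y} → Near x y → V.lookup W x ≡ true → V.lookup W y ≡ true
  levelOpen⁻ W h {x} {y} (le , eq) wx = ⇒ᵇ⁻ (allFinB⁻ (allFinB⁻ h x) y) (∧⁺ wx (∧⁺ le (finEq⁺ eq)))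

  levelOpen⁺ : ∀ W → (∀ {x y} → Near x y → V.lookup W x ≡ true → V.lookup W y ≡ true) → levelOpen W ≡ true
  levelOpen⁺ W h = allB⁺ (allFin n) λ x → allB⁺ (allFin n) λ y → ⇒ᵇ⁺ λ q →
    let r = ∧⁻ʳ {V.lookup W x} q in
    h (∧⁻ˡ r , finEq⁻ (∧⁻ʳ {leqT (top n O) x y} r)) (∧⁻ˡ q)

  levelOpen-tabulate : ∀ b → (∀ {x y} → Near x y → b x ≡ true → b y ≡ true) → levelOpen (V.tabulate b) ≡ true
  levelOpen-tabulate b h = levelOpen⁺ (V.tabulate b) λ {x} {y} nr bx →
    trans (VP.lookup∘tabulate b y) (h nr (trans (sym (VP.lookup∘tabulate b x)) bx))

module _ {n : ℕ} (O′ : Vec Bool n → Bool) (Y : Vec Bool n) where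

  record Disconnection (U W : Vec Bool n) : Set where
    field
      openˡ    : O′ U ≡ true
      openʳ    : O′ W ≡ true
      meetsˡ   : ∃ λ x → V.lookup Y x ≡ true × V.lookup U x ≡ true
      meetsʳ   : ∃ λ x → V.lookup Y x ≡ true × V.lookup W x ≡ true
      covers   : ∀ x → V.lookup Y x ≡ true → V.lookup U x ≡ true ⊎ V.lookup W x ≡ true
      disjoint : ∀ x → V.lookup Y x ≡ true → V.lookup U x ≡ true → ¬ (V.lookup W x ≡ true)

  flip-disconnection : ∀ {U W} → Disconnection U W → Disconnection W U
  flip-disconnection d = record
    { openˡ = openʳ ; openʳ = openˡ ; meetsˡ = meetsʳ ; meetsʳ = meetsˡ
    ; covers = λ x yx → swap (covers x yx) ; disjoint = λ x yx wx ux → disjoint x yx ux wx }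
    where open Disconnection d

  private
    disconnectedB : Vec Bool n → Vec Bool n → Bool
    disconnectedB U W =
      O′ U ∧ O′ W ∧
      anyB (λ x → V.lookup Y x ∧ V.lookup U x) (allFin n) ∧
      anyB (λ x → V.lookup Y x ∧ V.lookup W x) (allFin n) ∧
      allB (λ x → not (V.lookup Y x) ∨ (V.lookup U x ∨ V.lookup W x)) (allFin n) ∧
      allB (λ x → not (V.lookup Y x ∧ V.lookup U x ∧ V.lookup W x)) (allFin n)

    disconnected⁻ : ∀ U W → disconnectedB U W ≡ true → Disconnection U W
    disconnected⁻ U W h₀ = record
      { openˡ = ∧⁻ˡ h₀
      ; openʳ = ∧⁻ˡ h₁
      ; meetsˡ = map₂ (λ q → ∧⁻ˡ q , ∧⁻ʳ q) (anyB⁻ (allFin n) (∧⁻ˡ h₂))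
      ; meetsʳ = map₂ (λ q → ∧⁻ˡ q , ∧⁻ʳ q) (anyB⁻ (allFin n) (∧⁻ˡ h₃))
      ; covers = λ x yx → ∨⁻ (⇒ᵇ⁻ (allFinB⁻ (∧⁻ˡ h₄) x) yx)
      ; disjoint = λ x yx ux wx → not⁻ (allFinB⁻ h₅ x) (∧⁺ yx (∧⁺ ux wx))
      }
      where
      h₁ = ∧⁻ʳ {O′ U} h₀
      h₂ = ∧⁻ʳ {O′ W} h₁
      h₃ = ∧⁻ʳ {anyB (λ x → V.lookup Y x ∧ V.lookup U x) (allFin n)} h₂
      h₄ = ∧⁻ʳ {anyB (λ x → V.lookup Y x ∧ V.lookup W x) (allFin n)} h₃
      h₅ = ∧⁻ʳ {allB (λ x → not (V.lookup Y x) ∨ (V.lookup U x ∨ V.lookup W x)) (allFin n)} h₄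

    disconnected⁺ : ∀ {U W} → Disconnection U W → disconnectedB U W ≡ true
    disconnected⁺ {U} {W} d = ∧⁺ openˡ (∧⁺ openʳ (∧⁺
      (anyFinB⁺ (proj₁ meetsˡ) (∧⁺ (proj₁ (proj₂ meetsˡ)) (proj₂ (proj₂ meetsˡ)))) (∧⁺
      (anyFinB⁺ (proj₁ meetsʳ) (∧⁺ (proj₁ (proj₂ meetsʳ)) (proj₂ (proj₂ meetsʳ)))) (∧⁺
      (allB⁺ (allFin n) λ x → ⇒ᵇ⁺ λ yx → case covers x yx of λ where
        (inj₁ ux) → ∨⁺ˡ ux
        (inj₂ wx) → ∨⁺ʳ {V.lookup U x} wx)
      (allB⁺ (allFin n) λ x → not⁺ λ q →
        disjoint x (∧⁻ˡ q) (∧⁻ˡ (∧⁻ʳ {V.lookup Y x} q)) (∧⁻ʳ {V.lookup U x} (∧⁻ʳ {V.lookup Y x} q)))))))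
      where open Disconnection d

  connected⁺ : (∀ {U W} → ¬ Disconnection U W) → connectedB O′ Y ≡ true
  connected⁺ h = not⁺ λ e → case anyB⁻ (subsets n) e of λ where
    (U , e′) → case anyB⁻ (subsets n) e′ of λ where (W , e″) → h (disconnected⁻ U W e″)

  connected⁻ : connectedB O′ Y ≡ true → ∀ {U W} → ¬ Disconnection U W
  connected⁻ h {U} {W} d = not⁻ h (anySubsetsB⁺ U (anySubsetsB⁺ W (disconnected⁺ d)))

record Admissible {n : ℕ} (O O′ : Vec Bool n → Bool) : Set where
  field
    finer : ∀ W → O W ≡ true → O′ W ≡ true
    agree : ∀ Y → connectedB O′ Y ≡ true → sameRestrB O′ O Y ≡ true
    sims  : ∀ x y → simT (top n (quotOpen O O′)) x y ≡ simT (top n (quotOpen O′ O′)) x y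

module _ {n : ℕ} {O O′ : Vec Bool n → Bool} where

  admissible⁻ : admissibleB (top n O) O′ ≡ true → Admissible O O′
  admissible⁻ a = record
    { finer = λ W o → ⇒ᵇ⁻ (allSubsetsB⁻ (∧⁻ˡ a) W) o
    ; agree = λ Y c → ⇒ᵇ⁻ (allSubsetsB⁻ (∧⁻ˡ (∧⁻ʳ {finerB O′ O} a)) Y) c
    ; sims  = λ x y → iffB⁻ (allFinB⁻ (allFinB⁻ (∧⁻ʳ {allB (λ Y → not (connectedB O′ Y) ∨ sameRestrB O′ O Y) (subsets n)} (∧⁻ʳ {finerB O′ O} a)) x) y)
    }

  admissible⁺ : Admissible O O′ → admissibleB (top n O) O′ ≡ true
  admissible⁺ a = ∧⁺
    (allB⁺ (subsets n) λ W → ⇒ᵇ⁺ (finer W))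
    (∧⁺ (allB⁺ (subsets n) λ Y → ⇒ᵇ⁺ (agree Y))
        (allB⁺ (allFin n) λ x → allB⁺ (allFin n) λ y → iffB⁺ (sims x y)))
    where open Admissible a

  sameRestr⁻ : ∀ Y → sameRestrB O′ O Y ≡ true → ∀ U → O′ U ≡ true → ∃ λ W → O W ≡ true × W ∩ₛ Y ≡ U ∩ₛ Y
  sameRestr⁻ Y s U o =
    map₂ (λ {W} h → ∧⁻ˡ h , boolVecEq⁻ (∧⁻ʳ {O W} h))
      (anyB⁻ (subsets n) (trans (sym (iffB⁻ (allSubsetsB⁻ s (U ∩ₛ Y)))) (anySubsetsB⁺ U (∧⁺ o (boolVecEq⁺ {U = U ∩ₛ Y} refl)))))

∈-∩⁺ : ∀ {n} {U W : Vec Bool n} {x} → V.lookup U x ≡ true → V.lookup W x ≡ true → V.lookup (U ∩ₛ W) x ≡ true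
∈-∩⁺ {U = U} {W} {x} p q = trans (VP.lookup-zipWith _∧_ x U W) (∧⁺ p q)

∈-∩⁻ˡ : ∀ {n} (U W : Vec Bool n) {x} → V.lookup (U ∩ₛ W) x ≡ true → V.lookup U x ≡ true
∈-∩⁻ˡ U W {x} p = ∧⁻ˡ (trans (sym (VP.lookup-zipWith _∧_ x U W)) p)

combine-monoʳ-< : ∀ {p m} (i : Fin p) {j k : Fin m} → j F.< k → combine i j F.< combine i k
combine-monoʳ-< {m = m} i {j} {k} lt =
  subst₂ _<_ (sym (FP.toℕ-combine i j)) (sym (FP.toℕ-combine i k)) (+-monoʳ-< (m * toℕ i) lt)

-- Admissible topologies and lexicographic maps

module _ {n p m : ℕ} (O O′ : Vec Bool n → Bool) (g : Vec (Fin p) n) (f : Vec (Fin m) n) where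

  private
    lex : Vec (Fin (p * m)) n
    lex = V.zipWith combine g f

    lookup-lex : ∀ x → V.lookup lex x ≡ combine (V.lookup g x) (V.lookup f x)
    lookup-lex x = VP.lookup-zipWith combine x g f

  module FromAdmissible (t′ : Topology O′) (a : Admissible O O′)
                        (sf : StrictMap O′ f) (sg : StrictMap (quotOpen O O′) g) where
    open Admissible a

    ≤′-coarsen : ∀ {x y} → x ≤⟨ O′ ⟩ y → x ≤⟨ O ⟩ y
    ≤′-coarsen le = ≤⟨⟩⁺ {O = O} λ W o → ≤⟨⟩⁻ {O = O′} le W (finer W o)

    -- A relation of T′ is also one of T, and T/T′ adds its reverse, so its two points become
    -- equivalent in the quotient, where `g` is constant.
    ≤′-level : ∀ {x y} → x ≤⟨ O′ ⟩ y → V.lookup g x ≡ V.lookup g y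
    ≤′-level le = const sg (quot-forward {O = O} {O′} (≤′-coarsen le)) (quot-backward {O = O} {O′} le)

    -- The class of x under T′/T′ is its connected component in T′. The part of a disconnection that
    -- contains x is closed, inside the class, under relations of T′ in both directions, so it
    -- exhausts the class and leaves nothing for the other part.
    component-connected : ∀ x → connectedB O′ (V.tabulate (leqT (top n (quotOpen O′ O′)) x)) ≡ true
    component-connected x = connected⁺ O′ Y λ d → case Disconnection.covers d x x∈Y of λ where
        (inj₁ ux) → absorb d ux
        (inj₂ wx) → absorb (flip-disconnection O′ Y d) wx
      where
      Q = quotOpen O′ O′
      Y = V.tabulate (leqT (top n Q) x)
      Y⁺ : ∀ {z} → x ≤⟨ Q ⟩ z → V.lookup Y z ≡ true
      Y⁺ {z} le = trans (VP.lookup∘tabulate _ z) le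
      Y⁻ : ∀ {z} → V.lookup Y z ≡ true → x ≤⟨ Q ⟩ z
      Y⁻ {z} yz = trans (sym (VP.lookup∘tabulate _ z)) yz
      x∈Y : V.lookup Y x ≡ true
      x∈Y = Y⁺ (≤⟨⟩-refl Q x)
      absorb : ∀ {U W} → Disconnection O′ Y U W → V.lookup U x ≡ true → ⊥
      absorb {U} {W} d ux =
        let (w , yw , ww) = meetsʳ
            b z = V.lookup Y z ∧ V.lookup U z
        in disjoint w yw (∧⁻ʳ {V.lookup Y w} (quot⁻ {O = O′} {O′} (Y⁻ yw) b closed (∧⁺ x∈Y ux))) ww
        where
        open Disconnection d
        closed : ∀ z w → V.lookup Y z ∧ V.lookup U z ≡ true → z ≤⟨ O′ ⟩ w ⊎ w ≤⟨ O′ ⟩ z → V.lookup Y w ∧ V.lookup U w ≡ true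
        closed z w h (inj₁ le) =
          ∧⁺ (Y⁺ (≤⟨⟩-trans Q (Y⁻ (∧⁻ˡ h)) (quot-forward {O = O′} {O′} le)))
             (≤⟨⟩⁻ {O = O′} le U openˡ (∧⁻ʳ {V.lookup Y z} h))
        -- Going down stays in `U` because `W` is open: were w in `W`, the point z above it would be
        -- in `W` as well.
        closed z w h (inj₂ ge) = ∧⁺ yw (case covers w yw of λ where
            (inj₁ uw) → uw
            (inj₂ ww) → ⊥-elim (disjoint z (∧⁻ˡ h) (∧⁻ʳ {V.lookup Y z} h) (≤⟨⟩⁻ {O = O′} ge W openʳ ww)))
          where
          yw : V.lookup Y w ≡ true
          yw = Y⁺ (≤⟨⟩-trans Q (Y⁻ (∧⁻ˡ h)) (quot-backward {O = O′} {O′} ge))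

    -- If the reverse relation failed, strictness of `g` on T/T′ would separate the two values.
    ≤-level⇒≥Q : ∀ {x y} → x ≤⟨ O ⟩ y → V.lookup g x ≡ V.lookup g y → y ≤⟨ quotOpen O O′ ⟩ x
    ≤-level⇒≥Q {x} {y} le eq with true? (leqT (top n (quotOpen O O′)) y x)
    ... | inj₁ ge = ge
    ... | inj₂ ng = ⊥-elim (<⇒≢ (strict sg (quot-forward {O = O} {O′} le) ng) (cong toℕ eq))

    -- The points are equivalent in T/T′, hence by admissibility in T′/T′, so y lies in the
    -- connected component of x. On that component T and T′ have the same trace, which transfers the
    -- relation.
    ≤-level⇒≤′ : ∀ {x y} → x ≤⟨ O ⟩ y → V.lookup g x ≡ V.lookup g y → x ≤⟨ O′ ⟩ y
    ≤-level⇒≤′ {x} {y} le eq = ≤⟨⟩⁺ {O = O′} λ U o ux →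
      let (W , oW , W∩Y≡) = sameRestr⁻ {O = O} {O′} Y (agree Y (component-connected x)) U o
          x∈W = ∈-∩⁻ˡ W Y (trans (cong (λ V → V.lookup V x) W∩Y≡) (∈-∩⁺ {U = U} {Y} ux (Y⁺ (≤⟨⟩-refl Q x))))
          y∈W = ≤⟨⟩⁻ {O = O} le W oW x∈W
      in ∈-∩⁻ˡ U Y (trans (cong (λ V → V.lookup V y) (sym W∩Y≡)) (∈-∩⁺ {U = W} {Y} y∈W (Y⁺ x≤Qy)))
      where
      Q = quotOpen O′ O′
      Y = V.tabulate (leqT (top n Q) x)
      Y⁺ : ∀ {z} → x ≤⟨ Q ⟩ z → V.lookup Y z ≡ true
      Y⁺ {z} le = trans (VP.lookup∘tabulate _ z) le
      x≤Qy : x ≤⟨ Q ⟩ y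
      x≤Qy = ∧⁻ˡ (trans (sym (sims x y)) (∧⁺ (quot-forward {O = O} {O′} le) (≤-level⇒≥Q le eq)))

    -- The order of T′ is now known to be `Near`, and a finite topology is determined by its order.
    level-unique : ∀ W → O′ W ≡ levelOpen O g W
    level-unique W = bool-ext
      (λ o → levelOpen⁺ O g W λ (le , eq) wx → ≤⟨⟩⁻ {O = O′} (≤-level⇒≤′ le eq) W o wx)
      (λ h → upclosed⇒open t′ W λ le wx → levelOpen⁻ O g W h (≤′-coarsen le , ≤′-level le) wx)

    lex-strictMap : StrictMap O lex
    lex-strictMap = strictMap (λ {x} {y} p q → subst₂ F._<_ (sym (lookup-lex x)) (sym (lookup-lex y)) (lex< p q))
                              (λ {x} {y} p q → trans (lookup-lex x) (trans (lex≡ p q) (sym (lookup-lex y))))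
      where
      lex< : ∀ {x y} → x ≤⟨ O ⟩ y → ¬ (y ≤⟨ O ⟩ x) →
             combine (V.lookup g x) (V.lookup f x) F.< combine (V.lookup g y) (V.lookup f y)
      -- A strict relation of T either stays strict in T/T′, where `g` increases, or becomes an
      -- equivalence there; then `g` is constant, the relation belongs to T′ and `f` increases.
      lex< {x} {y} p q with true? (leqT (top n (quotOpen O O′)) y x)
      ... | inj₂ ng = FP.combine-monoˡ-< (V.lookup f x) (V.lookup f y) (strict sg (quot-forward {O = O} {O′} p) ng)
      ... | inj₁ ge = subst (λ i → combine (V.lookup g x) (V.lookup f x) F.< combine i (V.lookup f y)) eq
          (combine-monoʳ-< (V.lookup g x) (strict sf (≤-level⇒≤′ p eq) (q ∘ ≤′-coarsen)))
        where
        eq : V.lookup g x ≡ V.lookup g y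
        eq = const sg (quot-forward {O = O} {O′} p) ge
      lex≡ : ∀ {x y} → x ≤⟨ O ⟩ y → y ≤⟨ O ⟩ x →
             combine (V.lookup g x) (V.lookup f x) ≡ combine (V.lookup g y) (V.lookup f y)
      lex≡ {x} {y} p q = cong₂ combine eq (const sf (≤-level⇒≤′ p eq) (≤-level⇒≤′ q (sym eq)))
        where
        eq : V.lookup g x ≡ V.lookup g y
        eq = const sg (quot-forward {O = O} {O′} p) (quot-forward {O = O} {O′} q)

  module FromLex (t : Topology O) (s : StrictMap O lex) (level : ∀ W → O′ W ≡ levelOpen O g W) where

    private
      g′ : Fin n → ℕ
      g′ x = toℕ (V.lookup g x)

      lex-< : ∀ {x y} → x ≤⟨ O ⟩ y → ¬ (y ≤⟨ O ⟩ x) →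
              combine (V.lookup g x) (V.lookup f x) F.< combine (V.lookup g y) (V.lookup f y)
      lex-< {x} {y} p q = subst₂ F._<_ (lookup-lex x) (lookup-lex y) (strict s p q)

      lex-≡ : ∀ {x y} → x ≤⟨ O ⟩ y → y ≤⟨ O ⟩ x → V.lookup g x ≡ V.lookup g y × V.lookup f x ≡ V.lookup f y
      lex-≡ {x} {y} p q = FP.combine-injective (V.lookup g x) (V.lookup f x) (V.lookup g y) (V.lookup f y)
        (subst₂ _≡_ (lookup-lex x) (lookup-lex y) (const s p q))

      -- A drop in the dominant coordinate would be a drop in the lexicographic order.
      g-mono : ∀ {x y} → x ≤⟨ O ⟩ y → g′ x ≤ g′ y
      g-mono {x} {y} p with true? (leqT (top n O) y x)
      ... | inj₁ q = ≤-reflexive (cong toℕ (proj₁ (lex-≡ p q)))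
      ... | inj₂ q = ≮⇒≥ λ gy<gx → <-asym (lex-< p q) (FP.combine-monoˡ-< (V.lookup f y) (V.lookup f x) gy<gx)

      f-strict : ∀ {x y} → x ≤⟨ O ⟩ y → ¬ (y ≤⟨ O ⟩ x) → V.lookup g x ≡ V.lookup g y → V.lookup f x F.< V.lookup f y
      f-strict {x} {y} p q eq = ≰⇒> λ fy≤fx → case m≤n⇒m<n∨m≡n fy≤fx of λ where
          (inj₁ lt) → <-asym less (combine-monoʳ-< (V.lookup g x) lt)
          (inj₂ e)  → <⇒≢ less (cong (λ j → toℕ (combine (V.lookup g x) j)) (sym (toℕ-injective e)))
        where
        less : combine (V.lookup g x) (V.lookup f x) F.< combine (V.lookup g x) (V.lookup f y)
        less = subst (λ i → combine (V.lookup g x) (V.lookup f x) F.< combine i (V.lookup f y)) (sym eq) (lex-< p q)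

      -- Tested on the set of all points `Near` above x, which is open in T′ because `Near` is
      -- transitive.
      ≤′⁻ : ∀ {x y} → x ≤⟨ O′ ⟩ y → Near O g x y
      ≤′⁻ {x} {y} le = ∧⁻ˡ near , finEq⁻ (∧⁻ʳ {leqT (top n O) x y} near)
        where
        near : nearB O g x y ≡ true
        near = trans (sym (VP.lookup∘tabulate _ y)) (≤⟨⟩⁻ {O = O′} le (V.tabulate (nearB O g x))
          (trans (level _) (levelOpen-tabulate O g (nearB O g x) λ {z} {w} (le , eq) xz →
            ∧⁺ (≤⟨⟩-trans O (∧⁻ˡ xz) le) (finEq⁺ {i = V.lookup g x} (trans (finEq⁻ (∧⁻ʳ {leqT (top n O) x z} xz)) eq))))
          (trans (VP.lookup∘tabulate _ x) (∧⁺ (≤⟨⟩-refl O x) (finEq⁺ {i = V.lookup g x} refl))))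

      ≤′⁺ : ∀ {x y} → Near O g x y → x ≤⟨ O′ ⟩ y
      ≤′⁺ nr = ≤⟨⟩⁺ {O = O′} λ W o wx → levelOpen⁻ O g W (trans (sym (level W)) o) nr wx

      O⇒O′ : ∀ W → O W ≡ true → O′ W ≡ true
      O⇒O′ W o = trans (level W) (levelOpen⁺ O g W λ (le , _) wx → ≤⟨⟩⁻ {O = O} le W o wx)

      Q Q′ : Vec Bool n → Bool
      Q  = quotOpen O O′
      Q′ = quotOpen O′ O′

      -- Both generating steps respect `g`: it is monotone along T and constant along T′.
      Q-mono : ∀ {x y} → x ≤⟨ Q ⟩ y → g′ x ≤ g′ y
      Q-mono {x} {y} le = ≤ᵇ⁻ {g′ x} (quot⁻ {O = O} {O′} le (λ z → g′ x ≤ᵇ g′ z)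
        (λ z w h st → ≤ᵇ⁺ (≤-trans (≤ᵇ⁻ {g′ x} h) (case st of λ where
          (inj₁ p) → g-mono p
          (inj₂ p) → ≤-reflexive (cong toℕ (sym (proj₂ (≤′⁻ p)))))))
        (≤ᵇ⁺ {g′ x} ≤-refl))
        where
        ≤ᵇ⁺ : ∀ {a b} → a ≤ b → (a ≤ᵇ b) ≡ true
        ≤ᵇ⁺ p = Equivalence.to T-≡ (≤⇒≤ᵇ p)
        ≤ᵇ⁻ : ∀ {a b} → (a ≤ᵇ b) ≡ true → a ≤ b
        ≤ᵇ⁻ {a} {b} p = ≤ᵇ⇒≤ a b (Equivalence.from T-≡ p)

      -- A Near-closed part of the level of x becomes Q-closed once all higher levels are added.
      level-set : ∀ x (b : Fin n → Bool) →
        (∀ z w → V.lookup g z ≡ V.lookup g x → b z ≡ true → Near O g z w ⊎ Near O g w z → b w ≡ true) →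
        ∀ {y} → x ≤⟨ Q ⟩ y → V.lookup g x ≡ V.lookup g y → b x ≡ true → b y ≡ true
      level-set x b closed {y} le eq bx with ∨⁻ {finLt (V.lookup g x) (V.lookup g y)}
          (quot⁻ {O = O} {O′} le (λ z → finLt (V.lookup g x) (V.lookup g z) ∨ (finEq (V.lookup g x) (V.lookup g z) ∧ b z)) up
            (∨⁺ʳ {finLt (V.lookup g x) (V.lookup g x)} (∧⁺ (finEq⁺ {i = V.lookup g x} refl) bx)))
        where
        above : ∀ {w} → V.lookup g x F.< V.lookup g w → finLt (V.lookup g x) (V.lookup g w) ∨ (finEq (V.lookup g x) (V.lookup g w) ∧ b w) ≡ true
        above lt = ∨⁺ˡ (finLt⁺ lt)
        same : ∀ {w} → V.lookup g x ≡ V.lookup g w → b w ≡ true → finLt (V.lookup g x) (V.lookup g w) ∨ (finEq (V.lookup g x) (V.lookup g w) ∧ b w) ≡ true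
        same {w} e bw = ∨⁺ʳ {finLt (V.lookup g x) (V.lookup g w)} (∧⁺ (finEq⁺ e) bw)
        up : ∀ z w → finLt (V.lookup g x) (V.lookup g z) ∨ (finEq (V.lookup g x) (V.lookup g z) ∧ b z) ≡ true →
             z ≤⟨ O ⟩ w ⊎ w ≤⟨ O′ ⟩ z →
             finLt (V.lookup g x) (V.lookup g w) ∨ (finEq (V.lookup g x) (V.lookup g w) ∧ b w) ≡ true
        up z w h st with ∨⁻ {finLt (V.lookup g x) (V.lookup g z)} h | st
        ... | inj₁ lt | inj₁ p = above (<-≤-trans (finLt⁻ {i = V.lookup g x} lt) (g-mono p))
        ... | inj₁ lt | inj₂ p = above (<-≤-trans (finLt⁻ {i = V.lookup g x} lt) (≤-reflexive (cong toℕ (sym (proj₂ (≤′⁻ p))))))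
        ... | inj₂ h′ | inj₂ p = same (trans e (sym (proj₂ nr))) (closed z w (sym e) (∧⁻ʳ {finEq (V.lookup g x) (V.lookup g z)} h′) (inj₂ nr))
          where
          e = finEq⁻ {i = V.lookup g x} (∧⁻ˡ h′)
          nr = ≤′⁻ p
        -- A relation of T starting in the level of x either goes up to a higher level or stays, and
        -- then it is a `Near` step.
        ... | inj₂ h′ | inj₁ p with m≤n⇒m<n∨m≡n (g-mono p)
        ...   | inj₁ lt = above (subst (λ i → i F.< V.lookup g w) (sym (finEq⁻ {i = V.lookup g x} (∧⁻ˡ h′))) lt)
        ...   | inj₂ q  = same (trans e (toℕ-injective q)) (closed z w (sym e) (∧⁻ʳ {finEq (V.lookup g x) (V.lookup g z)} h′) (inj₁ (p , toℕ-injective q)))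
          where
          e = finEq⁻ {i = V.lookup g x} (∧⁻ˡ h′)
      ... | inj₁ lt = ⊥-elim (<⇒≢ (finLt⁻ {i = V.lookup g x} lt) (cong toℕ eq))
      ... | inj₂ h  = ∧⁻ʳ {finEq (V.lookup g x) (V.lookup g y)} h

      -- A path in the quotient between points of one level cannot leave that level, as `g` never
      -- decreases along it, so it uses only relations of T′ and their reverses.
      Q⇒Q′ : ∀ {x y} → x ≤⟨ Q ⟩ y → V.lookup g x ≡ V.lookup g y → x ≤⟨ Q′ ⟩ y
      Q⇒Q′ {x} le eq = quot⁺ {O = O′} {O′} λ b closed bx → level-set x b
        (λ z w _ bz → λ where
          (inj₁ nr) → closed z w bz (inj₁ (≤′⁺ nr))
          (inj₂ nr) → closed z w bz (inj₂ (≤′⁺ nr))) le eq bx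

      Q′⇒Q : ∀ {x y} → x ≤⟨ Q′ ⟩ y → x ≤⟨ Q ⟩ y
      Q′⇒Q le = quot⁺ {O = O} {O′} λ b closed bx → quot⁻ {O = O′} {O′} le b
        (λ z w bz → λ where
          (inj₁ p) → closed z w bz (inj₁ (proj₁ (≤′⁻ p)))
          (inj₂ p) → closed z w bz (inj₂ p)) bx

      -- Inside a level the generating relation is symmetric, so the complement of a closed
      -- predicate is closed there too, and `level-set` applies to `not ∘ b`.
      Q-level-sym : ∀ {x y} → x ≤⟨ Q ⟩ y → V.lookup g x ≡ V.lookup g y → y ≤⟨ Q ⟩ x
      Q-level-sym {x} {y} le eq = quot⁺ {O = O} {O′} λ b closed by → case true? (b x) of λ where
        (inj₁ bx)  → bx
        (inj₂ nbx) → ⊥-elim (not⁻ (level-set x (not ∘ b)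
          (λ z w _ nbz → λ where
            (inj₁ nr) → not⁺ λ bw → not⁻ nbz (closed w z bw (inj₂ (≤′⁺ nr)))
            (inj₂ nr) → not⁺ λ bw → not⁻ nbz (closed w z bw (inj₁ (proj₁ nr)))) le eq (not⁺ nbx)) by)

    level-topology : Topology O′
    level-topology = record
      { open-∅ = trans (level _) (levelOpen⁺ O g (∅ₛ n) λ {x} _ p → case trans (sym (VP.lookup-replicate x false)) p of λ ())
      ; open-X = trans (level _) (levelOpen⁺ O g (Xₛ n) λ {x} {y} _ _ → VP.lookup-replicate y true)
      ; open-∪ = λ U W oU oW → trans (level _) (levelOpen⁺ O g (U ∪ₛ W) λ {x} {y} nr p →
          trans (VP.lookup-zipWith _∨_ y U W) (case ∨⁻ (trans (sym (VP.lookup-zipWith _∨_ x U W)) p) of λ where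
            (inj₁ q) → ∨⁺ˡ (up U oU nr q)
            (inj₂ q) → ∨⁺ʳ {V.lookup U y} (up W oW nr q)))
      ; open-∩ = λ U W oU oW → trans (level _) (levelOpen⁺ O g (U ∩ₛ W) λ {x} {y} nr p →
          let q = trans (sym (VP.lookup-zipWith _∧_ x U W)) p in
          trans (VP.lookup-zipWith _∧_ y U W) (∧⁺ (up U oU nr (∧⁻ˡ q)) (up W oW nr (∧⁻ʳ {V.lookup U x} q))))
      }
      where
      up : ∀ U → O′ U ≡ true → ∀ {x y} → Near O g x y → V.lookup U x ≡ true → V.lookup U y ≡ true
      up U o = levelOpen⁻ O g U (trans (sym (level U)) o)

    private
      -- `Near` preserves `g`, so a level set of `g` and its complement are both open in T′ and
      -- would disconnect a set `Y` that meets two levels.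
      connected⇒level : ∀ Y → connectedB O′ Y ≡ true → ∀ {x y} → V.lookup Y x ≡ true → V.lookup Y y ≡ true → V.lookup g x ≡ V.lookup g y
      connected⇒level Y c {x} {y} yx yy with true? (finEq (V.lookup g x) (V.lookup g y))
      ... | inj₁ e = finEq⁻ e
      ... | inj₂ ne = ⊥-elim (connected⁻ O′ Y c {V.tabulate b} {V.tabulate (not ∘ b)} record
          { openˡ = trans (level _) (levelOpen-tabulate O g b λ (_ , e) bz → finEq⁺ {i = V.lookup g x} (trans (finEq⁻ bz) e))
          ; openʳ = trans (level _) (levelOpen-tabulate O g (not ∘ b) λ (_ , e) nbz → not⁺ λ bw → not⁻ nbz (finEq⁺ {i = V.lookup g x} (trans (finEq⁻ bw) (sym e))))
          ; meetsˡ = x , yx , trans (VP.lookup∘tabulate b x) (finEq⁺ {i = V.lookup g x} refl)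
          ; meetsʳ = y , yy , trans (VP.lookup∘tabulate (not ∘ b) y) (not⁺ ne)
          ; covers = λ z _ → case true? (b z) of λ where
              (inj₁ bz)  → inj₁ (trans (VP.lookup∘tabulate b z) bz)
              (inj₂ nbz) → inj₂ (trans (VP.lookup∘tabulate (not ∘ b) z) (not⁺ nbz))
          ; disjoint = λ z _ bz nbz → not⁻ (trans (sym (VP.lookup∘tabulate (not ∘ b) z)) nbz) (trans (sym (VP.lookup∘tabulate b z)) bz)
          })
        where
        b : Fin n → Bool
        b z = finEq (V.lookup g x) (V.lookup g z)

      -- For a T′-open `W` the witness is the up-closure in T of `W ∩ₛ Y`. It adds nothing inside
      -- `Y`: as `Y` lies in one level of `g`, every relation of T within it is a relation of T′.
      same-restriction : ∀ Y → connectedB O′ Y ≡ true → sameRestrB O′ O Y ≡ true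
      same-restriction Y c = allB⁺ (subsets n) λ U → iffB⁺ (bool-ext
          (λ h → case anyB⁻ (subsets n) h of λ where
            (W , q) → anySubsetsB⁺ (closure W) (∧⁺ (closure-open W) (boolVecEq⁺ (trans (closure-restricts W (∧⁻ˡ q)) (boolVecEq⁻ (∧⁻ʳ {O′ W} q))))))
          (λ h → case anyB⁻ (subsets n) h of λ where
            (W , q) → anySubsetsB⁺ W (∧⁺ (O⇒O′ W (∧⁻ˡ q)) (∧⁻ʳ {O W} q))))
        where
        fromB : Vec Bool n → Fin n → Fin n → Bool
        fromB W w z = (V.lookup W z ∧ V.lookup Y z) ∧ leqT (top n O) z w
        aboveB : Vec Bool n → Fin n → Bool
        aboveB W w = anyB (fromB W w) (allFin n)
        closure : Vec Bool n → Vec Bool n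
        closure W = V.tabulate (aboveB W)
        closure-open : ∀ W → O (closure W) ≡ true
        closure-open W = upclosed⇒open t (closure W) λ {x} {y} le p →
          case anyB⁻ (allFin n) (trans (sym (VP.lookup∘tabulate (aboveB W) x)) p) of λ where
            (z , q) → trans (VP.lookup∘tabulate (aboveB W) y)
              (anyFinB⁺ z (∧⁺ (∧⁻ˡ q) (≤⟨⟩-trans O (∧⁻ʳ {V.lookup W z ∧ V.lookup Y z} q) le)))
        closure-restricts : ∀ W → O′ W ≡ true → closure W ∩ₛ Y ≡ W ∩ₛ Y
        closure-restricts W o = vec-ext λ w → trans (VP.lookup-zipWith _∧_ w (closure W) Y)
          (trans (trans (cong (_∧ V.lookup Y w) (VP.lookup∘tabulate (aboveB W) w)) (bool-ext
            (λ h → case anyB⁻ (allFin n) (∧⁻ˡ h) of λ where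
              (z , q) → let wy = ∧⁻ˡ q
                            yw = ∧⁻ʳ {aboveB W w} h
                        in ∧⁺ (levelOpen⁻ O g W (trans (sym (level W)) o)
                               (∧⁻ʳ {V.lookup W z ∧ V.lookup Y z} q , connected⇒level Y c (∧⁻ʳ {V.lookup W z} wy) yw) (∧⁻ˡ wy)) yw)
            (λ h → ∧⁺ (anyFinB⁺ w (∧⁺ h (≤⟨⟩-refl O w))) (∧⁻ʳ {V.lookup W w} h))))
          (sym (VP.lookup-zipWith _∧_ w W Y)))

    level-admissible : Admissible O O′
    level-admissible = record
      { finer = O⇒O′
      ; agree = same-restriction
      -- Points equivalent in T/T′ have equal `g` by monotonicity in both directions, and within a
      -- level the two quotients agree.
      ; sims = λ x y → bool-ext
          (λ h → let p = ∧⁻ˡ {leqT (top n Q) x y} h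
                     q = ∧⁻ʳ {leqT (top n Q) x y} h
                     e = toℕ-injective (≤-antisym (Q-mono p) (Q-mono q))
                 in ∧⁺ (Q⇒Q′ p e) (Q⇒Q′ q (sym e)))
          (λ h → ∧⁺ (Q′⇒Q (∧⁻ˡ {leqT (top n Q′) x y} h)) (Q′⇒Q (∧⁻ʳ {leqT (top n Q′) x y} h)))
      }

    f-strictMap : StrictMap O′ f
    f-strictMap = strictMap
      (λ p q → let (le , e) = ≤′⁻ p in f-strict le (λ ge → q (≤′⁺ (ge , sym e))) e)
      (λ p q → proj₂ (lex-≡ (proj₁ (≤′⁻ p)) (proj₁ (≤′⁻ q))))

    -- Monotonicity is `Q-mono`; if `g` failed to increase along a strict relation, `Q-level-sym`
    -- would reverse that relation.
    g-strictMap : StrictMap (quotOpen O O′) g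
    g-strictMap = strictMap
      (λ p q → ≤∧≢⇒< (Q-mono p) λ e → q (Q-level-sym p (toℕ-injective e)))
      (λ p q → toℕ-injective (≤-antisym (Q-mono p) (Q-mono q)))

module _ {n : ℕ} {O : Vec Bool n → Bool} (t : Topology O) where

  private
    member : List (Vec Bool n) → Vec Bool n → Bool
    member fam W = memVec W fam

    T = top n O

  -- By `characterise` a family passes all tests exactly when the pair is lexicographically
  -- compatible and membership agrees with `levelOpen O g`; the first condition leaves the sum and
  -- `∑-sublists-δ` evaluates the rest to 1.
  ∑-admissible : ∀ {p m} (g : Vec (Fin p) n) (f : Vec (Fin m) n) →
    ∑ (sublists (subsets n)) (λ fam → let O′ = member fam in
      ⟦ (isTopologyB (top n O′) ∧ admissibleB T O′) ∧ (compatible (top n O′) f ∧ compatible (quotT T O′) g) ⟧) ≡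
    ⟦ compatible T (V.zipWith combine g f) ⟧
  ∑-admissible g f = begin
    ∑ (sublists (subsets n)) (λ fam → ⟦ pairs (member fam) ⟧)
      ≡⟨ ∑-cong (sublists (subsets n)) (λ fam → trans (cong ⟦_⟧ (characterise fam)) (⟦∧⟧ (compatible T lex) _)) ⟩
    ∑ (sublists (subsets n)) (λ fam → ⟦ compatible T lex ⟧ * ⟦ allB (λ W → iffB (memVec W fam) (levelOpen O g W)) (subsets n) ⟧)
      ≡⟨ ∑-*ˡ (sublists (subsets n)) ⟦ compatible T lex ⟧ ⟩
    _ ≡⟨ cong (⟦ compatible T lex ⟧ *_) (∑-sublists-δ (subsets n) (Unique-subsets n) (levelOpen O g)) ⟩
    _ ≡⟨ *-identityʳ _ ⟩
    _ ∎
    where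
    open ≡-Reasoning
    lex = V.zipWith combine g f
    pairs : (Vec Bool n → Bool) → Bool
    pairs O′ = (isTopologyB (top n O′) ∧ admissibleB T O′) ∧ (compatible (top n O′) f ∧ compatible (quotT T O′) g)

    characterise : ∀ fam → pairs (member fam) ≡
      compatible T lex ∧ allB (λ W → iffB (memVec W fam) (levelOpen O g W)) (subsets n)
    characterise fam = bool-ext
      (λ h → let ta = ∧⁻ˡ h
                 fg = ∧⁻ʳ {isTopologyB (top n O′) ∧ admissibleB T O′} h
                 open FromAdmissible O O′ g f (isTopology⁻ (∧⁻ˡ ta)) (admissible⁻ (∧⁻ʳ {isTopologyB (top n O′)} ta))
                   (compatible⁻ O′ f (∧⁻ˡ fg)) (compatible⁻ (quotOpen O O′) g (∧⁻ʳ {compatible (top n O′) f} fg))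
             in ∧⁺ (compatible⁺ O lex lex-strictMap) (allB⁺ (subsets n) λ W → iffB⁺ (level-unique W)))
      (λ h → let open FromLex O O′ g f t (compatible⁻ O lex (∧⁻ˡ h))
                   (λ W → iffB⁻ (allSubsetsB⁻ (∧⁻ʳ {compatible T lex} h) W))
             in ∧⁺ (∧⁺ (isTopology⁺ level-topology) (admissible⁺ level-admissible))
                   (∧⁺ (compatible⁺ O′ f f-strictMap) (compatible⁺ (quotOpen O O′) g g-strictMap)))
      where
      O′ = member fam

  -- Exchanging the sum over T′ with those over `g` and `f` isolates, for each pair, the number of
  -- suitable T′. The composition `c` goes with T′ and `f`, and `d` with T/T′ and `g`: the quotient
  -- supplies the dominant coordinate.
  lam-ΓH : lam⊗ (ΓH T) ≈⊗ ρQ (lam T)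
  lam-ΓH c d = begin
    coeff⊗ c d (lam⊗ (ΓH T))
      ≡⟨ trans (coeff⊗-lam⊗ c d (ΓH T)) (trans (∑-map _ (filterB (admissibleB T) (topologiesOn n)))
           (trans (∑-filterB (admissibleB T) (topologiesOn n)) (trans (∑-filterB (λ O′ → isTopologyB (top n O′)) (L.map member fams)) (∑-map member fams)))) ⟩
    ∑ fams (λ fam → ⟦ isTop fam ⟧ * (⟦ adm fam ⟧ * (coeff c (lam (sub fam)) * coeff d (lam (quo fam)))))
      ≡⟨ trans (∑-cong fams λ fam → trans (cong (λ x → ⟦ isTop fam ⟧ * (⟦ adm fam ⟧ * x)) (cong₂ _*_ (coeff-lam (sub fam) c) (coeff-lam (quo fam) d)))
           (rearrange ⟦ isTop fam ⟧ ⟦ adm fam ⟧ ⟦ posB c ⟧ ⟦ posB d ⟧ _ _)) (∑-*ˡ fams both) ⟩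
    both * ∑ fams (λ fam → ⟦ isTop fam ⟧ * ⟦ adm fam ⟧ * (compatibleCount (quo fam) p d * compatibleCount (sub fam) m c))
      ≡⟨ cong (both *_) (∑-cong fams expand) ⟩
    both * ∑ fams (λ fam → ∑ (maps p n) (λ g → ∑ (maps m n) (λ f → ⟦ good fam g f ⟧ * (⟦ natListEq d (sizes g) ⟧ * ⟦ natListEq c (sizes f) ⟧))))
      ≡⟨ cong (both *_) (trans (∑-swap fams (maps p n)) (∑-cong (maps p n) λ g → ∑-swap fams (maps m n))) ⟩
    both * ∑ (maps p n) (λ g → ∑ (maps m n) (λ f → ∑ fams (λ fam → ⟦ good fam g f ⟧ * (⟦ natListEq d (sizes g) ⟧ * ⟦ natListEq c (sizes f) ⟧))))
      ≡⟨ cong (both *_) (∑-cong (maps p n) λ g → ∑-cong (maps m n) λ f →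
           trans (∑-*ʳ fams (⟦ natListEq d (sizes g) ⟧ * ⟦ natListEq c (sizes f) ⟧)) (*-congˡ (∑-admissible g f))) ⟩
    both * ∑ (maps p n) (λ g → ∑ (maps m n) (λ f → ⟦ compatible T (V.zipWith combine g f) ⟧ * (⟦ natListEq d (sizes g) ⟧ * ⟦ natListEq c (sizes f) ⟧)))
      ≡⟨ coeff-ρQ-lam T c d ⟨
    _ ∎
    where
    open ≡-Reasoning
    p = length d
    m = length c
    both = ⟦ posB c ⟧ * ⟦ posB d ⟧
    fams = sublists (subsets n)
    sub quo : List (Vec Bool n) → Top
    sub fam = top n (member fam)
    quo fam = quotT T (member fam)
    isTop adm : List (Vec Bool n) → Bool
    isTop fam = isTopologyB (sub fam)
    adm fam = admissibleB T (member fam)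
    good : List (Vec Bool n) → Vec (Fin p) n → Vec (Fin m) n → Bool
    good fam g f = (isTop fam ∧ adm fam) ∧ (compatible (sub fam) f ∧ compatible (quo fam) g)

    rearrange : ∀ s a x y u v → s * (a * (x * u * (y * v))) ≡ x * y * (s * a * (v * u))
    rearrange = solve 6 (λ s a x y u v → s :* (a :* (x :* u :* (y :* v))) := x :* y :* (s :* a :* (v :* u))) refl

    regroup : ∀ s a q e q′ e′ → ⟦ s ⟧ * ⟦ a ⟧ * (⟦ q ⟧ * ⟦ e ⟧ * (⟦ q′ ⟧ * ⟦ e′ ⟧)) ≡ ⟦ (s ∧ a) ∧ (q′ ∧ q) ⟧ * (⟦ e ⟧ * ⟦ e′ ⟧)
    regroup s a q e q′ e′ rewrite ⟦∧⟧ (s ∧ a) (q′ ∧ q) | ⟦∧⟧ s a | ⟦∧⟧ q′ q =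
      solve 6 (λ s a q e q′ e′ → s :* a :* (q :* e :* (q′ :* e′)) := s :* a :* (q′ :* q) :* (e :* e′)) refl
        ⟦ s ⟧ ⟦ a ⟧ ⟦ q ⟧ ⟦ e ⟧ ⟦ q′ ⟧ ⟦ e′ ⟧

    expand : ∀ fam → ⟦ isTop fam ⟧ * ⟦ adm fam ⟧ * (compatibleCount (quo fam) p d * compatibleCount (sub fam) m c) ≡
      ∑ (maps p n) (λ g → ∑ (maps m n) (λ f → ⟦ good fam g f ⟧ * (⟦ natListEq d (sizes g) ⟧ * ⟦ natListEq c (sizes f) ⟧)))
    expand fam = trans (cong (⟦ isTop fam ⟧ * ⟦ adm fam ⟧ *_) (∑-product (maps p n) (maps m n)))
      (trans (sym (∑-*ˡ (maps p n) (⟦ isTop fam ⟧ * ⟦ adm fam ⟧))) (∑-cong (maps p n) λ g →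
        trans (sym (∑-*ˡ (maps m n) (⟦ isTop fam ⟧ * ⟦ adm fam ⟧))) (∑-cong (maps m n) λ f →
          regroup (isTop fam) (adm fam) (compatible (quo fam) g) (natListEq d (sizes g)) (compatible (sub fam) f) (natListEq c (sizes f)))))

theorem5p6 : ((T₁ T₂ : Top) → IsTopology T₁ → IsTopology T₂ → Homeomorphic T₁ T₂ → lam T₁ ≈Q lam T₂)
    × (lam unitT ≈Q oneQ)
    × ((T₁ T₂ : Top) → IsTopology T₁ → IsTopology T₂ → lam (prodT T₁ T₂) ≈Q mulQ (lam T₁) (lam T₂))
    × ((T : Top) → IsTopology T → counitQ (lam T) ≡ counitH T)
    × ((T : Top) → IsTopology T → lam⊗ (ΔH T) ≈⊗ ΔQ (lam T))
    × ((T : Top) → IsTopology T → lam⊗ (ΓH T) ≈⊗ ρQ (lam T))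
theorem5p6 =
    (λ (top _ O₁) (top _ O₂) _ _ homeo → lam-homeomorphic {O₁ = O₁} {O₂} homeo)
  , (λ c → refl)
  , (λ (top _ O₁) (top _ O₂) t₁ t₂ → lam-prodT (isTopology⁻ {O = O₁} t₁) (isTopology⁻ {O = O₂} t₂))
  , (λ T _ → counit-lam T)
  , (λ (top _ O) t → lam-ΔH (isTopology⁻ {O = O} t))
  , (λ (top _ O) t → lam-ΓH (isTopology⁻ {O = O} t))
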